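{- There is a constant $c>0$ such that, for every $n$ (for all sufficiently large $n$, in the sense that the bound holds as stated with this $c$), the number of pairwise non-isomorphic $n$-vertex graphs that are determined by their spectrum is at least $e^{cn}$.
   Context: All graphs are finite and simple. The spectrum of a graph is the multiset of eigenvalues of its adjacency matrix $\mathrm{A}(G)\in\{0,1\}^{n\times n}$ (whose $(i,j)$-entry is $1$ iff $v_i v_j$ is an edge). A graph $G$ is determined by its spectrum if every graph with the same spectrum as $G$ is isomorphic to $G$. -}

module Defs where

open import Data.Nat using (ℕ; zero; suc)
open import Data.Integer using (ℤ; +_; -_) renaming (_+_ to _+ℤ_; _*_ to _*ℤ_)
open import Data.Bool using (Bool; true; false; if_then_else_)
open import Data.Fin using (Fin; zero; suc; punchIn; _≟_)
open import Data.List using (List; []; _∷_)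
open import Data.Product using (Σ; _×_; _,_)
open import Relation.Nullary using (yes; no)
open import Relation.Binary.PropositionalEquality using (_≡_)
open import Function.Bundles using (_↔_; Inverse)

record Graph (n : ℕ) : Set where
  field
    adj   : Fin n → Fin n → Bool
    sym   : ∀ i j → adj i j ≡ adj j i
    irrefl : ∀ i → adj i i ≡ false
open Graph public

A : ∀ {n} → Graph n → Fin n → Fin n → ℤ
A G i j = if adj G i j then + 1 else + 0

Iso : ∀ {n m} → Graph n → Graph m → Set
Iso {n} {m} G H =
  Σ (Fin n ↔ Fin m) λ σ → ∀ i j → adj H (Inverse.to σ i) (Inverse.to σ j) ≡ adj G i j

-- Integer polynomials as coefficient lists (lowest degree first)

Poly : Set
Poly = List ℤ

_⊕_ : Poly → Poly → Poly
[] ⊕ q = q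
(a ∷ p) ⊕ [] = a ∷ p
(a ∷ p) ⊕ (b ∷ q) = (a +ℤ b) ∷ (p ⊕ q)

scale : ℤ → Poly → Poly
scale c [] = []
scale c (a ∷ p) = (c *ℤ a) ∷ scale c p

_⊗_ : Poly → Poly → Poly
[] ⊗ q = []
(a ∷ p) ⊗ q = scale a q ⊕ (+ 0 ∷ (p ⊗ q))

coeff : Poly → ℕ → ℤ
coeff [] _ = + 0
coeff (a ∷ p) zero = a
coeff (a ∷ p) (suc k) = coeff p k

-- equality of polynomials (coefficientwise, ignoring trailing zeros)
_≈ₚ_ : Poly → Poly → Set
p ≈ₚ q = ∀ k → coeff p k ≡ coeff q k

det : ∀ n → (Fin n → Fin n → Poly) → Poly
det zero M = + 1 ∷ []
det (suc n) M = go (suc n) (λ j → j) (+ 1)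
  where
  minor : Fin (suc n) → Fin n → Fin n → Poly
  minor j r c = M (suc r) (punchIn j c)
  -- go k f s : sum over the k columns f 0, …, f (k-1), with alternating
  -- sign starting at s; column f t has sign (-1)^(index of f t)
  go : ∀ k → (Fin k → Fin (suc n)) → ℤ → Poly
  go zero f s = []
  go (suc k) f s =
    (scale s (M zero (f zero) ⊗ det n (minor (f zero))))
      ⊕ go k (λ t → f (suc t)) (- s)

charPoly : ∀ {n} → Graph n → Poly
charPoly {n} G = det n λ i j → entry i j
  where
  entry : _ → _ → Poly
  entry i j with i ≟ j
  ... | yes _ = (- A G i j) ∷ + 1 ∷ []
  ... | no _  = (- A G i j) ∷ []

-- Two graphs have the same spectrum (multiset of adjacency eigenvalues)
-- iff their characteristic polynomials coincide.
Cospectral : ∀ {n m} → Graph n → Graph m → Set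
Cospectral G H = charPoly G ≈ₚ charPoly H

DS : ∀ {n} → Graph n → Set
DS G = ∀ m (H : Graph m) → Cospectral G H → Iso G H

{-# OPTIONS --safe #-}
module Submission where

-- The graphs are lollipops: a clique on d vertices with a caterpillar tree of m ≤ d / 200000 vertices
-- hanging from it by a single edge. Let H be cospectral with such a graph; both have the same closed
-- walk counts. For N = A + I the moments of H up to the fourth are close to those of a bare clique
-- and N² − d N is small in norm, so the vertices of H of degree above about 3 d / 4 form a clique of
-- size d that at most one edge leaves. For a clique with one such edge the closed walks at
-- its end v satisfy C = 1 + z² (W + J) C, where W depends on d only and J counts the closed walks of
-- the remaining graph at the other end of the edge; by removal of v and Newton's identities,
-- C′ / C is determined by the spectrum up to the traces of the remaining graph. These grow at most
-- like mᵏ, whereas a difference between two series J would make itself felt at rate (d − 1)ᵏ. Hence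
-- J is determined, and comparing first-return series recovers the tail vertex by vertex
-- from the degrees along its spine. There are 2^ℓ such tails with 1 + 4 ℓ vertices.

open import Defs hiding (sym)
open import Algebra.Bundles using (CommutativeRing)
import Algebra.Solver.Ring
open import Algebra.Solver.Ring.AlmostCommutativeRing using (AlmostCommutativeRing; fromCommutativeRing; _-Raw-AlmostCommutative⟶_)
open import Algebra.Structures using (IsCommutativeRing)
open import Data.Bool using (Bool; true; false; if_then_else_; not; _∧_)
open import Data.Empty using (⊥; ⊥-elim)
open import Data.Fin using (Fin; zero; suc; punchIn; punchOut; _≟_; toℕ; splitAt; join; _↑ˡ_; _↑ʳ_)
open import Data.Fin.Permutation using (Permutation; _⟨$⟩ʳ_)
open import Data.Fin.Properties using (any?; splitAt-↑ˡ; splitAt-↑ʳ; join-splitAt; injective⇒≤; punchOut-injective; suc-injective; ↑ˡ-injective; ↑ʳ-injective)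
open import Data.Integer as ℤ using (ℤ; +_; -[1+_]; _≤_; +≤+; ∣_∣)
import Data.Integer.Properties as ℤₚ
open import Data.List using (List; []; _∷_; _++_; length; map)
open import Data.List.Properties using (length-++; length-map)
open import Data.List.Relation.Unary.All as All using (All; []; _∷_)
import Data.List.Relation.Unary.All.Properties as Allₚ
open import Data.List.Relation.Unary.AllPairs as AllPairs using (AllPairs; []; _∷_)
import Data.List.Relation.Unary.AllPairs.Properties as AllPairsₚ
open import Data.Maybe using (Maybe; just; nothing)
open import Data.Nat as ℕ using (ℕ; zero; suc; z≤n; s≤s; _<ᵇ_)
open import Data.Nat.DivMod using (_/_; _%_; m≡m%n+[m/n]*n; m%n<n; m≥n⇒m/n>0)
import Data.Nat.Properties as ℕₚ
open import Data.Product using (Σ; _×_; _,_; proj₁; proj₂)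
open import Data.Sum using (_⊎_; inj₁; inj₂; [_,_]′)
import Function
open import Function.Bundles using (_↔_; mk↔ₛ′; Inverse)
open import Level using (0ℓ)
open import Relation.Nullary.Decidable using (dec⇒maybe)
open import Relation.Nullary using (¬_; does; yes; no)
open import Relation.Binary.PropositionalEquality using (_≡_; refl; sym; trans; cong; cong₂; subst; module ≡-Reasoning)

-- No eigenvalue appears: the spectrum enters through integer traces, and analysis is replaced by
-- inequalities between integers and identities of formal power series. The clique is exact by
-- integrality: a missing pair costs `d` in the third moment, a second unit of `P`, which measures
-- the edges leaving the clique, costs `4 d` in the fourth, and all admissible errors are of the
-- order of the tail size. This is why `d` must exceed the tail by a large constant factor. The
-- obstacle in comparing series is that the mate is unknown outside its clique, so that differences
-- of walk series may have negative coefficients as large as `b^k`, with `b` vertices outside. Sign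
-- information is therefore carried by lower bounds of the form z^a (1 - b z² / (1 - b z));
-- multiplying by the closed walks at the clique vertex, which grow much faster, makes such a series
-- positive. Caterpillars are used because a vertex with two children contributes the sum of two
-- walk series, which cannot be divided between two unknown subtrees. A leaf contributes the
-- constant 1 and leaves one unknown series.

infixl 6 _+_ _-_
infixl 7 _*_
infix 8 -_

-- The ring operations of ℤ are made opaque so that unification treats them as rigid.
opaque
  _+_ : ℤ → ℤ → ℤ
  _+_ = ℤ._+_

opaque
  _*_ : ℤ → ℤ → ℤ
  _*_ = ℤ._*_

opaque
  -_ : ℤ → ℤ
  -_ = ℤ.-_

_-_ : ℤ → ℤ → ℤ
a - b = a + - b

opaque
  unfolding _+_ _*_ -_

  isCommutativeRing : IsCommutativeRing _≡_ _+_ _*_ -_ (+ 0) (+ 1)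
  isCommutativeRing = CommutativeRing.isCommutativeRing ℤₚ.+-*-commutativeRing

ringℤ : CommutativeRing 0ℓ 0ℓ
ringℤ = record { isCommutativeRing = isCommutativeRing }

module R = CommutativeRing ringℤ

opaque
  unfolding _+_ _*_ -_

  +-homo : ∀ a b → a ℤ.+ b ≡ a + b
  +-homo a b = refl

  *-homo : ∀ a b → a ℤ.* b ≡ a * b
  *-homo a b = refl

  neg-homo : ∀ a → ℤ.- a ≡ - a
  neg-homo a = refl

ℤ-homo : CommutativeRing.rawRing ℤₚ.+-*-commutativeRing -Raw-AlmostCommutative⟶ fromCommutativeRing ringℤ
ℤ-homo = record { ⟦_⟧ = λ x → x ; +-homo = +-homo ; *-homo = *-homo ; -‿homo = neg-homo ; 0-homo = refl ; 1-homo = refl }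

module ℤSolver = Algebra.Solver.Ring (CommutativeRing.rawRing ℤₚ.+-*-commutativeRing) (fromCommutativeRing ringℤ) ℤ-homo (λ a b → dec⇒maybe (a ℤₚ.≟ b))
open ℤSolver public using (solve; _:=_; _:+_; _:*_; _:-_; :-_)

♯ : ∀ {m} → ℕ → ℤSolver.Polynomial m
♯ n = ℤSolver.con (+ n)

-- Order on the integers

opaque
  unfolding _+_ _*_ -_

  ≤-diff : ∀ {a b} → a ≤ b → + 0 ≤ b - a
  ≤-diff = ℤₚ.i≤j⇒0≤j-i

  -- Certificate form of an inequality: the slack `e` is built from visibly nonnegative terms by
  -- `_⊞_` and `_⊠_`, and the ring solver checks `b - a ≡ e`. Most estimates below have this shape.
  ≤-by : ∀ {a b e} → + 0 ≤ e → b - a ≡ e → a ≤ b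
  ≤-by p q = ℤₚ.0≤i-j⇒j≤i (subst (+ 0 ≤_) (sym q) p)

  infixl 6 _⊞_
  infixl 7 _⊠_

  _⊞_ : ∀ {a b} → + 0 ≤ a → + 0 ≤ b → + 0 ≤ a + b
  _⊞_ = ℤₚ.+-mono-≤

  _⊠_ : ∀ {a b} → + 0 ≤ a → + 0 ≤ b → + 0 ≤ a * b
  _⊠_ {+ a} {+ b} _ _ = subst (+ 0 ≤_) (ℤₚ.pos-* a b) (+≤+ z≤n)

  0≤sq : ∀ a → + 0 ≤ a * a
  0≤sq (+ n) = _⊠_ {+ n} {+ n} (+≤+ z≤n) (+≤+ z≤n)
  0≤sq -[1+ n ] = +≤+ z≤n

  +-mono : ∀ {a b c d} → a ≤ b → c ≤ d → a + c ≤ b + d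
  +-mono = ℤₚ.+-mono-≤

  suc≡1+ : ∀ k → + suc k ≡ + 1 + + k
  suc≡1+ k = refl

  pos-+ : ∀ a b → + (a ℕ.+ b) ≡ + a + + b
  pos-+ a b = refl

  pos-* : ∀ a b → + (a ℕ.* b) ≡ + a * + b
  pos-* a b = ℤₚ.pos-* a b

  *-cancel-≤ : ∀ {c a b} → + 1 ≤ c → c * a ≤ c * b → a ≤ b
  *-cancel-≤ {+ zero} (+≤+ ())
  *-cancel-≤ {+ suc c} {a} {b} _ p = ℤₚ.*-cancelˡ-≤-pos a b (+ suc c) p

  double-zero : ∀ {a} → a ≡ - a → a ≡ + 0
  double-zero {+ zero} p = refl

  ≤-total : ∀ a b → a ≤ b ⊎ b + + 1 ≤ a
  ≤-total a b with a ℤₚ.≤? b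
  ... | yes p = inj₁ p
  ... | no p = inj₂ (subst (_≤ a) (ℤₚ.+-comm (+ 1) b) (ℤₚ.i<j⇒suc[i]≤j (ℤₚ.≰⇒> p)))

  1≰0 : ¬ (+ 1 ≤ + 0)
  1≰0 (+≤+ ())

  mul-zero : ∀ {a b} → a * b ≡ + 0 → a ≡ + 0 ⊎ b ≡ + 0
  mul-zero {a} {b} = ℤₚ.i*j≡0⇒i≡0∨j≡0 a

  minus-zero : ∀ {a b} → a - b ≡ + 0 → a ≡ b
  minus-zero {a} {b} = ℤₚ.i-j≡0⇒i≡j a b

*-monoˡ : ∀ {c a b} → + 0 ≤ c → a ≤ b → c * a ≤ c * b
*-monoˡ {c} {a} {b} p q = ≤-by (p ⊠ ≤-diff q) (eq c a b)
  where
  eq = solve 3 (λ c a b → c :* b :- c :* a := c :* (b :- a)) refl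

*-mono : ∀ {a b c d} → + 0 ≤ a → + 0 ≤ c → a ≤ b → c ≤ d → a * c ≤ b * d
*-mono {a} {b} {c} {d} p r q s = ≤-by (p ⊠ ≤-diff s ⊞ ≤-diff q ⊠ (r ⊞ ≤-diff s)) (eq a b c d)
  where
  eq = solve 4 (λ a b c d → b :* d :- a :* c := a :* (d :- c) :+ (b :- a) :* (c :+ (d :- c))) refl

import Algebra.Properties.Semiring.Sum (CommutativeRing.semiring ringℤ) as Sum

opaque
  sum : ∀ {n} → (Fin n → ℤ) → ℤ
  sum = Sum.sum

opaque
  unfolding sum

  sum-zero : (f : Fin 0 → ℤ) → sum f ≡ + 0
  sum-zero f = refl

  sum-suc : ∀ {n} (f : Fin (suc n) → ℤ) → sum f ≡ f zero + sum (λ i → f (suc i))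
  sum-suc f = refl

  sum-cong : ∀ {n} {f g : Fin n → ℤ} → (∀ i → f i ≡ g i) → sum f ≡ sum g
  sum-cong = Sum.sum-cong-≗

  sum-comm : ∀ {m n} (f : Fin m → Fin n → ℤ) → sum (λ i → sum (λ j → f i j)) ≡ sum (λ j → sum (λ i → f i j))
  sum-comm = Sum.∑-comm

  sum-+ : ∀ {n} (f g : Fin n → ℤ) → sum (λ i → f i + g i) ≡ sum f + sum g
  sum-+ = Sum.∑-distrib-+

  sum-*ˡ : ∀ {n} c (f : Fin n → ℤ) → sum (λ i → c * f i) ≡ c * sum f
  sum-*ˡ c f = sym (Sum.*-distribˡ-sum c f)

  sum-*ʳ : ∀ {n} c (f : Fin n → ℤ) → sum (λ i → f i * c) ≡ sum f * c
  sum-*ʳ c f = sym (Sum.*-distribʳ-sum c f)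

  sum-permute : ∀ {m n} (f : Fin n → ℤ) (π : Permutation m n) → sum f ≡ sum (λ i → f (π ⟨$⟩ʳ i))
  sum-permute f π = Sum.sum-permute f π

  sum-0 : ∀ {n} {f : Fin n → ℤ} → (∀ i → f i ≡ + 0) → sum f ≡ + 0
  sum-0 {n} p = trans (sum-cong p) (Sum.sum-replicate-zero n)

0≤+ : ∀ {k} → + 0 ≤ + k
0≤+ = +≤+ z≤n

1≤⇒0≤ : ∀ {a} → + 1 ≤ a → + 0 ≤ a
1≤⇒0≤ = ℤₚ.≤-trans (+≤+ z≤n)

≡⇒≤ : ∀ {a b : ℤ} → a ≡ b → a ≤ b
≡⇒≤ = ℤₚ.≤-reflexive

≤-trans : ∀ {a b c : ℤ} → a ≤ b → b ≤ c → a ≤ c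
≤-trans = ℤₚ.≤-trans

≤-refl : ∀ {a : ℤ} → a ≤ a
≤-refl = ℤₚ.≤-refl

a≤a+b : ∀ {a b} → + 0 ≤ b → a ≤ a + b
a≤a+b {a} {b} p = ≤-by p (eq a b)
  where
  eq = solve 2 (λ a b → a :+ b :- a := b) refl

-- Finite sums

opaque
  unfolding sum

  sum-≥0 : ∀ {n} {f : Fin n → ℤ} → (∀ i → + 0 ≤ f i) → + 0 ≤ sum f
  sum-≥0 {zero} p = ≤-refl
  sum-≥0 {suc n} p = p zero ⊞ sum-≥0 (λ i → p (suc i))

  sum-mono : ∀ {n} {f g : Fin n → ℤ} → (∀ i → f i ≤ g i) → sum f ≤ sum g
  sum-mono {zero} p = ≤-refl
  sum-mono {suc n} p = +-mono (p zero) (sum-mono (λ i → p (suc i)))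

  term≤sum : ∀ {n} {f : Fin n → ℤ} → (∀ i → + 0 ≤ f i) → ∀ i → f i ≤ sum f
  term≤sum {suc n} p zero = a≤a+b (sum-≥0 (λ i → p (suc i)))
  term≤sum {suc n} {f} p (suc i) = ≤-trans (term≤sum (λ j → p (suc j)) i)
    (≤-trans (a≤a+b (p zero)) (≡⇒≤ (R.+-comm _ (f zero))))

  sum-neg : ∀ {n} (f : Fin n → ℤ) → sum (λ i → - f i) ≡ - sum f
  sum-neg {zero} f = eq
    where
    opaque
      unfolding -_
      eq : + 0 ≡ - (+ 0)
      eq = refl
  sum-neg {suc n} f = trans (cong₂ _+_ refl (sum-neg (λ i → f (suc i)))) (solve 2 (λ a b → :- a :+ :- b := :- (a :+ b)) refl (f zero) (sum (λ i → f (suc i))))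

  sum-1 : ∀ n → sum {n} (λ _ → + 1) ≡ + n
  sum-1 zero = refl
  sum-1 (suc n) = trans (cong₂ _+_ refl (sum-1 n)) (sym (suc≡1+ n))

δ : ∀ {n} → Fin n → Fin n → ℤ
δ i j = if does (i ≟ j) then + 1 else + 0

δ-refl : ∀ {n} (i : Fin n) → δ i i ≡ + 1
δ-refl zero = refl
δ-refl (suc i) = δ-refl i

δ-sym : ∀ {n} (i j : Fin n) → δ i j ≡ δ j i
δ-sym zero zero = refl
δ-sym zero (suc j) = refl
δ-sym (suc i) zero = refl
δ-sym (suc i) (suc j) = δ-sym i j

δ-≢ : ∀ {n} {i j : Fin n} → ¬ (i ≡ j) → δ i j ≡ + 0
δ-≢ {i = i} {j} p with i ≟ j
... | yes q = ⊥-elim (p q)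
... | no q = refl

δ-split : ∀ {n} (i j : Fin n) → (i ≡ j × δ i j ≡ + 1) ⊎ (¬ (i ≡ j) × δ i j ≡ + 0)
δ-split i j with i ≟ j
... | yes q = inj₁ (q , refl)
... | no q = inj₂ (q , refl)

opaque
  unfolding sum

  sum-δˡ : ∀ {n} (i : Fin n) (f : Fin n → ℤ) → sum (λ j → δ i j * f j) ≡ f i
  sum-δˡ zero f = trans (cong₂ _+_ (R.*-identityˡ (f zero)) (sum-0 (λ j → R.zeroˡ (f (suc j))))) (R.+-identityʳ _)
  sum-δˡ (suc i) f = trans (cong₂ _+_ (R.zeroˡ (f zero)) (sum-δˡ i (λ j → f (suc j)))) (R.+-identityˡ _)

sum-δʳ : ∀ {n} (i : Fin n) (f : Fin n → ℤ) → sum (λ j → f j * δ j i) ≡ f i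
sum-δʳ i f = trans (sum-cong (λ j → trans (R.*-comm (f j) (δ j i)) (cong₂ _*_ (δ-sym j i) refl))) (sum-δˡ i f)

-- Formal power series over ℤ

Series : Set
Series = ℕ → ℤ

infix 4 _≈_
_≈_ : Series → Series → Set
f ≈ g = ∀ k → f k ≡ g k

infixl 6 _⊕s_
infixl 7 _⊛_

_⊕s_ : Series → Series → Series
(f ⊕s g) k = f k + g k

negs : Series → Series
negs f k = - f k

const : ℤ → Series
const c zero = c
const c (suc k) = + 0

z⊛ : Series → Series
z⊛ f zero = + 0
z⊛ f (suc k) = f k

zs : Series
zs = z⊛ (const (+ 1))

tl : Series → Series
tl f k = f (suc k)

_⊛_ : Series → Series → Series
(f ⊛ g) zero = f zero * g zero
(f ⊛ g) (suc k) = f zero * g (suc k) + (tl f ⊛ g) k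

≈-sym : ∀ {f g} → f ≈ g → g ≈ f
≈-sym p k = sym (p k)

≈-trans : ∀ {f g h} → f ≈ g → g ≈ h → f ≈ h
≈-trans p q k = trans (p k) (q k)

⊛-cong : ∀ {f f′ g g′} → f ≈ f′ → g ≈ g′ → f ⊛ g ≈ f′ ⊛ g′
⊛-cong p q zero = cong₂ _*_ (p 0) (q 0)
⊛-cong p q (suc k) = cong₂ _+_ (cong₂ _*_ (p 0) (q (suc k))) (⊛-cong (λ i → p (suc i)) q k)

⊕-cong : ∀ {f f′ g g′} → f ≈ f′ → g ≈ g′ → f ⊕s g ≈ f′ ⊕s g′
⊕-cong p q k = cong₂ _+_ (p k) (q k)

⊛-distribʳ : ∀ h f g → (f ⊕s g) ⊛ h ≈ f ⊛ h ⊕s g ⊛ h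
⊛-distribʳ h f g zero = R.distribʳ (h 0) (f 0) (g 0)
⊛-distribʳ h f g (suc k) = trans (cong₂ _+_ refl (⊛-distribʳ h (tl f) (tl g) k)) (eq (f 0) (g 0) (h (suc k)) _ _)
  where
  eq = solve 5 (λ a b c x y → (a :+ b) :* c :+ (x :+ y) := (a :* c :+ x) :+ (b :* c :+ y)) refl

⊛-scaleˡ : ∀ c f g → (λ k → c * f k) ⊛ g ≈ (λ k → c * (f ⊛ g) k)
⊛-scaleˡ c f g zero = R.*-assoc c (f 0) (g 0)
⊛-scaleˡ c f g (suc k) = trans (cong₂ _+_ refl (⊛-scaleˡ c (tl f) g k)) (eq c (f 0) (g (suc k)) _)
  where
  eq = solve 4 (λ c a b x → c :* a :* b :+ c :* x := c :* (a :* b :+ x)) refl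

⊛-sucʳ : ∀ f g k → (f ⊛ g) (suc k) ≡ (f ⊛ tl g) k + f (suc k) * g 0
⊛-sucʳ f g zero = refl
⊛-sucʳ f g (suc k) = trans (cong₂ _+_ refl (⊛-sucʳ (tl f) g k)) (sym (R.+-assoc _ _ _))

⊛-comm : ∀ f g → f ⊛ g ≈ g ⊛ f
⊛-comm f g zero = R.*-comm (f 0) (g 0)
⊛-comm f g (suc k) = trans (cong₂ _+_ (R.*-comm (f 0) (g (suc k))) (⊛-comm (tl f) g k))
  (trans (R.+-comm _ ((g ⊛ tl f) k)) (sym (⊛-sucʳ g f k)))

⊛-assoc : ∀ f g h → (f ⊛ g) ⊛ h ≈ f ⊛ (g ⊛ h)
⊛-assoc f g h zero = R.*-assoc (f 0) (g 0) (h 0)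
⊛-assoc f g h (suc k) = begin
  f 0 * g 0 * h (suc k) + (((λ i → f 0 * g (suc i)) ⊕s (tl f ⊛ g)) ⊛ h) k
    ≡⟨ cong₂ _+_ refl (⊛-distribʳ h (λ i → f 0 * g (suc i)) (tl f ⊛ g) k) ⟩
  f 0 * g 0 * h (suc k) + (((λ i → f 0 * g (suc i)) ⊛ h) k + ((tl f ⊛ g) ⊛ h) k)
    ≡⟨ cong₂ _+_ refl (cong₂ _+_ (⊛-scaleˡ (f 0) (tl g) h k) (⊛-assoc (tl f) g h k)) ⟩
  f 0 * g 0 * h (suc k) + (f 0 * (tl g ⊛ h) k + (tl f ⊛ (g ⊛ h)) k)
    ≡⟨ eq (f 0) (g 0) (h (suc k)) _ _ ⟩
  f 0 * (g 0 * h (suc k) + (tl g ⊛ h) k) + (tl f ⊛ (g ⊛ h)) k ∎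
  where
  open ≡-Reasoning
  eq = solve 5 (λ a b c x y → a :* b :* c :+ (a :* x :+ y) := a :* (b :* c :+ x) :+ y) refl

⊛-zeroˡ : ∀ g → (λ _ → + 0) ⊛ g ≈ (λ _ → + 0)
⊛-zeroˡ g zero = R.zeroˡ (g 0)
⊛-zeroˡ g (suc k) = trans (cong₂ _+_ (R.zeroˡ (g (suc k))) (⊛-zeroˡ g k)) (R.+-identityˡ (+ 0))

const-⊛ : ∀ c g → const c ⊛ g ≈ (λ k → c * g k)
const-⊛ c g zero = refl
const-⊛ c g (suc k) = trans (cong₂ _+_ refl (⊛-zeroˡ g k)) (R.+-identityʳ _)

⊛-identityˡ : ∀ g → const (+ 1) ⊛ g ≈ g
⊛-identityˡ g k = trans (const-⊛ (+ 1) g k) (R.*-identityˡ (g k))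

zs-⊛ : ∀ f → zs ⊛ f ≈ z⊛ f
zs-⊛ f zero = R.zeroˡ (f 0)
zs-⊛ f (suc k) = trans (cong₂ _+_ (R.zeroˡ (f (suc k))) (⊛-identityˡ f k)) (R.+-identityˡ (f k))

private
  seriesRing : CommutativeRing 0ℓ 0ℓ
  seriesRing = record
    { Carrier = Series ; _≈_ = _≈_ ; _+_ = _⊕s_ ; _*_ = _⊛_ ; -_ = negs ; 0# = λ _ → + 0 ; 1# = const (+ 1)
    ; isCommutativeRing = record
      { isRing = record
        { +-isAbelianGroup = record
          { isGroup = record
            { isMonoid = record
              { isSemigroup = record
                { isMagma = record
                  { isEquivalence = record { refl = λ k → refl ; sym = ≈-sym ; trans = ≈-trans }
                  ; ∙-cong = ⊕-cong }
                ; assoc = λ f g h k → R.+-assoc (f k) (g k) (h k) }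
              ; identity = (λ f k → R.+-identityˡ (f k)) , (λ f k → R.+-identityʳ (f k)) }
            ; inverse = (λ f k → R.-‿inverseˡ (f k)) , (λ f k → R.-‿inverseʳ (f k))
            ; ⁻¹-cong = λ p k → cong -_ (p k) }
          ; comm = λ f g k → R.+-comm (f k) (g k) }
        ; *-cong = ⊛-cong
        ; *-assoc = ⊛-assoc
        ; *-identity = ⊛-identityˡ , (λ f k → trans (⊛-comm f (const (+ 1)) k) (⊛-identityˡ f k))
        ; distrib = (λ f g h k → trans (⊛-comm f (g ⊕s h) k) (trans (⊛-distribʳ f g h k) (cong₂ _+_ (⊛-comm g f k) (⊛-comm h f k)))) , ⊛-distribʳ }
      ; *-comm = ⊛-comm } }

  seriesACR : AlmostCommutativeRing 0ℓ 0ℓ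
  seriesACR = fromCommutativeRing seriesRing

  opaque
    unfolding _+_ _*_ -_
    const-homo-+ : ∀ a b → const (a ℤ.+ b) ≈ const a ⊕s const b
    const-homo-+ a b zero = refl
    const-homo-+ a b (suc k) = refl
    const-homo-* : ∀ a b → const (a ℤ.* b) ≈ const a ⊛ const b
    const-homo-* a b zero = refl
    const-homo-* a b (suc k) = sym (trans (const-⊛ a (const b) (suc k)) (R.zeroʳ a))
    const-homo-neg : ∀ a → const (ℤ.- a) ≈ negs (const a)
    const-homo-neg a zero = refl
    const-homo-neg a (suc k) = refl

  const-0 : const (+ 0) ≈ (λ _ → + 0)
  const-0 zero = refl
  const-0 (suc k) = refl

  constHom : CommutativeRing.rawRing ℤₚ.+-*-commutativeRing -Raw-AlmostCommutative⟶ seriesACR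
  constHom = record
    { ⟦_⟧ = const ; +-homo = const-homo-+ ; *-homo = const-homo-* ; -‿homo = const-homo-neg ; 0-homo = const-0 ; 1-homo = λ k → refl }

  const-≟ : ∀ a b → Maybe (const a ≈ const b)
  const-≟ a b with a ℤₚ.≟ b
  ... | yes refl = just (λ k → refl)
  ... | no _ = nothing

module SeriesSolver = Algebra.Solver.Ring (CommutativeRing.rawRing ℤₚ.+-*-commutativeRing) seriesACR constHom const-≟
open SeriesSolver public using () renaming (_:+_ to _:⊕_; _:*_ to _:⊛_; :-_ to :⊖_; _:=_ to _:≈_; con to :const)

-- Determinants over ℤ

sgn : ∀ {n} → Fin n → ℤ
sgn zero = + 1
sgn (suc i) = - sgn i

detℤ : ∀ n → (Fin n → Fin n → ℤ) → ℤ
detℤ zero M = + 1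
detℤ (suc n) M = sum (λ j → sgn j * (M zero j * detℤ n (λ r c → M (suc r) (punchIn j c))))

detℤ-cong : ∀ n {M N : Fin n → Fin n → ℤ} → (∀ i j → M i j ≡ N i j) → detℤ n M ≡ detℤ n N
detℤ-cong zero p = refl
detℤ-cong (suc n) p = sum-cong λ j → cong₂ _*_ refl (cong₂ _*_ (p zero j) (detℤ-cong n (λ r c → p (suc r) (punchIn j c))))

-- dual j k is the index of j once the column punchIn j k has been removed.
dual : ∀ {n} → Fin (suc (suc n)) → Fin (suc n) → Fin (suc n)
dual zero k = zero
dual (suc j) zero = j
dual {suc n} (suc j) (suc k) = suc (dual j k)

-- `(j , k)` encodes the ordered pair of distinct columns `j` and `punchIn j k`. Exchanging the two
-- columns gives `(punchIn j k , dual j k)`, and the sum is reindexed along this involution.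
sum-dual : ∀ {n} (g : Fin (suc (suc n)) → Fin (suc n) → ℤ) →
  sum (λ j → sum (λ k → g j k)) ≡ sum (λ j → sum (λ k → g (punchIn j k) (dual j k)))
sum-dual {zero} g = trans (sums g) (trans (R.+-comm _ _) (sym (sums (λ j k → g (punchIn j k) (dual j k)))))
  where
  sums : (g : Fin 2 → Fin 1 → ℤ) → sum (λ j → sum (λ k → g j k)) ≡ g zero zero + g (suc zero) zero
  sums g = trans (sum-suc _) (cong₂ _+_ (one (g zero)) (trans (one _) (one (g (suc zero)))))
    where
    one : (f : Fin 1 → ℤ) → sum f ≡ f zero
    one f = trans (sum-suc f) (trans (cong₂ _+_ refl (sum-zero _)) (R.+-identityʳ _))
sum-dual {suc n} g = begin
  sum (λ j → sum (g j))
    ≡⟨ trans (sum-suc _) (cong₂ _+_ refl (sum-cong (λ j → sum-suc (g (suc j))))) ⟩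
  sum (g zero) + sum (λ j → g (suc j) zero + sum (λ k → g (suc j) (suc k)))
    ≡⟨ cong₂ _+_ refl (sum-+ (λ j → g (suc j) zero) _) ⟩
  sum (g zero) + (sum (λ j → g (suc j) zero) + sum (λ j → sum (λ k → g (suc j) (suc k))))
    ≡⟨ cong₂ _+_ refl (cong₂ _+_ refl (sum-dual (λ j k → g (suc j) (suc k)))) ⟩
  sum (g zero) + (sum (λ j → g (suc j) zero) + sum (λ j → sum (λ k → g (suc (punchIn j k)) (suc (dual j k)))))
    ≡⟨ eq _ _ _ ⟩
  sum (λ j → g (suc j) zero) + (sum (g zero) + sum (λ j → sum (λ k → g (suc (punchIn j k)) (suc (dual j k)))))
    ≡⟨ cong₂ _+_ refl (sum-+ (g zero) _) ⟨
  sum (λ j → g (suc j) zero) + sum (λ j → g zero j + sum (λ k → g (suc (punchIn j k)) (suc (dual j k))))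
    ≡⟨ trans (sum-suc _) (cong₂ _+_ refl (sum-cong (λ j → sum-suc (λ k → g (punchIn (suc j) k) (dual (suc j) k))))) ⟨
  sum (λ j → sum (λ k → g (punchIn j k) (dual j k))) ∎
  where
  open ≡-Reasoning
  eq = solve 3 (λ a b c → a :+ (b :+ c) := b :+ (a :+ c)) refl

sgn-dual : ∀ {n} (j : Fin (suc (suc n))) (k : Fin (suc n)) → sgn (punchIn j k) * sgn (dual j k) ≡ - (sgn j * sgn k)
sgn-dual zero k = eq (sgn k)
  where
  eq = solve 1 (λ a → :- a :* ♯ 1 := :- (♯ 1 :* a)) refl
sgn-dual (suc j) zero = eq (sgn j)
  where
  eq = solve 1 (λ a → ♯ 1 :* a := :- (:- a :* ♯ 1)) refl
sgn-dual {suc n} (suc j) (suc k) = trans (eq (sgn (punchIn j k)) (sgn (dual j k))) (trans (sgn-dual j k) (cong -_ (sym (eq (sgn j) (sgn k)))))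
  where
  eq = solve 2 (λ a b → :- a :* :- b := a :* b) refl

punchIn-dual : ∀ {n} (j : Fin (suc (suc n))) (k : Fin (suc n)) → punchIn (punchIn j k) (dual j k) ≡ j
punchIn-dual zero k = refl
punchIn-dual (suc j) zero = refl
punchIn-dual {suc n} (suc j) (suc k) = cong suc (punchIn-dual j k)

punchIn-punchIn : ∀ {n} (j : Fin (suc (suc n))) (k : Fin (suc n)) (c : Fin n) →
  punchIn (punchIn j k) (punchIn (dual j k) c) ≡ punchIn j (punchIn k c)
punchIn-punchIn zero k c = refl
punchIn-punchIn (suc j) zero c = refl
punchIn-punchIn (suc j) (suc k) zero = refl
punchIn-punchIn {suc n} (suc j) (suc k) (suc c) = cong suc (punchIn-punchIn j k c)

-- The transposition of the adjacent indices `k` and `k + 1`.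
swap : ∀ {n} → Fin n → Fin (suc n) → Fin (suc n)
swap zero zero = suc zero
swap zero (suc zero) = zero
swap zero (suc (suc i)) = suc (suc i)
swap (suc k) zero = zero
swap (suc k) (suc i) = suc (swap k i)

-- Expand along two rows and exchange the two columns they use: the remaining minor is the same by
-- `punchIn-punchIn`, and the sign flips by `sgn-dual`.
detℤ-swap₀ : ∀ n (M : Fin (suc (suc n)) → Fin (suc (suc n)) → ℤ) →
  detℤ (suc (suc n)) (λ i → M (swap zero i)) ≡ - detℤ (suc (suc n)) M
detℤ-swap₀ n M = begin
  sum (λ j → sgn j * (M (suc zero) j * sum (λ k → sgn k * (M zero (punchIn j k) * D j k))))
    ≡⟨ sum-cong (λ j → expand (sgn j) (M (suc zero) j) _) ⟩
  sum (λ j → sum (λ k → (sgn j * M (suc zero) j) * (sgn k * (M zero (punchIn j k) * D j k))))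
    ≡⟨ sum-dual (λ j k → (sgn j * M (suc zero) j) * (sgn k * (M zero (punchIn j k) * D j k))) ⟩
  sum (λ j → sum (λ k → (sgn (punchIn j k) * M (suc zero) (punchIn j k)) * (sgn (dual j k) * (M zero (punchIn (punchIn j k) (dual j k)) * D (punchIn j k) (dual j k)))))
    ≡⟨ sum-cong (λ j → trans (sum-cong (λ k → step j k)) (sum-neg _)) ⟩
  sum (λ j → - sum (λ k → (sgn j * M zero j) * (sgn k * (M (suc zero) (punchIn j k) * D j k))))
    ≡⟨ sum-neg _ ⟩
  - sum (λ j → sum (λ k → (sgn j * M zero j) * (sgn k * (M (suc zero) (punchIn j k) * D j k))))
    ≡⟨ cong -_ (sum-cong (λ j → expand (sgn j) (M zero j) _)) ⟨
  - sum (λ j → sgn j * (M zero j * sum (λ k → sgn k * (M (suc zero) (punchIn j k) * D j k)))) ∎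
  where
  open ≡-Reasoning
  D : Fin (suc (suc n)) → Fin (suc n) → ℤ
  D j k = detℤ n (λ r c → M (suc (suc r)) (punchIn j (punchIn k c)))
  expand : ∀ {m} a b (f : Fin m → ℤ) → a * (b * sum f) ≡ sum (λ k → (a * b) * f k)
  expand a b f = trans (sym (R.*-assoc a b _)) (sym (sum-*ˡ (a * b) f))
  eq₁ = solve 5 (λ s t a b d → (s :* a) :* (t :* (b :* d)) := (s :* t) :* (a :* b :* d)) refl
  eq₂ = solve 5 (λ s t a b d → :- (s :* t) :* (a :* b :* d) := :- ((s :* b) :* (t :* (a :* d)))) refl
  step : ∀ j k → _ ≡ _
  step j k = trans (eq₁ (sgn (punchIn j k)) (sgn (dual j k)) _ _ _)
    (trans (cong₂ _*_ (sgn-dual j k) (cong₂ _*_ (cong₂ _*_ refl (cong (M zero) (punchIn-dual j k)))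
        (detℤ-cong n (λ r c → cong (M (suc (suc r))) (punchIn-punchIn j k c)))))
      (eq₂ (sgn j) (sgn k) (M (suc zero) (punchIn j k)) (M zero j) (D j k)))

detℤ-swap : ∀ n (k : Fin n) (M : Fin (suc n) → Fin (suc n) → ℤ) →
  detℤ (suc n) (λ i → M (swap k i)) ≡ - detℤ (suc n) M
detℤ-swap (suc n) zero M = trans (detℤ-cong (suc (suc n)) {M = λ i → M (swap zero i)} (λ i j → refl)) (detℤ-swap₀ n M)
detℤ-swap (suc n) (suc k) M = trans
  (sum-cong (λ j → trans (cong₂ _*_ refl (cong₂ _*_ refl (detℤ-swap n k (λ r c → M (suc r) (punchIn j c))))) (eq (sgn j) (M zero j) _)))
  (sum-neg _)
  where
  eq = solve 3 (λ a b d → a :* (b :* :- d) := :- (a :* (b :* d))) refl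

-- Adjacent swaps move the repeated row up until it lies directly below row 0, where exchanging the
-- two equal rows gives det = - det. The recursion is on `toℕ q`, because `inj q` is not
-- structurally smaller.
detℤ-repeat : ∀ n (q : Fin n) (M : Fin (suc n) → Fin (suc n) → ℤ) → (∀ j → M zero j ≡ M (suc q) j) → detℤ (suc n) M ≡ + 0
detℤ-repeat n q = go n q (toℕ q) refl
  where
  inj : ∀ {n} → Fin n → Fin (suc n)
  inj zero = zero
  inj (suc i) = suc (inj i)
  swap-inj : ∀ {n} (q : Fin n) → swap q (inj q) ≡ suc q
  swap-inj zero = refl
  swap-inj (suc q) = cong suc (swap-inj q)
  toℕ-inj : ∀ {n} (q : Fin n) → toℕ (inj q) ≡ toℕ q
  toℕ-inj zero = refl
  toℕ-inj (suc q) = cong suc (toℕ-inj q)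
  invol = solve 1 (λ b → b := :- (:- b)) refl
  opaque
    unfolding _+_ _*_ -_
    neg0 : - (+ 0) ≡ + 0
    neg0 = refl
  flip : ∀ a b → a ≡ - b → b ≡ - a
  flip a b e = trans (invol b) (cong -_ (sym e))
  go : ∀ n (q : Fin n) m → toℕ q ≡ m → (M : Fin (suc n) → Fin (suc n) → ℤ) → (∀ j → M zero j ≡ M (suc q) j) → detℤ (suc n) M ≡ + 0
  go (suc n) zero m e M p = double-zero (trans (detℤ-cong (suc (suc n)) same) (detℤ-swap (suc n) zero M))
    where
    same : ∀ i j → M i j ≡ M (swap zero i) j
    same zero j = p j
    same (suc zero) j = sym (p j)
    same (suc (suc i)) j = refl
  go (suc n) (suc q) (suc m) e M p = trans (flip _ _ (detℤ-swap (suc n) (suc q) M))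
    (trans (cong -_ (go (suc n) (inj q) m (trans (toℕ-inj q) (ℕₚ.suc-injective e)) (λ i → M (swap (suc q) i))
      (λ j → trans (p j) (cong (λ i → M i j) (sym (cong suc (swap-inj q))))))) neg0)

cofactor : ∀ {n} → (Fin (suc n) → Fin (suc n) → ℤ) → Fin (suc n) → ℤ
cofactor {n} M j = sgn j * detℤ n (λ r c → M (suc r) (punchIn j c))

-- For a row other than row 0 the sum is the expansion of the determinant in which that row has
-- replaced row 0, so that two rows are equal.
cramer : ∀ {n} (M : Fin (suc n) → Fin (suc n) → ℤ) i → sum (λ j → M i j * cofactor M j) ≡ δ i zero * detℤ (suc n) M
cramer {n} M zero = trans (sum-cong (λ j → eq (M zero j) (sgn j) _)) (sym (R.*-identityˡ _))
  where
  eq = solve 3 (λ a b c → a :* (b :* c) := b :* (a :* c)) refl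
cramer {n} M (suc i) = trans (sum-cong (λ j → eq (M (suc i) j) (sgn j) _))
    (trans (detℤ-repeat n i M′ (λ j → refl)) (sym (R.zeroˡ _)))
  where
  M′ : Fin (suc n) → Fin (suc n) → ℤ
  M′ zero = M (suc i)
  M′ (suc r) = M (suc r)
  eq = solve 3 (λ a b c → a :* (b :* c) := b :* (a :* c)) refl

-- Evaluation of polynomials

ev : Poly → ℤ → ℤ
ev [] x = + 0
ev (a ∷ p) x = a + x * ev p x

opaque
  unfolding _+_ _*_ -_

  ev-⊕ : ∀ p q x → ev (p ⊕ q) x ≡ ev p x + ev q x
  ev-⊕ [] q x = sym (R.+-identityˡ _)
  ev-⊕ (a ∷ p) [] x = sym (R.+-identityʳ _)
  ev-⊕ (a ∷ p) (b ∷ q) x = trans (cong (λ t → a + b + x * t) (ev-⊕ p q x)) (solve 5 (λ a b x s t → a :+ b :+ x :* (s :+ t) := (a :+ x :* s) :+ (b :+ x :* t)) refl a b x (ev p x) (ev q x))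

  ev-scale : ∀ c p x → ev (scale c p) x ≡ c * ev p x
  ev-scale c [] x = sym (R.zeroʳ c)
  ev-scale c (a ∷ p) x = trans (cong (λ t → c * a + x * t) (ev-scale c p x)) (solve 4 (λ c a x s → c :* a :+ x :* (c :* s) := c :* (a :+ x :* s)) refl c a x (ev p x))

  ev-⊗ : ∀ p q x → ev (p ⊗ q) x ≡ ev p x * ev q x
  ev-⊗ [] q x = sym (R.zeroˡ (ev q x))
  ev-⊗ (a ∷ p) q x = trans (ev-⊕ (scale a q) (+ 0 ∷ (p ⊗ q)) x)
    (trans (cong₂ _+_ (ev-scale a q x) (cong (λ t → + 0 + x * t) (ev-⊗ p q x))) (solve 4 (λ a x s t → a :* t :+ (♯ 0 :+ x :* (s :* t)) := (a :+ x :* s) :* t) refl a x (ev p x) (ev q x)))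

  coeff-⊕ : ∀ p q k → coeff (p ⊕ q) k ≡ coeff p k + coeff q k
  coeff-⊕ [] q k = sym (R.+-identityˡ _)
  coeff-⊕ (a ∷ p) [] k = sym (R.+-identityʳ _)
  coeff-⊕ (a ∷ p) (b ∷ q) zero = refl
  coeff-⊕ (a ∷ p) (b ∷ q) (suc k) = coeff-⊕ p q k

  coeff-scale : ∀ c p k → coeff (scale c p) k ≡ c * coeff p k
  coeff-scale c [] k = sym (R.zeroʳ c)
  coeff-scale c (a ∷ p) zero = refl
  coeff-scale c (a ∷ p) (suc k) = coeff-scale c p k

  small-multiple : ∀ a e m → ∣ a ∣ ℕ.≤ m → a + + suc m * e ≡ + 0 → a ≡ + 0
  small-multiple a e m q p = by-cases ∣ e ∣ refl
    where
    by-cases : ∀ k → ∣ e ∣ ≡ k → a ≡ + 0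
    by-cases zero ∣e∣≡ = trans (sym (trans (cong (λ t → a + + suc m * t) (ℤₚ.∣i∣≡0⇒i≡0 ∣e∣≡)) (trans (cong (λ t → a + t) (R.zeroʳ (+ suc m))) (R.+-identityʳ a)))) p
    by-cases (suc k) ∣e∣≡ = ⊥-elim (ℕₚ.<-irrefl refl (ℕₚ.≤-trans (s≤s q) (ℕₚ.≤-trans (ℕₚ.m≤m*n (suc m) (suc k))
      (ℕₚ.≤-reflexive (trans (cong (suc m ℕ.*_) (sym ∣e∣≡)) (trans (sym (ℤₚ.abs-* (+ suc m) e)) (trans (cong ∣_∣ (neg a _ p)) (ℤₚ.∣-i∣≡∣i∣ a))))))))
      where
      neg : ∀ a b → a + b ≡ + 0 → b ≡ - a
      neg a b p = trans (solve 2 (λ a b → b := a :+ b :+ :- a) refl a b) (trans (cong (λ t → t + - a) p) (R.+-identityˡ (- a)))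

-- The constant term is divisible by an evaluation point larger than its absolute value, hence zero.
-- At nonzero points the factor x can then be cancelled, which leaves the tail of the list; no roots
-- are counted.
ev-zero⇒coeff-zero : ∀ p N → (∀ k → N ℕ.≤ k → ev p (+ k) ≡ + 0) → ∀ i → coeff p i ≡ + 0
ev-zero⇒coeff-zero [] N h i = refl
ev-zero⇒coeff-zero (a ∷ p) N h = result
  where
  a≡0 : a ≡ + 0
  a≡0 = small-multiple a _ (∣ a ∣ ℕ.+ N) (ℕₚ.m≤m+n ∣ a ∣ N) (h (suc (∣ a ∣ ℕ.+ N)) (ℕₚ.m≤n⇒m≤1+n (ℕₚ.m≤n+m N ∣ a ∣)))
  tail-zero : ∀ k → suc N ℕ.≤ k → ev p (+ k) ≡ + 0
  tail-zero (suc k) (s≤s q) with mul-zero {+ suc k} (trans (sym (R.+-identityˡ _)) (trans (cong₂ _+_ (sym a≡0) refl) (h (suc k) (ℕₚ.m≤n⇒m≤1+n q))))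
  ... | inj₂ e = e
  result : ∀ i → coeff (a ∷ p) i ≡ + 0
  result zero = a≡0
  result (suc i) = ev-zero⇒coeff-zero p (suc N) tail-zero i

-- Through this lemma, identities of polynomial determinants are reduced to integer determinants at
-- every point.
ev≡⇒≈ₚ : ∀ p q → (∀ x → ev p x ≡ ev q x) → p ≈ₚ q
ev≡⇒≈ₚ p q h k = minus-zero (trans (sym (trans (coeff-⊕ p (scale (- + 1) q) k) (cong₂ _+_ refl (trans (coeff-scale _ q k) (eq _)))))
    (ev-zero⇒coeff-zero (p ⊕ scale (- + 1) q) 0
      (λ x _ → trans (ev-⊕ p _ (+ x)) (trans (cong₂ _+_ (h (+ x)) (trans (ev-scale _ q (+ x)) (eq _))) (R.-‿inverseʳ _))) k))
  where
  eq = solve 1 (λ a → (:- ♯ 1) :* a := :- a) refl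

-- The column loop inside det is a local function of Defs. It is named here by letting unification
-- solve for it: after two unfoldings its row index, column count, column map and sign are
-- syntactically distinct, so that with-abstraction turns them into independent variables.

PolyMat : ℕ → Set
PolyMat n = Fin (suc n) → Fin (suc n) → Poly

laplaceTerm : ∀ n → PolyMat n → ℤ → Fin (suc n) → Poly
laplaceTerm n M s j = scale s (M zero j ⊗ det n (λ r c → M (suc r) (punchIn j c)))

mutual
  loop₂ : ∀ m → PolyMat (suc m) → Poly
  loop₂ = _

  det≡loop₂ : ∀ m M → det (suc (suc m)) M ≡ laplaceTerm (suc m) M (+ 1) zero ⊕ (laplaceTerm (suc m) M (ℤ.- + 1) (suc zero) ⊕ loop₂ m M)
  det≡loop₂ m M = refl

mutual
  loop : (n : ℕ) (M : PolyMat n) (k : ℕ) (f : Fin k → Fin (suc n)) (s : ℤ) → Poly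
  loop = _

  loop≡loop₂ : ∀ m M → loop (suc m) M m (λ t → suc (suc t)) (+ 1) ≡ loop₂ m M
  loop≡loop₂ m M with m | ℕ.suc m | (Fin m → Fin (suc (suc m))) Function.∋ (λ t → suc (suc t)) | + 1
  ... | k | n | f | s = refl

opaque
  unfolding -_

  ev-loop : ∀ n (M : PolyMat n) k f s x → ev (loop n M k f s) x ≡ sum (λ t → sgn t * (s * ev (M zero (f t) ⊗ det n (λ r c → M (suc r) (punchIn (f t) c))) x))
  ev-loop n M zero f s x = sym (sum-zero _)
  ev-loop n M (suc k) f s x = trans (ev-⊕ (laplaceTerm n M s (f zero)) (loop n M k (λ t → f (suc t)) (- s)) x)
    (trans (cong₂ _+_ (trans (ev-scale s (term zero) x) (sym (R.*-identityˡ _)))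
      (trans (ev-loop n M k (λ t → f (suc t)) (- s) x) (sum-cong (λ t → solve 3 (λ a s b → a :* (:- s :* b) := :- a :* (s :* b)) refl (sgn t) s (ev (term (suc t)) x))))) (sym (sum-suc _)))
    where
    term : Fin (suc k) → Poly
    term t = M zero (f t) ⊗ det n (λ r c → M (suc r) (punchIn (f t) c))

  coeff-loop : ∀ n (M : PolyMat n) m → (∀ j → coeff (M zero j ⊗ det n (λ r c → M (suc r) (punchIn j c))) m ≡ + 0) →
    ∀ k f s → coeff (loop n M k f s) m ≡ + 0
  coeff-loop n M m h zero f s = refl
  coeff-loop n M m h (suc k) f s = trans (coeff-⊕ (laplaceTerm n M s (f zero)) (loop n M k (λ t → f (suc t)) (- s)) m)
    (trans (cong₂ _+_ (trans (coeff-scale s (M zero (f zero) ⊗ _) m) (trans (cong₂ _*_ refl (h (f zero))) (R.zeroʳ s))) (coeff-loop n M m h k (λ t → f (suc t)) (- s))) (R.+-identityˡ _))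

ev-det : ∀ n (M : Fin n → Fin n → Poly) x → ev (det n M) x ≡ detℤ n (λ i j → ev (M i j) x)
ev-det zero M x = trans (cong₂ _+_ refl (R.zeroʳ x)) (R.+-identityʳ _)
ev-det (suc n) M x = trans (ev-loop n M (suc n) (λ j → j) (+ 1) x)
  (sum-cong (λ j → cong₂ _*_ refl (trans (R.*-identityˡ _) (trans (ev-⊗ (M zero j) _ x) (cong₂ _*_ refl (ev-det n (λ r c → M (suc r) (punchIn j c)) x))))))

-- Walk counts

Matrix : ℕ → Set
Matrix n = Fin n → Fin n → ℤ

pow : ∀ {n} → Matrix n → ℕ → Matrix n
pow a zero = δ
pow a (suc k) i j = sum (λ l → a i l * pow a k l j)

trace : ∀ {n} → Matrix n → ℤ
trace a = sum (λ i → a i i)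

Symmetric : ∀ {n} → Matrix n → Set
Symmetric a = ∀ i j → a i j ≡ a j i

pow-sucʳ : ∀ {n} (a : Matrix n) k i j → pow a (suc k) i j ≡ sum (λ l → pow a k i l * a l j)
pow-sucʳ a zero i j = trans (sum-δʳ j (λ l → a i l)) (sym (sum-δˡ i (λ l → a l j)))
pow-sucʳ a (suc k) i j = begin
  sum (λ l → a i l * pow a (suc k) l j)
    ≡⟨ sum-cong (λ l → trans (cong₂ _*_ refl (pow-sucʳ a k l j)) (sym (sum-*ˡ (a i l) _))) ⟩
  sum (λ l → sum (λ m → a i l * (pow a k l m * a m j)))
    ≡⟨ sum-comm _ ⟩
  sum (λ m → sum (λ l → a i l * (pow a k l m * a m j)))
    ≡⟨ sum-cong (λ m → trans (sum-cong (λ l → sym (R.*-assoc (a i l) _ _))) (sum-*ʳ (a m j) _)) ⟩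
  sum (λ m → pow a (suc k) i m * a m j) ∎
  where open ≡-Reasoning

pow-sym : ∀ {n} (a : Matrix n) → Symmetric a → ∀ k → Symmetric (pow a k)
pow-sym a s zero i j = δ-sym i j
pow-sym a s (suc k) i j = trans (sum-cong (λ l → trans (cong₂ _*_ (s i l) (pow-sym a s k l j)) (R.*-comm _ _))) (sym (pow-sucʳ a k j i))

pow-add : ∀ {n} (a : Matrix n) p q i j → sum (λ l → pow a p i l * pow a q l j) ≡ pow a (p ℕ.+ q) i j
pow-add a zero q i j = sum-δˡ i (λ l → pow a q l j)
pow-add a (suc p) q i j = begin
  sum (λ l → sum (λ m → a i m * pow a p m l) * pow a q l j)
    ≡⟨ sum-cong (λ l → trans (sym (sum-*ʳ (pow a q l j) _)) (sum-cong (λ m → R.*-assoc (a i m) _ _))) ⟩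
  sum (λ l → sum (λ m → a i m * (pow a p m l * pow a q l j)))
    ≡⟨ sum-comm _ ⟩
  sum (λ m → sum (λ l → a i m * (pow a p m l * pow a q l j)))
    ≡⟨ sum-cong (λ m → trans (sum-*ˡ (a i m) _) (cong₂ _*_ refl (pow-add a p q m j))) ⟩
  pow a (suc p ℕ.+ q) i j ∎
  where open ≡-Reasoning

⊛-sum : ∀ {n} (c : Fin n → ℤ) (g : Fin n → Series) h → (λ m → sum (λ l → c l * g l m)) ⊛ h ≈ (λ k → sum (λ l → c l * (g l ⊛ h) k))
⊛-sum c g h zero = trans (sym (sum-*ʳ (h 0) _)) (sum-cong (λ l → R.*-assoc (c l) _ _))
⊛-sum c g h (suc k) = trans (cong₂ _+_ (trans (sym (sum-*ʳ (h (suc k)) _)) (sum-cong (λ l → R.*-assoc (c l) _ _))) (⊛-sum c (λ l → tl (g l)) h k))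
  (trans (sym (sum-+ _ _)) (sum-cong (λ l → sym (R.distribˡ (c l) _ _))))

z⊛-⊛ : ∀ f g → z⊛ f ⊛ g ≈ z⊛ (f ⊛ g)
z⊛-⊛ f g zero = R.zeroˡ (g 0)
z⊛-⊛ f g (suc k) = trans (cong₂ _+_ (R.zeroˡ (g (suc k))) refl) (R.+-identityˡ _)

-- Each of the `k + 1` ways to write `k` as `p + q` contributes `u k`. The factor obtained here
-- becomes the derivative in `trace-removal`.
sum-diagonal : ∀ {n} (g h : Fin n → Series) (u : Series) → (∀ p q → sum (λ i → g i p * h i q) ≡ u (p ℕ.+ q)) →
  ∀ k → sum (λ i → (g i ⊛ h i) k) ≡ + suc k * u k
sum-diagonal g h u e zero = trans (e 0 0) (sym (R.*-identityˡ (u 0)))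
sum-diagonal g h u e (suc k) = trans (sum-+ _ _) (trans (cong₂ _+_ (e 0 (suc k)) (sum-diagonal (λ i → tl (g i)) h (tl u) (λ p q → e (suc p) q) k))
  (trans (eq (u (suc k)) (+ suc k)) (cong₂ _*_ (sym (suc≡1+ (suc k))) refl)))
  where
  eq = solve 2 (λ u k → u :+ k :* u := (♯ 1 :+ k) :* u) refl

-- The Euler operator z d/dz.
D : Series → Series
D f k = + k * f k

D-⊛ : ∀ f g → D (f ⊛ g) ≈ D f ⊛ g ⊕s f ⊛ D g
D-⊛ f g zero = eq (f 0) (g 0)
  where
  eq = solve 2 (λ a b → ♯ 0 :* (a :* b) := ♯ 0 :* a :* b :+ a :* (♯ 0 :* b)) refl
D-⊛ f g (suc k) = begin
  + suc k * (f 0 * g (suc k) + (tl f ⊛ g) k)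
    ≡⟨ cong₂ _*_ (suc≡1+ k) refl ⟩
  (+ 1 + + k) * (f 0 * g (suc k) + (tl f ⊛ g) k)
    ≡⟨ eq₁ (+ k) (f 0) (g (suc k)) _ ⟩
  f 0 * ((+ 1 + + k) * g (suc k)) + ((tl f ⊛ g) k + + k * (tl f ⊛ g) k)
    ≡⟨ cong₂ _+_ refl (cong₂ _+_ refl (D-⊛ (tl f) g k)) ⟩
  f 0 * ((+ 1 + + k) * g (suc k)) + ((tl f ⊛ g) k + ((D (tl f) ⊛ g) k + (tl f ⊛ D g) k))
    ≡⟨ eq₂ (f 0) (g (suc k)) _ _ _ _ ⟩
  (+ 0 * f 0 * g (suc k) + ((tl f ⊛ g) k + (D (tl f) ⊛ g) k)) + (f 0 * ((+ 1 + + k) * g (suc k)) + (tl f ⊛ D g) k)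
    ≡⟨ cong₂ _+_ (cong₂ _+_ refl (sym (trans (⊛-cong {g = g} tl-D (λ _ → refl) k) (⊛-distribʳ g (tl f) (D (tl f)) k))))
         (cong₂ _+_ (cong₂ _*_ refl (cong₂ _*_ (sym (suc≡1+ k)) refl)) refl) ⟩
  (D f ⊛ g ⊕s f ⊛ D g) (suc k) ∎
  where
  open ≡-Reasoning
  tl-D : tl (D f) ≈ tl f ⊕s D (tl f)
  tl-D m = trans (cong₂ _*_ (suc≡1+ m) refl) (eq (+ m) (f (suc m)))
    where
    eq = solve 2 (λ m a → (♯ 1 :+ m) :* a := a :+ m :* a) refl
  eq₁ = solve 4 (λ k a b c → (♯ 1 :+ k) :* (a :* b :+ c) := a :* ((♯ 1 :+ k) :* b) :+ (c :+ k :* c)) refl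
  eq₂ = solve 6 (λ a b x c d e → a :* x :+ (c :+ (d :+ e)) := (♯ 0 :* a :* b :+ (c :+ d)) :+ (a :* x :+ e)) refl

⊛-cancel : ∀ f g → g 0 ≡ + 1 → f ⊛ g ≈ (λ _ → + 0) → f ≈ (λ _ → + 0)
⊛-cancel f g g1 e zero = trans (sym (trans (cong₂ _*_ refl g1) (R.*-identityʳ (f 0)))) (e 0)
⊛-cancel f g g1 e (suc k) = ⊛-cancel (tl f) g g1 (λ m → trans (sym (R.+-identityˡ _))
  (trans (cong₂ _+_ (sym (trans (cong₂ _*_ (⊛-cancel f g g1 e zero) refl) (R.zeroˡ (g (suc m))))) refl) (e (suc m)))) k

-- Removing a vertex

1-δ : ∀ {n} → Fin n → Fin n → ℤ
1-δ v i = + 1 - δ v i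

-- The vertex is kept as an isolated index, so that all matrices of one argument share the index
-- type `Fin n`.
del : ∀ {n} → Fin n → Matrix n → Matrix n
del v a i j = 1-δ v i * (1-δ v j * a i j)

1-δ-refl : ∀ {n} (v : Fin n) → 1-δ v v ≡ + 0
1-δ-refl v = trans (cong₂ _-_ refl (δ-refl v)) (R.-‿inverseʳ (+ 1))

1-δ-≢ : ∀ {n} {v i : Fin n} → ¬ (v ≡ i) → 1-δ v i ≡ + 1
1-δ-≢ p = trans (cong₂ _-_ refl (δ-≢ p)) eq
  where
  opaque
    unfolding _+_ _*_ -_
    eq : + 1 - + 0 ≡ + 1
    eq = refl

del-row : ∀ {n} (v : Fin n) a j → del v a v j ≡ + 0
del-row v a j = trans (cong₂ _*_ (1-δ-refl v) refl) (R.zeroˡ _)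

del-col : ∀ {n} (v : Fin n) a i → del v a i v ≡ + 0
del-col v a i = trans (cong₂ _*_ refl (trans (cong₂ _*_ (1-δ-refl v) refl) (R.zeroˡ _))) (R.zeroʳ (1-δ v i))

del-other : ∀ {n} {v i j : Fin n} (a : Matrix n) → ¬ (v ≡ i) → ¬ (v ≡ j) → del v a i j ≡ a i j
del-other a p q = trans (cong₂ _*_ (1-δ-≢ p) (trans (cong₂ _*_ (1-δ-≢ q) refl) (R.*-identityˡ _))) (R.*-identityˡ _)

del-sym : ∀ {n} (v : Fin n) a → Symmetric a → Symmetric (del v a)
del-sym v a s i j = trans (eq (1-δ v i) (1-δ v j) (a i j)) (cong₂ _*_ refl (cong₂ _*_ refl (s i j)))
  where
  eq = solve 3 (λ a b c → a :* (b :* c) := b :* (a :* c)) refl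

module Remove {n : ℕ} (a : Matrix n) (a-sym : Symmetric a) (v : Fin n) (a-vv : a v v ≡ + 0) where

  a′ : Matrix n
  a′ = del v a

  closed : Series
  closed k = pow a k v v

  -- Coefficient `k` counts the walks of length `k + 2` from `v` to `v` that meet `v` only at their
  -- two ends.
  returns : Series
  returns k = sum (λ l → a v l * sum (λ m → pow a′ k l m * a v m))

  private
    -- First-passage series: walks from `i` that reach `v` only at their last vertex.
    hit : Fin n → Series
    hit i zero = δ v i
    hit i (suc k) = sum (λ l → pow a′ k i l * a v l)

    split-a : ∀ i l → a i l ≡ a′ i l + (δ v i * a v l + a i v * δ v l)
    split-a i l with v ≟ i | v ≟ l
    ... | yes refl | yes refl = trans a-vv (sym (trans (cong₂ _+_ refl (cong₂ _+_ (cong₂ _*_ refl a-vv) (cong₂ _*_ a-vv refl))) (eq (a v v))))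
      where
      eq = solve 1 (λ x → (♯ 1 :- ♯ 1) :* ((♯ 1 :- ♯ 1) :* x) :+ (♯ 1 :* ♯ 0 :+ ♯ 0 :* ♯ 1) := ♯ 0) refl
    ... | yes refl | no _ = eq (a v l) (a v v)
      where
      eq = solve 2 (λ x y → x := (♯ 1 :- ♯ 1) :* ((♯ 1 :- ♯ 0) :* x) :+ (♯ 1 :* x :+ y :* ♯ 0)) refl
    ... | no _ | yes refl = eq (a i v) (a v v)
      where
      eq = solve 2 (λ x y → x := (♯ 1 :- ♯ 0) :* ((♯ 1 :- ♯ 1) :* x) :+ (♯ 0 :* y :+ x :* ♯ 1)) refl
    ... | no _ | no _ = eq (a i l) (a v l) (a i v)
      where
      eq = solve 3 (λ x y z → x := (♯ 1 :- ♯ 0) :* ((♯ 1 :- ♯ 0) :* x) :+ (♯ 0 :* y :+ z :* ♯ 0)) refl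

    tl-hit : ∀ i → tl (hit i) ≈ (λ m → sum (λ l → a′ i l * hit l m)) ⊕s const (a v i)
    tl-hit i zero = trans (sum-δˡ i (a v)) (sym (trans (cong₂ _+_ (trans (sum-cong (λ l → cong₂ _*_ refl (δ-sym v l))) (trans (sum-δʳ v (a′ i)) (del-col v a i))) refl) (R.+-identityˡ _)))
    tl-hit i (suc m) = trans (begin
      sum (λ p → sum (λ l → a′ i l * pow a′ m l p) * a v p)
        ≡⟨ sum-cong (λ p → trans (sym (sum-*ʳ (a v p) _)) (sum-cong (λ l → R.*-assoc (a′ i l) _ _))) ⟩
      sum (λ p → sum (λ l → a′ i l * (pow a′ m l p * a v p)))
        ≡⟨ sum-comm _ ⟩
      sum (λ l → sum (λ p → a′ i l * (pow a′ m l p * a v p)))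
        ≡⟨ sum-cong (λ l → sum-*ˡ (a′ i l) _) ⟩
      sum (λ l → a′ i l * hit l (suc m)) ∎) (sym (R.+-identityʳ _))
      where open ≡-Reasoning

    -- A walk either avoids `v` or is cut at its first visit to `v`. The constant on the left
    -- compensates for the empty walk at `v`, which both terms on the right count because `v`
    -- survives in `a′` as an isolated index.
    walk : ∀ i j k → pow a k i j + const (δ v i * δ v j) k ≡ pow a′ k i j + (hit i ⊛ (λ k → pow a k v j)) k
    walk i j zero = refl
    walk i j (suc k) = begin
      sum (λ l → a i l * w l) + + 0
        ≡⟨ R.+-identityʳ _ ⟩
      sum (λ l → a i l * w l)
        ≡⟨ sum-cong (λ l → trans (cong₂ _*_ (split-a i l) refl) (eq₁ (a′ i l) (δ v i) (a v l) (a i v) (δ v l) (w l))) ⟩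
      sum (λ l → a′ i l * w l + (δ v i * (a v l * w l) + a i v * (δ v l * w l)))
        ≡⟨ trans (sum-+ _ _) (cong₂ _+_ refl (trans (sum-+ _ _) (cong₂ _+_ (sum-*ˡ (δ v i) _) (trans (sum-*ˡ (a i v) _) (cong₂ _*_ (a-sym i v) (sum-δˡ v w)))))) ⟩
      sum (λ l → a′ i l * w l) + (δ v i * sum (λ l → a v l * w l) + a v i * w v)
        ≡⟨ cong₂ _+_ rec refl ⟩
      (pow a′ (suc k) i j + X) + (δ v i * sum (λ l → a v l * w l) + a v i * w v)
        ≡⟨ eq₂ (pow a′ (suc k) i j) X (δ v i * sum (λ l → a v l * w l)) (a v i * w v) ⟩
      pow a′ (suc k) i j + (δ v i * sum (λ l → a v l * w l) + (X + a v i * w v))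
        ≡⟨ cong₂ _+_ refl (cong₂ _+_ refl (sym (trans (⊛-cong {g = y} (tl-hit i) (λ _ → refl) k) (trans (⊛-distribʳ y _ _ k) (cong₂ _+_ (⊛-sum (a′ i) hit y k) (const-⊛ (a v i) y k)))))) ⟩
      pow a′ (suc k) i j + (hit i ⊛ y) (suc k) ∎
      where
      open ≡-Reasoning
      w : Fin n → ℤ
      w l = pow a k l j
      y : Series
      y k = pow a k v j
      X : ℤ
      X = sum (λ l → a′ i l * (hit l ⊛ y) k)
      eq₁ = solve 6 (λ p d x q e w → (p :+ (d :* x :+ q :* e)) :* w := p :* w :+ (d :* (x :* w) :+ q :* (e :* w))) refl
      eq₂ = solve 4 (λ p x d e → (p :+ x) :+ (d :+ e) := p :+ (d :+ (x :+ e))) refl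
      const-* : ∀ x c k → const (x * c) k ≡ x * const c k
      const-* x c zero = refl
      const-* x c (suc k) = sym (R.zeroʳ x)
      vanish : sum (λ l → a′ i l * const (δ v l * δ v j) k) ≡ + 0
      vanish = trans (sum-cong (λ l → trans (cong₂ _*_ refl (const-* (δ v l) (δ v j) k)) (eq (a′ i l) (δ v l) _)))
        (trans (sum-δˡ v _) (trans (cong₂ _*_ (del-col v a i) refl) (R.zeroˡ _)))
        where
        eq = solve 3 (λ a d c → a :* (d :* c) := d :* (a :* c)) refl
      rec : sum (λ l → a′ i l * w l) ≡ pow a′ (suc k) i j + X
      rec = begin
        sum (λ l → a′ i l * w l)
          ≡⟨ trans (cong₂ _+_ refl vanish) (R.+-identityʳ _) ⟨
        sum (λ l → a′ i l * w l) + sum (λ l → a′ i l * const (δ v l * δ v j) k)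
          ≡⟨ sum-+ _ _ ⟨
        sum (λ l → a′ i l * w l + a′ i l * const (δ v l * δ v j) k)
          ≡⟨ sum-cong (λ l → trans (sym (R.distribˡ (a′ i l) _ _)) (trans (cong₂ _*_ refl (walk l j k)) (R.distribˡ (a′ i l) _ _))) ⟩
        sum (λ l → a′ i l * pow a′ k l j + a′ i l * (hit l ⊛ y) k)
          ≡⟨ sum-+ _ _ ⟩
        pow a′ (suc k) i j + X ∎

    pow-isolated : ∀ k i → pow a′ k i v ≡ const (δ v i) k
    pow-isolated zero i = δ-sym i v
    pow-isolated (suc k) i = trans (pow-sucʳ a′ k i v) (sum-0 (λ l → trans (cong₂ _*_ refl (del-col v a l)) (R.zeroʳ _)))

    walk-v : ∀ i → (λ k → pow a k v i) ≈ hit i ⊛ closed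
    walk-v i k = +-cancelʳ (trans (cong₂ _+_ (pow-sym a a-sym k v i) refl) (trans (walk i v k)
      (trans (R.+-comm _ _) (cong₂ _+_ refl (trans (pow-isolated k i) (cong (λ t → const t k) (sym (trans (cong₂ _*_ refl (δ-refl v)) (R.*-identityʳ _)))))))))
      where
      +-cancelʳ : ∀ {a b c} → a + c ≡ b + c → a ≡ b
      +-cancelʳ {a} {b} {c} e = trans (sym (eq a c)) (trans (cong (λ t → t - c) e) (eq b c))
        where
        eq = solve 2 (λ a c → a :+ c :- c := a) refl

  closed-renewal : closed ≈ const (+ 1) ⊕s z⊛ (z⊛ (returns ⊛ closed))
  closed-renewal zero = trans (δ-refl v) (sym (R.+-identityʳ _))
  closed-renewal (suc k) = begin
    sum (λ l → a v l * pow a k l v)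
      ≡⟨ sum-cong (λ l → cong₂ _*_ refl (trans (pow-sym a a-sym k l v) (walk-v l k))) ⟩
    sum (λ l → a v l * (hit l ⊛ closed) k)
      ≡⟨ ⊛-sum (a v) hit closed k ⟨
    ((λ m → sum (λ l → a v l * hit l m)) ⊛ closed) k
      ≡⟨ ⊛-cong {g = closed} first (λ _ → refl) k ⟩
    (z⊛ returns ⊛ closed) k
      ≡⟨ z⊛-⊛ returns closed k ⟩
    z⊛ (returns ⊛ closed) k
      ≡⟨ R.+-identityˡ _ ⟨
    + 0 + z⊛ (returns ⊛ closed) k ∎
    where
    open ≡-Reasoning
    first : (λ m → sum (λ l → a v l * hit l m)) ≈ z⊛ returns
    first zero = trans (sum-cong (λ l → cong₂ _*_ refl (δ-sym v l))) (trans (sum-δʳ v (a v)) a-vv)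
    first (suc m) = refl

  -- `closed` is the quotient det(1 - z a′) / det(1 - z a), and this is its logarithmic derivative.
  -- Closed walks at `v` with a marked position `i` give the factor `k + 1`; cutting them by first
  -- passage instead turns the same count into `S ⊛ closed`, where `S` less 1 is the difference of
  -- the traces by `walk` on the diagonal.
  trace-removal : D closed ≈ ((λ k → trace (pow a k)) ⊕s negs (λ k → trace (pow a′ k))) ⊛ closed
  trace-removal k = begin
    + k * closed k
      ≡⟨ eq (+ k) (closed k) ⟩
    (+ 1 + + k) * closed k + negs closed k
      ≡⟨ cong₂ _+_ (trans (cong₂ _*_ (sym (suc≡1+ k)) refl) (sym (sum-diagonal (λ i k → pow a k v i) (λ i k → pow a k v i) closed diag k))) refl ⟩
    sum (λ i → ((λ k → pow a k v i) ⊛ (λ k → pow a k v i)) k) + negs closed k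
      ≡⟨ cong₂ _+_ (sum-cong (λ i → trans (⊛-cong {g = λ k → pow a k v i} (walk-v i) (λ _ → refl) k)
           (trans (SeriesSolver.solve 3 (λ h c y → h :⊛ c :⊛ y :≈ h :⊛ y :⊛ c) (λ _ → refl) (hit i) closed (λ k → pow a k v i) k) (sym (R.*-identityˡ _))))) refl ⟩
    sum (λ i → + 1 * (hit i ⊛ (λ k → pow a k v i) ⊛ closed) k) + negs closed k
      ≡⟨ cong₂ _+_ (⊛-sum (λ _ → + 1) (λ i → hit i ⊛ (λ k → pow a k v i)) closed k) refl ⟨
    (S ⊛ closed) k + negs closed k
      ≡⟨ SeriesSolver.solve 2 (λ s c → s :⊛ c :⊕ (:⊖ c) :≈ (s :⊕ (:⊖ :const (+ 1))) :⊛ c) (λ _ → refl) S closed k ⟩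
    ((S ⊕s negs (const (+ 1))) ⊛ closed) k
      ≡⟨ ⊛-cong {g = closed} total (λ _ → refl) k ⟩
    (((λ k → trace (pow a k)) ⊕s negs (λ k → trace (pow a′ k))) ⊛ closed) k ∎
    where
    open ≡-Reasoning
    S : Series
    S = λ k → sum (λ i → + 1 * (hit i ⊛ (λ k → pow a k v i)) k)
    diag : ∀ p q → sum (λ i → pow a p v i * pow a q v i) ≡ closed (p ℕ.+ q)
    diag p q = trans (sum-cong (λ i → cong₂ _*_ refl (pow-sym a a-sym q v i))) (pow-add a p q v v)
    eq = solve 2 (λ k c → k :* c := (♯ 1 :+ k) :* c :+ :- c) refl
    eq′ : ∀ x y t t′ → t + x ≡ t′ + y → y - x ≡ t - t′
    eq′ x y t t′ e = trans (lem₁ x y t t′) (trans (cong (λ u → t - t′ + (u - (t + x))) (sym e)) (lem₂ t t′ x))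
      where
      lem₁ = solve 4 (λ x y t t′ → y :- x := t :- t′ :+ ((t′ :+ y) :- (t :+ x))) refl
      lem₂ = solve 3 (λ t t′ x → t :- t′ :+ ((t :+ x) :- (t :+ x)) := t :- t′) refl
    const-sum : ∀ k → sum (λ i → const (δ v i * δ v i) k) ≡ const (+ 1) k
    const-sum zero = trans (sum-δˡ v (δ v)) (δ-refl v)
    const-sum (suc k) = sum-0 (λ i → refl)
    total : S ⊕s negs (const (+ 1)) ≈ (λ k → trace (pow a k)) ⊕s negs (λ k → trace (pow a′ k))
    total k = eq′ (const (+ 1) k) (S k) _ _ (trans (cong₂ _+_ refl (sym (const-sum k))) (trans (sym (sum-+ _ _))
      (trans (sum-cong (λ i → trans (walk i i k) (cong₂ _+_ refl (sym (R.*-identityˡ _))))) (sum-+ _ _))))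

-- Newton's identities

charMatrix : ∀ {n} → Matrix n → Fin n → Fin n → Poly
charMatrix a i j = - a i j ∷ δ i j ∷ []

χ : ∀ n → Matrix n → Poly
χ n a = det n (charMatrix a)

coeff-linear-⊗ : ∀ a b q k → (∀ m → k ℕ.≤ m → coeff q m ≡ + 0) → ∀ m → suc k ℕ.≤ m → coeff ((a ∷ b ∷ []) ⊗ q) m ≡ + 0
coeff-linear-⊗ a b q k h (suc m) (s≤s p) = trans (coeff-⊕ (scale a q) _ (suc m))
  (trans (cong₂ _+_ (trans (coeff-scale a q (suc m)) (trans (cong₂ _*_ refl (h (suc m) (ℕₚ.m≤n⇒m≤1+n p))) (R.zeroʳ a)))
    (trans (coeff-⊕ (scale b q) _ m) (cong₂ _+_ (trans (coeff-scale b q m) (trans (cong₂ _*_ refl (h m p)) (R.zeroʳ b))) (zz m)))) eq)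
  where
  opaque
    unfolding _+_
    eq : + 0 + (+ 0 + + 0) ≡ + 0
    eq = refl
  zz : ∀ m → coeff (+ 0 ∷ []) m ≡ + 0
  zz zero = refl
  zz (suc m) = refl

coeff-det-linear : ∀ n (u w : Matrix n) m → suc n ℕ.≤ m → coeff (det n (λ i j → u i j ∷ w i j ∷ [])) m ≡ + 0
coeff-det-linear zero u w (suc m) p = refl
coeff-det-linear (suc n) u w m p = coeff-loop n (λ i j → u i j ∷ w i j ∷ []) m
  (λ j → coeff-linear-⊗ (u zero j) (w zero j) (det n (λ r c → u (suc r) (punchIn j c) ∷ w (suc r) (punchIn j c) ∷ [])) (suc n) (coeff-det-linear n (λ r c → u (suc r) (punchIn j c)) (λ r c → w (suc r) (punchIn j c))) m p)
  (suc n) (λ j → j) (+ 1)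

-- rev n f lists f n, f (n - 1), …, f 0, 0, 0, …
rev : ℕ → Series → Series
rev n f zero = f n
rev zero f (suc k) = + 0
rev (suc n) f (suc k) = rev n f k

rev-cong : ∀ n {f g} → f ≈ g → rev n f ≈ rev n g
rev-cong n p zero = p n
rev-cong zero p (suc k) = refl
rev-cong (suc n) p (suc k) = rev-cong n p k

rev-shift : ∀ n f g → (∀ m → f m ≡ g (suc m)) → g 0 ≡ + 0 → ∀ k → rev n f (suc k) ≡ rev n g k
rev-shift zero f g p q zero = sym q
rev-shift zero f g p q (suc k) = refl
rev-shift (suc n) f g p q zero = p n
rev-shift (suc n) f g p q (suc k) = rev-shift n f g p q k

rev-sum : ∀ {m} n (c : Fin m → ℤ) (f : Fin m → Series) → rev n (λ k → sum (λ j → c j * f j k)) ≈ (λ k → sum (λ j → c j * rev n (f j) k))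
rev-sum n c f zero = refl
rev-sum zero c f (suc k) = sym (sum-0 (λ j → R.zeroʳ (c j)))
rev-sum (suc n) c f (suc k) = rev-sum n c f k

rev-⊕ : ∀ n f g → rev n (f ⊕s g) ≈ rev n f ⊕s rev n g
rev-⊕ n f g zero = refl
rev-⊕ zero f g (suc k) = sym (R.+-identityˡ _)
rev-⊕ (suc n) f g (suc k) = rev-⊕ n f g k

rev-scale : ∀ n c f → rev n (λ k → c * f k) ≈ (λ k → c * rev n f k)
rev-scale n c f zero = refl
rev-scale zero c f (suc k) = sym (R.zeroʳ c)
rev-scale (suc n) c f (suc k) = rev-scale n c f k

-- The reciprocal polynomial det(1 - z a).
charSeries : ∀ n → Matrix n → Series
charSeries n a = rev n (coeff (χ n a))

psum : ∀ {n} → (Fin n → Poly) → Poly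
psum {zero} f = []
psum {suc n} f = f zero ⊕ psum (λ i → f (suc i))

ev-psum : ∀ {n} (f : Fin n → Poly) x → ev (psum f) x ≡ sum (λ i → ev (f i) x)
ev-psum {zero} f x = sym (sum-zero _)
ev-psum {suc n} f x = trans (ev-⊕ (f zero) _ x) (trans (cong₂ _+_ refl (ev-psum (λ i → f (suc i)) x)) (sym (sum-suc _)))

coeff-psum : ∀ {n} (f : Fin n → Poly) k → coeff (psum f) k ≡ sum (λ i → coeff (f i) k)
coeff-psum {zero} f x = sym (sum-zero _)
coeff-psum {suc n} f x = trans (coeff-⊕ (f zero) _ x) (trans (cong₂ _+_ refl (coeff-psum (λ i → f (suc i)) x)) (sym (sum-suc _)))

minor₀ : ∀ {n} → Matrix (suc n) → Matrix n
minor₀ a i j = a (suc i) (suc j)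

module _ {n : ℕ} (a : Matrix (suc n)) where

  private
    X : Series
    X = coeff (χ (suc n) a)

    cof : Fin (suc n) → Poly
    cof j = scale (sgn j) (det n (λ r c → charMatrix a (suc r) (punchIn j c)))

    Y : Fin (suc n) → Series
    Y j = coeff (cof j)

    rest : Fin (suc n) → Poly
    rest i = psum (λ j → scale (- a i j) (cof j))

    lhs : Fin (suc n) → Poly
    lhs i = (+ 0 ∷ cof i) ⊕ rest i

    ev-cramer : ∀ i x → ev (lhs i) x ≡ ev (scale (δ i zero) (χ (suc n) a)) x
    ev-cramer i x = begin
      ev (lhs i) x
        ≡⟨ trans (ev-⊕ (+ 0 ∷ cof i) (rest i) x) (cong₂ _+_ (R.+-identityˡ _) (trans (ev-psum (λ j → scale (- a i j) (cof j)) x) (sum-cong (λ j → ev-scale (- a i j) (cof j) x)))) ⟩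
      x * ev (cof i) x + sum (λ j → - a i j * ev (cof j) x)
        ≡⟨ cong₂ _+_ (sym (trans (sum-*ˡ x _) (cong₂ _*_ refl (sum-δˡ i (λ j → ev (cof j) x))))) refl ⟩
      sum (λ j → x * (δ i j * ev (cof j) x)) + sum (λ j → - a i j * ev (cof j) x)
        ≡⟨ sum-+ _ _ ⟨
      sum (λ j → x * (δ i j * ev (cof j) x) + - a i j * ev (cof j) x)
        ≡⟨ sum-cong (λ j → trans (eq x (δ i j) (a i j) (ev (cof j) x)) (cong₂ _*_ refl (trans (ev-scale (sgn j) (det n (λ r c → charMatrix a (suc r) (punchIn j c))) x) (cong₂ _*_ refl (ev-det n _ x))))) ⟩
      sum (λ j → ev (charMatrix a i j) x * cofactor (λ i j → ev (charMatrix a i j) x) j)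
        ≡⟨ cramer (λ i j → ev (charMatrix a i j) x) i ⟩
      δ i zero * detℤ (suc n) (λ i j → ev (charMatrix a i j) x)
        ≡⟨ trans (ev-scale (δ i zero) (χ (suc n) a) x) (cong₂ _*_ refl (ev-det (suc n) (charMatrix a) x)) ⟨
      ev (scale (δ i zero) (χ (suc n) a)) x ∎
      where
      open ≡-Reasoning
      eq = solve 4 (λ x d a c → x :* (d :* c) :+ :- a :* c := (:- a :+ x :* (d :+ x :* ♯ 0)) :* c) refl

    relation : ∀ i k → coeff (+ 0 ∷ cof i) k + sum (λ j → - a i j * Y j k) ≡ δ i zero * X k
    relation i k = trans (cong₂ _+_ refl (sym (trans (coeff-psum (λ j → scale (- a i j) (cof j)) k) (sum-cong (λ j → coeff-scale (- a i j) (cof j) k)))))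
      (trans (sym (coeff-⊕ (+ 0 ∷ cof i) (rest i) k)) (trans (ev≡⇒≈ₚ (lhs i) (scale (δ i zero) (χ (suc n) a)) (ev-cramer i) k) (coeff-scale (δ i zero) (χ (suc n) a) k)))

    solved : ∀ i k → coeff (+ 0 ∷ cof i) k ≡ sum (λ j → a i j * Y j k) + δ i zero * X k
    solved i k = trans (eq _ (sum (λ j → a i j * Y j k)) _ _ (relation i k) (trans (sum-cong (λ j → neg (a i j) (Y j k))) (sum-neg _))) refl
      where
      neg = solve 2 (λ a y → :- a :* y := :- (a :* y)) refl
      lem = solve 2 (λ c s → c := s :+ (c :+ :- s)) refl
      opaque
        unfolding _+_ _*_ -_
        eq : ∀ c s s′ t → c + s′ ≡ t → s′ ≡ - s → c ≡ s + t
        eq c s _ _ refl refl = lem c s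

    Ỹ : Fin (suc n) → Series
    Ỹ i = rev n (Y i)

    P : Series
    P = charSeries (suc n) a

    Y-top : ∀ i → Y i (suc n) ≡ + 0
    Y-top i = trans (coeff-scale (sgn i) (det n (λ r c → charMatrix a (suc r) (punchIn i c))) (suc n))
      (trans (cong₂ _*_ refl (coeff-det-linear n (λ r c → - a (suc r) (punchIn i c)) (λ r c → δ (suc r) (punchIn i c)) (suc n) ℕₚ.≤-refl)) (R.zeroʳ (sgn i)))

    Ỹ-zero : ∀ i → Ỹ i 0 ≡ δ i zero * P 0
    Ỹ-zero i = trans (solved i (suc n)) (trans (cong₂ _+_ (sum-0 (λ j → trans (cong₂ _*_ refl (Y-top j)) (R.zeroʳ (a i j)))) refl) (R.+-identityˡ _))

    Ỹ-suc : ∀ i k → Ỹ i (suc k) ≡ sum (λ j → a i j * Ỹ j k) + δ i zero * P (suc k)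
    Ỹ-suc i k = trans (rev-shift n (Y i) g (λ m → solved i (suc m)) (sym (solved i 0)) k)
      (trans (rev-⊕ n _ _ k) (cong₂ _+_ (rev-sum n (a i) Y k) (rev-scale n (δ i zero) X k)))
      where
      g : Series
      g k = sum (λ j → a i j * Y j k) + δ i zero * X k

    -- Read from the top degree, the cofactors obey the recurrence of walks ending at vertex 0, with
    -- `P` as source term: the adjugate of 1 - z a is its determinant times the geometric series in
    -- z a.
    Ỹ-walk : ∀ i → Ỹ i ≈ (λ k → pow a k i zero) ⊛ P
    Ỹ-walk i zero = Ỹ-zero i
    Ỹ-walk i (suc k) = trans (Ỹ-suc i k) (trans (R.+-comm _ _) (cong₂ _+_ refl
      (trans (sum-cong (λ j → cong₂ _*_ refl (Ỹ-walk j k))) (sym (⊛-sum (a i) (λ j k → pow a k j zero) P k)))))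

  charSeries-minor₀ : charSeries n (minor₀ a) ≈ (λ k → pow a k zero zero) ⊛ charSeries (suc n) a
  charSeries-minor₀ k = trans (sym (rev-cong n (λ m → trans (coeff-scale (+ 1) (χ n (minor₀ a)) m) (R.*-identityˡ _)) k)) (Ỹ-walk zero k)

charSeries-zero : ∀ n (a : Matrix n) → charSeries n a 0 ≡ + 1
charSeries-zero zero a = refl
charSeries-zero (suc n) a = trans (sym (R.*-identityˡ _)) (trans (sym (charSeries-minor₀ a 0)) (charSeries-zero n (minor₀ a)))

-- The trace of the zeroth power is replaced by 0: Newton's identities involve positive powers only,
-- and the sizes of a matrix and of its minor differ.
traces⁺ : ∀ {n} → Matrix n → Series
traces⁺ a zero = + 0
traces⁺ a (suc k) = trace (pow a (suc k))

pow-del₀ : ∀ {n} (a : Matrix (suc n)) k i j → pow (del zero a) k (suc i) (suc j) ≡ pow (minor₀ a) k i j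
pow-del₀ a zero i j = refl
pow-del₀ a (suc k) i j = trans (sum-suc _) (trans (cong₂ _+_ (trans (cong₂ _*_ (del-col zero a (suc i)) refl) (R.zeroˡ _)) refl)
  (trans (R.+-identityˡ _) (sum-cong (λ l → cong₂ _*_ (del-other {v = zero} a (λ ()) (λ ())) (pow-del₀ a k l j)))))

trace-del₀ : ∀ {n} (a : Matrix (suc n)) k → trace (pow (del zero a) (suc k)) ≡ trace (pow (minor₀ a) (suc k))
trace-del₀ a k = trans (sum-suc _) (trans (cong₂ _+_ (sum-0 (λ l → trans (cong₂ _*_ (del-row zero a l) refl) (R.zeroˡ _))) refl)
  (trans (R.+-identityˡ _) (sum-cong (λ i → pow-del₀ a (suc k) i i))))

-- Induction on `n`, removing vertex 0. With `P⁻ ≈ c ⊛ P` and the logarithmic derivative of `c` from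
-- `trace-removal`, the identity multiplied by `c` becomes the identity for the minor; `c` has
-- constant term 1 and cancels.
newton : ∀ n (a : Matrix n) → Symmetric a → (∀ i → a i i ≡ + 0) → D (charSeries n a) ⊕s charSeries n a ⊛ traces⁺ a ≈ (λ _ → + 0)
newton zero a s z k = trans (cong₂ _+_ (zero-D k) (trans (⊛-cong {f = charSeries zero a} (λ _ → refl) zero-T k) (trans (⊛-comm _ _ k) (⊛-zeroˡ _ k)))) (R.+-identityˡ _)
  where
  zero-D : ∀ k → D (charSeries zero a) k ≡ + 0
  zero-D zero = R.zeroˡ _
  zero-D (suc k) = R.zeroʳ (+ suc k)
  zero-T : traces⁺ a ≈ (λ _ → + 0)
  zero-T zero = refl
  zero-T (suc k) = sum-zero _
newton (suc n) a s z = ⊛-cancel _ c (δ-refl {suc n} zero) (λ k → begin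
  ((D P ⊕s P ⊛ T) ⊛ c) k
    ≡⟨ SeriesSolver.solve 6 (λ dp p t c dc t′ → (dp :⊕ p :⊛ t) :⊛ c :≈ (c :⊛ dp :⊕ dc :⊛ p) :⊕ p :⊛ ((t :⊕ (:⊖ t′)) :⊛ c :⊕ (:⊖ dc)) :⊕ (c :⊛ p) :⊛ t′) (λ _ → refl) (D P) P T c (D c) T⁻ k ⟩
  ((c ⊛ D P ⊕s D c ⊛ P) ⊕s P ⊛ ((T ⊕s negs T⁻) ⊛ c ⊕s negs (D c)) ⊕s (c ⊛ P) ⊛ T⁻) k
    ≡⟨ cong₂ _+_ (cong₂ _+_ (trans (R.+-comm _ _) (trans (sym (D-⊛ c P k)) (cong₂ _*_ refl (sym (minor k))))) (vanish k)) (⊛-cong {g = T⁻} (≈-sym minor) (λ _ → refl) k) ⟩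
  D P⁻ k + + 0 + (P⁻ ⊛ T⁻) k
    ≡⟨ cong₂ _+_ (R.+-identityʳ _) refl ⟩
  D P⁻ k + (P⁻ ⊛ T⁻) k
    ≡⟨ newton n (minor₀ a) (λ i j → s (suc i) (suc j)) (λ i → z (suc i)) k ⟩
  + 0 ∎)
  where
  open ≡-Reasoning
  P P⁻ T T⁻ c : Series
  P = charSeries (suc n) a
  P⁻ = charSeries n (minor₀ a)
  T = traces⁺ a
  T⁻ = traces⁺ (minor₀ a)
  c k = pow a k zero zero
  minor : P⁻ ≈ c ⊛ P
  minor = charSeries-minor₀ a
  module Rm = Remove a s zero (z zero)
  difference : (λ k → trace (pow a k)) ⊕s negs (λ k → trace (pow (del zero a) k)) ≈ T ⊕s negs T⁻
  difference zero = trans (R.-‿inverseʳ _) (sym (R.-‿inverseʳ _))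
  difference (suc k) = cong₂ _-_ refl (trace-del₀ a k)
  vanish : P ⊛ ((T ⊕s negs T⁻) ⊛ c ⊕s negs (D c)) ≈ (λ _ → + 0)
  vanish k = trans (⊛-cong {f = P} (λ _ → refl) inner k) (trans (⊛-comm P _ k) (⊛-zeroˡ P k))
    where
    inner : (T ⊕s negs T⁻) ⊛ c ⊕s negs (D c) ≈ (λ _ → + 0)
    inner k = trans (cong₂ _+_ (trans (sym (⊛-cong {g = c} difference (λ _ → refl) k)) (sym (Rm.trace-removal k))) refl) (R.-‿inverseʳ _)

-- The spectrum determines the order of a graph and its closed walk counts

mutual
  -- The local `entry` of `charPoly` receives a name by unification, like the column loop of `det`.
  charEntry : ∀ {n} → Graph n → Fin n → Fin n → Poly
  charEntry = _

  charPoly≡det : ∀ {n} (G : Graph n) → charPoly G ≡ det n (charEntry G)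
  charPoly≡det G = refl

ev-charEntry : ∀ {n} (G : Graph n) i j x → ev (charEntry G i j) x ≡ ev (charMatrix (A G) i j) x
ev-charEntry G i j x with i ≟ j
... | yes _ = cong₂ _+_ neg (cong₂ _*_ refl refl)
  where
  opaque
    unfolding -_
    neg : ℤ.- A G i j ≡ - A G i j
    neg = refl
... | no _ = cong₂ _+_ neg (cong₂ _*_ refl (sym (trans (R.+-identityˡ _) (R.zeroʳ x))))
  where
  opaque
    unfolding -_
    neg : ℤ.- A G i j ≡ - A G i j
    neg = refl

coeff-charPoly : ∀ {n} (G : Graph n) → charPoly G ≈ₚ χ n (A G)
coeff-charPoly {n} G = ev≡⇒≈ₚ (charPoly G) (χ n (A G)) (λ x → trans (ev-det n (charEntry G) x) (trans (detℤ-cong n (λ i j → ev-charEntry G i j x)) (sym (ev-det n (charMatrix (A G)) x))))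

A-sym : ∀ {n} (G : Graph n) → Symmetric (A G)
A-sym G i j = cong (λ b → if b then + 1 else + 0) (Graph.sym G i j)

A-diag : ∀ {n} (G : Graph n) i → A G i i ≡ + 0
A-diag G i = cong (λ b → if b then + 1 else + 0) (Graph.irrefl G i)

-- The coefficient at `m` is 1 for the monic polynomial of `H`, but 0 for `G`, where the degree is
-- at most `n`.
cospectral-size : ∀ {n m} (G : Graph n) (H : Graph m) → Cospectral G H → ¬ (n ℕ.< m)
cospectral-size {n} {m} G H e n<m = case-⊥ (trans (sym (charSeries-zero m (A H))) (trans (sym (coeff-charPoly H m)) (trans (sym (e m)) (trans (coeff-charPoly G m) (coeff-det-linear n (λ i j → - A G i j) δ m n<m)))))
  where
  case-⊥ : ¬ (+ 1 ≡ + 0)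
  case-⊥ ()

-- The two Newton identities share the series `P`; their difference is `P` times the difference of
-- the trace series, and `P` has constant term 1.
cospectral-trace : ∀ {n} (G H : Graph n) → Cospectral G H → ∀ k → trace (pow (A G) k) ≡ trace (pow (A H) k)
cospectral-trace G H e zero = refl
cospectral-trace {n} G H e (suc k) = minus-zero (⊛-cancel (T G ⊕s negs (T H)) P (charSeries-zero n (A G)) (λ k → trans
    (SeriesSolver.solve 4 (λ t t′ p d → (t :⊕ (:⊖ t′)) :⊛ p :≈ (d :⊕ p :⊛ t) :⊕ (:⊖ (d :⊕ p :⊛ t′))) (λ _ → refl) (T G) (T H) P (D P) k)
    (trans (cong₂ _-_ (newton n (A G) (A-sym G) (A-diag G) k) (trans (cong₂ _+_ (cong₂ _*_ refl (PH k)) (⊛-cong {g = T H} PH (λ _ → refl) k)) (newton n (A H) (A-sym H) (A-diag H) k))) (R.-‿inverseʳ (+ 0)))) (suc k))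
  where
  T : Graph n → Series
  T G = traces⁺ (A G)
  P : Series
  P = charSeries n (A G)
  PH : P ≈ charSeries n (A H)
  PH = rev-cong n (λ m → trans (sym (coeff-charPoly G m)) (trans (e m) (coeff-charPoly H m)))

-- Coefficientwise inequalities and growth of power series

infix 4 _⊑_
_⊑_ : Series → Series → Set
f ⊑ g = ∀ k → f k ≤ g k

NonNeg : Series → Set
NonNeg f = ∀ k → + 0 ≤ f k

⊛-nonneg : ∀ {f g} → NonNeg f → NonNeg g → NonNeg (f ⊛ g)
⊛-nonneg p q zero = p 0 ⊠ q 0
⊛-nonneg p q (suc k) = (p 0 ⊠ q (suc k)) ⊞ ⊛-nonneg (λ i → p (suc i)) q k

⊛-monoˡ : ∀ {f g h} → NonNeg h → f ⊑ g → f ⊛ h ⊑ g ⊛ h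
⊛-monoˡ r p zero = *-mono-by r p 0 0
  where
  *-mono-by : ∀ {f g h} → NonNeg h → f ⊑ g → ∀ i j → f i * h j ≤ g i * h j
  *-mono-by {f} {g} {h} r p i j = subst (λ t → t ≤ g i * h j) (R.*-comm (h j) (f i)) (subst (λ t → h j * f i ≤ t) (R.*-comm (h j) (g i)) (*-monoˡ (r j) (p i)))
⊛-monoˡ {f} {g} {h} r p (suc k) = +-mono (subst (λ t → t ≤ g 0 * h (suc k)) (R.*-comm (h (suc k)) (f 0)) (subst (λ t → h (suc k) * f 0 ≤ t) (R.*-comm (h (suc k)) (g 0)) (*-monoˡ (r (suc k)) (p 0))))
  (⊛-monoˡ r (λ i → p (suc i)) k)

term≤⊛ : ∀ {f g} → NonNeg f → NonNeg g → ∀ i j → f i * g j ≤ (f ⊛ g) (i ℕ.+ j)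
term≤⊛ p q zero zero = ≤-refl
term≤⊛ {f} {g} p q zero (suc j) = a≤a+b (⊛-nonneg (λ i → p (suc i)) q j)
term≤⊛ {f} {g} p q (suc i) j = ≤-trans (term≤⊛ (λ i → p (suc i)) q i j)
  (≤-trans (a≤a+b (p 0 ⊠ q (suc (i ℕ.+ j)))) (≡⇒≤ (R.+-comm _ _)))

≤-cong : ∀ {a b c d : ℤ} → a ≡ c → b ≡ d → a ≤ b → c ≤ d
≤-cong refl refl p = p

shift : ℕ → Series → Series
shift zero f = f
shift (suc a) f = z⊛ (shift a f)

⊛-shift : ∀ f a g → f ⊛ shift a g ≈ shift a (f ⊛ g)
⊛-shift f zero g k = refl
⊛-shift f (suc a) g k = trans (⊛-comm f _ k) (trans (z⊛-⊛ (shift a g) f k) (z⊛-cong (λ k → trans (⊛-comm (shift a g) f k) (⊛-shift f a g k)) k))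
  where
  z⊛-cong : ∀ {f g} → f ≈ g → z⊛ f ≈ z⊛ g
  z⊛-cong p zero = refl
  z⊛-cong p (suc k) = p k

shift-at : ∀ a f → shift a f a ≡ f 0
shift-at zero f = refl
shift-at (suc a) f = shift-at a f

powers : ℤ → Series
powers c zero = + 1
powers c (suc k) = c * powers c k

powers-nonneg : ∀ {c} → + 0 ≤ c → NonNeg (powers c)
powers-nonneg p zero = 0≤+
powers-nonneg p (suc k) = p ⊠ powers-nonneg p k

powers-mono : ∀ {b c} → + 0 ≤ b → b ≤ c → powers b ⊑ powers c
powers-mono p q zero = ≤-refl
powers-mono p q (suc k) = *-mono p (powers-nonneg p k) q (powers-mono p q k)

powers-+ : ∀ c j k → powers c (j ℕ.+ k) ≡ powers c j * powers c k
powers-+ c zero k = sym (R.*-identityˡ _)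
powers-+ c (suc j) k = trans (cong₂ _*_ refl (powers-+ c j k)) (sym (R.*-assoc c _ _))

powers-* : ∀ b c k → powers (b * c) k ≡ powers b k * powers c k
powers-* b c zero = sym (R.*-identityˡ _)
powers-* b c (suc k) = trans (cong₂ _*_ refl (powers-* b c k)) (eq b c (powers b k) (powers c k))
  where
  eq = solve 4 (λ b c x y → b :* c :* (x :* y) := b :* x :* (c :* y)) refl

1≤powers : ∀ {c} → + 1 ≤ c → ∀ k → + 1 ≤ powers c k
1≤powers p zero = ≤-refl
1≤powers {c} p (suc k) = ≤-trans (1≤powers p k) (≤-cong (R.*-identityˡ _) refl (*-mono {+ 1} {c} {powers c k} {powers c k} 0≤+ (1≤⇒0≤ (1≤powers p k)) p ≤-refl))

k<2^k : ∀ k → + k + + 1 ≤ powers (+ 2) k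
k<2^k zero = ≡⇒≤ (R.+-identityˡ _)
k<2^k (suc k) = ≤-trans (≤-by (0≤+ {k}) (trans (cong (λ t → + 2 * (+ k + + 1) - (t + + 1)) (suc≡1+ k)) (eq (+ k)))) (*-monoˡ 0≤+ (k<2^k k))
  where
  eq = solve 1 (λ k → ♯ 2 :* (k :+ ♯ 1) :- (♯ 1 :+ k :+ ♯ 1) := k) refl

-- Applied with `m = d - 1`, `p = d - 2` and `b` vertices outside the clique: `m * Π k` is then the
-- number of first returns of length `k + 2` to a vertex of a clique on `d` vertices.
module Growth (m p b : ℤ) (1≤b : + 1 ≤ b) (2b≤p : + 2 * b ≤ p) (2b≤m : + 2 * b ≤ m) where

  0≤b : + 0 ≤ b
  0≤b = 1≤⇒0≤ 1≤b

  b≤2b : b ≤ + 2 * b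
  b≤2b = ≤-by 0≤b (eq b)
    where
    eq = solve 1 (λ b → ♯ 2 :* b :- b := b) refl

  0≤p : + 0 ≤ p
  0≤p = ≤-trans (≤-trans 0≤b b≤2b) 2b≤p

  0≤m : + 0 ≤ m
  0≤m = ≤-trans (≤-trans 0≤b b≤2b) 2b≤m

  Π : Series
  Π = powers p

  -- Growth at rate at least `p`, in a form stable under sums and under convolution with nonnegative
  -- series. The factor 2 leaves room for `C ⊛ template`, which is at least half of `C`.
  Growing : Series → Set
  Growing x = ∀ k → m * (Π ⊛ x) k ≤ + 2 * x (suc (suc k))

  Growing-cong : ∀ {x y} → x ≈ y → Growing x → Growing y
  Growing-cong e g k = ≤-cong (cong₂ _*_ refl (⊛-cong {f = Π} (λ _ → refl) e k)) (cong₂ _*_ refl (e (suc (suc k)))) (g k)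

  Growing-⊕ : ∀ {x y} → Growing x → Growing y → Growing (x ⊕s y)
  Growing-⊕ {x} {y} g h k = ≤-cong (sym (trans (cong₂ _*_ refl (SeriesSolver.solve 3 (λ p x y → p :⊛ (x :⊕ y) :≈ p :⊛ x :⊕ p :⊛ y) (λ _ → refl) Π x y k)) (R.distribˡ m _ _)))
    (sym (R.distribˡ (+ 2) _ _)) (+-mono (g k) (h k))

  Growing-⊛ : ∀ {s x} → NonNeg s → NonNeg x → Growing x → Growing (s ⊛ x)
  Growing-⊛ {s} {x} ns nx g k = ≤-trans (≤-trans (≡⇒≤ lhs) (⊛-monoˡ ns g k)) (≤-trans (≡⇒≤ (⊛-scaleˡ (+ 2) _ s k)) (*-monoˡ 0≤+ tail-bound))
    where
    lhs : m * (Π ⊛ (s ⊛ x)) k ≡ ((λ k → m * (Π ⊛ x) k) ⊛ s) k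
    lhs = trans (cong₂ _*_ refl (SeriesSolver.solve 3 (λ p s x → p :⊛ (s :⊛ x) :≈ p :⊛ x :⊛ s) (λ _ → refl) Π s x k)) (sym (⊛-scaleˡ m (Π ⊛ x) s k))
    tail-bound : ((λ k → x (suc (suc k))) ⊛ s) k ≤ (s ⊛ x) (suc (suc k))
    tail-bound = ≤-trans (≤-trans (a≤a+b (nx 1 ⊠ ns (suc k))) (≡⇒≤ (R.+-comm _ _))) (≤-trans (a≤a+b (nx 0 ⊠ ns (suc (suc k))))
      (≤-trans (≡⇒≤ (R.+-comm _ _)) (≡⇒≤ (⊛-comm x s (suc (suc k))))))

  zs-nonneg : NonNeg zs
  zs-nonneg zero = ≤-refl
  zs-nonneg (suc zero) = 0≤+
  zs-nonneg (suc (suc k)) = ≤-refl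

  z⊛-nonneg : ∀ {f} → NonNeg f → NonNeg (z⊛ f)
  z⊛-nonneg n zero = ≤-refl
  z⊛-nonneg n (suc k) = n k

  shift-nonneg : ∀ a {f} → NonNeg f → NonNeg (shift a f)
  shift-nonneg zero n = n
  shift-nonneg (suc a) n = z⊛-nonneg (shift-nonneg a n)

  Growing-z⊛ : ∀ {x} → NonNeg x → Growing x → Growing (z⊛ x)
  Growing-z⊛ {x} n g = Growing-cong (zs-⊛ x) (Growing-⊛ zs-nonneg n g)

  Growing-shift : ∀ a {x} → NonNeg x → Growing x → Growing (shift a x)
  Growing-shift zero n g = g
  Growing-shift (suc a) n g = Growing-z⊛ (shift-nonneg a n) (Growing-shift a n g)

  -- Lower bound for the difference of two first-return series with leading coefficient at least 1.
  template : Series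
  template = const (+ 1) ⊕s negs (z⊛ (z⊛ (λ k → b * powers b k)))

  renewal : Series → Series → Set
  renewal C J = C ≈ const (+ 1) ⊕s z⊛ (z⊛ (((λ k → m * Π k) ⊕s J) ⊛ C))

  module _ (C J : Series) (nC : NonNeg C) (nJ : NonNeg J) (renew : renewal C J) where

    C-growth : ∀ k → m * (Π ⊛ C) k ≤ C (suc (suc k))
    C-growth k = ≤-trans (a≤a+b (⊛-nonneg nJ nC k)) (≡⇒≤ (sym (trans (renew (suc (suc k))) (trans (R.+-identityˡ _)
      (trans (⊛-distribʳ C _ J k) (cong₂ _+_ (⊛-scaleˡ m Π C k) refl))))))

    private
      σ θ : Series
      σ = z⊛ (z⊛ (λ k → b * (powers b ⊛ C) k))
      θ = C ⊕s negs σ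

      σ-nonneg : NonNeg σ
      σ-nonneg = z⊛-nonneg (z⊛-nonneg (λ k → 0≤b ⊠ ⊛-nonneg (powers-nonneg 0≤b) nC k))

      -- The walks inside the clique already suffice: `2 b ≤ m` and `b ≤ p` place `2 σ` below the
      -- clique part of the renewal equation.
      2σ≤C : ∀ k → + 2 * σ k ≤ C k
      2σ≤C zero = ≤-trans (≡⇒≤ (R.zeroʳ (+ 2))) (nC 0)
      2σ≤C (suc zero) = ≤-trans (≡⇒≤ (R.zeroʳ (+ 2))) (nC 1)
      2σ≤C (suc (suc k)) = ≤-trans (≡⇒≤ (sym (R.*-assoc (+ 2) b _))) (≤-trans (*-mono (0≤+ ⊠ 0≤b) (⊛-nonneg (powers-nonneg 0≤b) nC k) 2b≤m
        (⊛-monoˡ nC (powers-mono 0≤b (≤-trans b≤2b 2b≤p)) k)) (C-growth k))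

      C≤2θ : ∀ k → C k ≤ + 2 * θ k
      C≤2θ k = ≤-by (≤-diff (2σ≤C k)) (eq (C k) (σ k))
        where
        eq = solve 2 (λ c s → ♯ 2 :* (c :+ :- s) :- c := c :- ♯ 2 :* s) refl

      θ≤C : ∀ k → θ k ≤ C k
      θ≤C k = ≤-by (σ-nonneg k) (eq (C k) (σ k))
        where
        eq = solve 2 (λ c s → c :- (c :+ :- s) := s) refl

      θ-nonneg : NonNeg θ
      θ-nonneg k = *-cancel-≤ {+ 2} (+≤+ (s≤s z≤n)) (≤-trans (≡⇒≤ (R.zeroʳ (+ 2))) (≤-trans (nC k) (C≤2θ k)))

      θ-growing : Growing θ
      θ-growing k = ≤-trans (*-monoˡ 0≤m (≤-cong (⊛-comm θ Π k) (⊛-comm C Π k) (⊛-monoˡ (powers-nonneg 0≤p) θ≤C k))) (≤-trans (C-growth k) (C≤2θ (suc (suc k))))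

      C-growing : Growing C
      C-growing k = ≤-trans (C-growth k) (≤-by (nC (suc (suc k))) (eq (C (suc (suc k)))))
        where
        eq = solve 1 (λ c → ♯ 2 :* c :- c := c) refl

      C⊛template : C ⊛ template ≈ θ
      C⊛template k = trans (SeriesSolver.solve 2 (λ c s → c :⊛ (:const (+ 1) :⊕ (:⊖ s)) :≈ c :⊕ (:⊖ (s :⊛ c))) (λ _ → refl) C (z⊛ (z⊛ (λ k → b * powers b k))) k)
        (cong (λ t → C k - t) (trans (z⊛-⊛ (z⊛ (λ k → b * powers b k)) C k) (z-eq k)))
        where
        z-eq : z⊛ ((z⊛ (λ k → b * powers b k)) ⊛ C) ≈ σ
        z-eq zero = refl
        z-eq (suc zero) = z⊛-⊛ (λ k → b * powers b k) C 0
        z-eq (suc (suc k)) = trans (z⊛-⊛ (λ k → b * powers b k) C (suc k)) (⊛-scaleˡ b (powers b) C k)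

    module _ (a : ℕ) (Y : Series) (Y-bound : shift a template ⊑ Y) where
      private
        Y⁺ : Series
        Y⁺ = Y ⊕s negs (shift a template)

        nY⁺ : NonNeg Y⁺
        nY⁺ k = ≤-diff (Y-bound k)

        decompose : shift a θ ⊕s C ⊛ Y⁺ ≈ C ⊛ Y
        decompose k = trans (cong₂ _+_ (sym (trans (⊛-shift C a template k) (shift-cong a C⊛template k))) refl)
          (SeriesSolver.solve 3 (λ c y s → c :⊛ s :⊕ c :⊛ (y :⊕ (:⊖ s)) :≈ c :⊛ y) (λ _ → refl) C Y (shift a template) k)
          where
          shift-cong : ∀ a {f g} → f ≈ g → shift a f ≈ shift a g
          shift-cong zero e k = e k
          shift-cong (suc a) e zero = refl
          shift-cong (suc a) e (suc k) = shift-cong a e k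

      -- `Y` may have negative coefficients. It is a shifted `template` plus a nonnegative series,
      -- and `C ⊛ template` is the nonnegative series `θ`.
      ⊛-Y-nonneg : NonNeg (C ⊛ Y)
      ⊛-Y-nonneg k = subst (+ 0 ≤_) (decompose k) (shift-nonneg a θ-nonneg k ⊞ ⊛-nonneg nC nY⁺ k)

      ⊛-Y-growing : Growing (C ⊛ Y)
      ⊛-Y-growing = Growing-cong decompose (Growing-⊕ (Growing-shift a θ-nonneg θ-growing)
        (Growing-cong (⊛-comm Y⁺ C) (Growing-⊛ nY⁺ nC C-growing)))

      ⊛-Y-leading : + 1 ≤ (C ⊛ Y) a
      ⊛-Y-leading = ≤-cong refl (decompose a) (≤-trans (≡⇒≤ (sym (trans (shift-at a θ) θ0))) (a≤a+b (⊛-nonneg nC nY⁺ a)))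
        where
        opaque
          unfolding _+_ -_
          θ0 : θ 0 ≡ + 1
          θ0 = trans (cong₂ _+_ (renew 0) refl) refl

  -- If the closed-walk series of two graphs satisfy these relations and J₁ exceeds J₂, then the
  -- logarithmic derivative of C₁/C₂ = 1 + X grows faster than the walk counts of bounded parts allow.
  growth-contradiction : ∀ C₁ C₂ J₁ J₂ t₁ t₂ S a Y k₀ →
    NonNeg C₁ → NonNeg J₁ → renewal C₁ J₁ → renewal C₂ J₂ →
    D C₁ ≈ t₁ ⊛ C₁ → D C₂ ≈ t₂ ⊛ C₂ →
    t₁ 0 ≡ t₂ 0 → t₁ 1 ≡ t₂ 1 → (∀ k → t₁ (suc (suc k)) - t₂ (suc (suc k)) ≤ powers b (suc (suc k))) →
    NonNeg S → + 1 ≤ S k₀ → shift a template ⊑ Y → J₁ ⊕s negs J₂ ≈ S ⊛ Y → ⊥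
  growth-contradiction C₁ C₂ J₁ J₂ t₁ t₂ S a Y k₀ nC₁ nJ₁ renew₁ renew₂ log₁ log₂ u0 u1 u-bound nS S₀ Y-bound JY = contradiction
    where
    u X : Series
    u = t₁ ⊕s negs t₂
    X = z⊛ (z⊛ (S ⊛ (C₁ ⊛ Y)))

    nX : NonNeg X
    nX = z⊛-nonneg (z⊛-nonneg (⊛-nonneg nS (⊛-Y-nonneg C₁ J₁ nC₁ nJ₁ renew₁ a Y Y-bound)))

    X-growing : Growing X
    X-growing = Growing-z⊛ (z⊛-nonneg n) (Growing-z⊛ n (Growing-⊛ nS (⊛-Y-nonneg C₁ J₁ nC₁ nJ₁ renew₁ a Y Y-bound) (⊛-Y-growing C₁ J₁ nC₁ nJ₁ renew₁ a Y Y-bound)))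
      where
      n : NonNeg (S ⊛ (C₁ ⊛ Y))
      n = ⊛-nonneg nS (⊛-Y-nonneg C₁ J₁ nC₁ nJ₁ renew₁ a Y Y-bound)

    K : ℕ
    K = suc (suc (k₀ ℕ.+ a))

    1≤XK : + 1 ≤ X K
    1≤XK = ≤-trans (≤-cong (R.*-identityˡ _) refl (*-mono {+ 1} {S k₀} {+ 1} 0≤+ 0≤+ S₀ (⊛-Y-leading C₁ J₁ nC₁ nJ₁ renew₁ a Y Y-bound)))
      (term≤⊛ nS (⊛-Y-nonneg C₁ J₁ nC₁ nJ₁ renew₁ a Y Y-bound) k₀ a)

    zz : Series → Series
    zz f = zs ⊛ (zs ⊛ f)

    zz-eq : ∀ f → z⊛ (z⊛ f) ≈ zz f
    zz-eq f zero = sym (zs-⊛ (zs ⊛ f) 0)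
    zz-eq f (suc k) = sym (trans (zs-⊛ (zs ⊛ f) (suc k)) (zs-⊛ f k))

    renewal′ : ∀ C J → renewal C J → C ≈ const (+ 1) ⊕s zz (((λ k → m * Π k) ⊕s J) ⊛ C)
    renewal′ C J r k = trans (r k) (cong₂ _+_ refl (zz-eq _ k))

    zero-from : ∀ {f g : Series} → f ≈ g → f ⊕s negs g ≈ (λ _ → + 0)
    zero-from e k = trans (cong₂ _-_ (e k) refl) (R.-‿inverseʳ _)

    combine₃ : ∀ {p q r : Series} → p ≈ (λ _ → + 0) → q ≈ (λ _ → + 0) → r ≈ (λ _ → + 0) → ∀ f g h → f ⊛ p ⊕s g ⊛ q ⊕s h ⊛ r ≈ (λ _ → + 0)
    combine₃ e₁ e₂ e₃ f g h k = trans (cong₂ _+_ (cong₂ _+_ (one e₁ f k) (one e₂ g k)) (one e₃ h k)) (trans (cong₂ _+_ (R.+-identityˡ _) refl) (R.+-identityˡ _))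
      where
      one : ∀ {p : Series} → p ≈ (λ _ → + 0) → ∀ f → f ⊛ p ≈ (λ _ → + 0)
      one e f k = trans (⊛-cong {f = f} (λ _ → refl) e k) (trans (⊛-comm f _ k) (⊛-zeroˡ f k))

    -- The renewal equations say 1/C = 1 - z² (W + J) with a common W. Hence 1/C₂ - 1/C₁ = z² (J₁ -
    -- J₂), and C₁/C₂ - 1 = z² S C₁ Y.
    ratio : C₁ ≈ C₂ ⊕s C₂ ⊛ X
    ratio k = minus-zero (trans
      (trans (cong (λ t → C₁ k - (C₂ k + t)) (⊛-cong {f = C₂} (λ _ → refl) (zz-eq (S ⊛ (C₁ ⊛ Y))) k))
        (SeriesSolver.solve 8 (λ c₁ c₂ w j₁ j₂ s y z →
          c₁ :⊕ (:⊖ (c₂ :⊕ c₂ :⊛ (z :⊛ (z :⊛ (s :⊛ (c₁ :⊛ y)))))) :≈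
          (:⊖ c₁) :⊛ (c₂ :⊕ (:⊖ (:const (+ 1) :⊕ z :⊛ (z :⊛ ((w :⊕ j₂) :⊛ c₂)))))
          :⊕ c₂ :⊛ (c₁ :⊕ (:⊖ (:const (+ 1) :⊕ z :⊛ (z :⊛ ((w :⊕ j₁) :⊛ c₁)))))
          :⊕ (z :⊛ z :⊛ c₁ :⊛ c₂) :⊛ (j₁ :⊕ (:⊖ j₂) :⊕ (:⊖ (s :⊛ y)))) (λ _ → refl) C₁ C₂ (λ k → m * Π k) J₁ J₂ S Y zs k))
      (combine₃ (zero-from (renewal′ C₂ J₂ renew₂)) (zero-from (renewal′ C₁ J₁ renew₁)) (zero-from JY) (negs C₁) C₂ (zs ⊛ zs ⊛ C₁ ⊛ C₂) k))

    C₂0 : C₂ 0 ≡ + 1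
    C₂0 = trans (renew₂ 0) (R.+-identityʳ _)

    -- The logarithmic derivative of C₁/C₂ = 1 + X is `t₁ - t₂`.
    log-derivative : D X ≈ u ⊕s u ⊛ X
    log-derivative k = minus-zero (⊛-cancel (D X ⊕s negs (u ⊕s u ⊛ X)) C₂ C₂0 (λ k → trans
      (SeriesSolver.solve 8 (λ c₁ c₂ x dc₁ dc₂ dx t₁ t₂ →
        (dx :⊕ (:⊖ ((t₁ :⊕ (:⊖ t₂)) :⊕ (t₁ :⊕ (:⊖ t₂)) :⊛ x))) :⊛ c₂ :≈
        (:const (+ 1) :⊛ (dc₁ :⊕ (:⊖ (t₁ :⊛ c₁))) :⊕ (:⊖ (:const (+ 1) :⊕ x)) :⊛ (dc₂ :⊕ (:⊖ (t₂ :⊛ c₂))) :⊕ t₁ :⊛ (c₁ :⊕ (:⊖ (c₂ :⊕ c₂ :⊛ x))))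
        :⊕ (:⊖ (dc₁ :⊕ (:⊖ (dc₂ :⊕ (dc₂ :⊛ x :⊕ c₂ :⊛ dx)))))) (λ _ → refl) C₁ C₂ X (D C₁) (D C₂) (D X) t₁ t₂ k)
      (trans (cong₂ _+_ (combine₃ (zero-from log₁) (zero-from log₂) (zero-from ratio) (const (+ 1)) (negs (const (+ 1) ⊕s X)) t₁ k)
        (cong -_ (zero-from D-ratio k))) (R.-‿inverseʳ (+ 0)))) k)
      where
      D-ratio : D C₁ ≈ D C₂ ⊕s (D C₂ ⊛ X ⊕s C₂ ⊛ D X)
      D-ratio k = trans (cong₂ _*_ refl (ratio k)) (trans (R.distribˡ (+ k) _ _) (cong₂ _+_ refl (D-⊛ C₂ X k)))

    -- Since `u` is at most `powers b` while `X` grows at rate `p`, the convolution `u ⊛ X` costs no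
    -- more than `b * X`. The factor `k + 2` from the derivative eventually exceeds `b`.
    upper : ∀ k → + suc (suc k) * X (suc (suc k)) ≤ powers b (suc (suc k)) + b * X (suc (suc k))
    upper k = ≤-trans (≡⇒≤ (trans (log-derivative (suc (suc k))) (cong₂ _+_ refl drop)))
      (+-mono (u-bound k) (≤-trans (⊛-monoˡ nX u-bound k) (≤-trans (≡⇒≤ (trans (⊛-cong {g = X} (λ i → sym (R.*-assoc b b _)) (λ _ → refl) k) (⊛-scaleˡ (b * b) (powers b) X k)))
        (≤-trans (*-monoˡ (0≤b ⊠ 0≤b) (⊛-monoˡ nX (powers-mono 0≤b (≤-trans b≤2b 2b≤p)) k))
          (≤-trans (≡⇒≤ (R.*-assoc b b _)) (*-monoˡ 0≤b half))))))
      where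
      u0′ : u 0 ≡ + 0
      u0′ = trans (cong₂ _-_ u0 refl) (R.-‿inverseʳ _)
      u1′ : u 1 ≡ + 0
      u1′ = trans (cong₂ _-_ u1 refl) (R.-‿inverseʳ _)
      drop : (u ⊛ X) (suc (suc k)) ≡ (tl (tl u) ⊛ X) k
      drop = trans (cong₂ _+_ (trans (cong₂ _*_ u0′ refl) (R.zeroˡ _)) (trans (cong₂ _+_ (trans (cong₂ _*_ u1′ refl) (R.zeroˡ _)) refl) (R.+-identityˡ _))) (R.+-identityˡ _)
      half : b * (Π ⊛ X) k ≤ X (suc (suc k))
      half = *-cancel-≤ {+ 2} (+≤+ (s≤s z≤n)) (≤-trans (≡⇒≤ (sym (R.*-assoc (+ 2) b _)))
        (≤-trans (*-mono (0≤+ ⊠ 0≤b) (⊛-nonneg (powers-nonneg 0≤p) nX k) 2b≤m ≤-refl) (X-growing k)))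

    lower : ∀ j → powers (+ 2) j * powers b j ≤ X (suc (suc (j ℕ.+ K)))
    lower j = ≤-trans (≡⇒≤ (sym (powers-* (+ 2) b j))) (≤-trans (powers-mono (0≤+ ⊠ 0≤b) 2b≤p j)
      (*-cancel-≤ {+ 2} (+≤+ (s≤s z≤n)) (≤-trans (*-mono 0≤+ (powers-nonneg 0≤p j) (≤-trans (≤-cong (R.*-identityʳ (+ 2)) refl (*-monoˡ {+ 2} 0≤+ 1≤b)) 2b≤m) ≤-refl)
        (≤-trans (*-monoˡ 0≤m (≤-trans (≤-cong (R.*-identityʳ _) refl (*-monoˡ (powers-nonneg 0≤p j) 1≤XK)) (term≤⊛ (powers-nonneg 0≤p) nX j K))) (X-growing (j ℕ.+ K))))))

    nat : ∀ {c} → + 1 ≤ c → Σ ℕ λ j → c ≡ + j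
    nat {+ j} _ = j , refl
    nat { -[1+ _ ]} ()

    -- With B = b^(K + 2) and j = b + B, the index L = j + K + 2 exceeds b. Then `upper` gives X L ≤
    -- b^L = B b^j, whereas `lower` gives X L ≥ 2^j b^j, and 2^j > j ≥ B.
    j : ℕ
    j = proj₁ (nat 1≤b) ℕ.+ proj₁ (nat (1≤powers 1≤b (suc (suc K))))

    contradiction : ⊥
    contradiction = 1≰0 (≤-trans (≤-diff-1 _ _ big) (≡⇒≤ (R.-‿inverseʳ _)))
      where
      L : ℕ
      L = suc (suc (j ℕ.+ K))
      B 2j bj : ℤ
      B = powers b (suc (suc K))
      2j = powers (+ 2) j
      bj = powers b j
      j-eq : + j ≡ b + B
      j-eq = trans (pos-+ (proj₁ (nat 1≤b)) _) (cong₂ _+_ (sym (proj₂ (nat 1≤b))) (sym (proj₂ (nat (1≤powers 1≤b (suc (suc K)))))))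
      XL≤ : X L ≤ powers b L
      XL≤ = ≤-by (≤-diff (upper (j ℕ.+ K)) ⊞ ((≤-diff (≤-refl {+ L}) ⊞ (≤-diff b+1≤L)) ⊠ nX L)) (eq (+ L) b (X L) (powers b L))
        where
        b+1≤L : b + + 1 ≤ + L
        b+1≤L = ≤-trans (≤-by (1≤⇒0≤ (1≤powers 1≤b (suc (suc K))) ⊞ (0≤+ {suc K})) (trans (cong (λ t → t - (b + + 1)) (trans (cong (λ n → + n) (eqℕ j K)) (trans (pos-+ j (suc (suc K))) (cong₂ _+_ j-eq (suc≡1+ (suc K)))))) (eq b B (+ suc K)))) ≤-refl
          where
          eqℕ : ∀ j K → suc (suc (j ℕ.+ K)) ≡ j ℕ.+ suc (suc K)
          eqℕ j K = sym (trans (ℕₚ.+-suc j (suc K)) (cong suc (ℕₚ.+-suc j K)))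
          eq = solve 3 (λ b B K → (b :+ B :+ (♯ 1 :+ K)) :- (b :+ ♯ 1) := B :+ K) refl
        eq = solve 4 (λ L b x B → B :- x := (B :+ b :* x :- L :* x) :+ ((L :- L) :+ (L :- (b :+ ♯ 1))) :* x) refl
      split : powers b L ≡ B * bj
      split = trans (cong (powers b) (eqℕ j K)) (powers-+ b (suc (suc K)) j)
        where
        eqℕ : ∀ j K → suc (suc (j ℕ.+ K)) ≡ suc (suc K) ℕ.+ j
        eqℕ j K = cong (λ t → suc (suc t)) (ℕₚ.+-comm j K)
      big : B * bj + + 1 ≤ B * bj
      big = ≤-trans (≤-by ((≤-diff (k<2^k j) ⊞ 0≤b) ⊠ 1≤⇒0≤ (1≤powers 1≤b j) ⊞ ≤-diff (1≤powers 1≤b j)) (trans (cong (λ t → 2j * bj - (B * bj + t)) refl) (trans (eq 2j bj B (+ j) b j-eq) refl)))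
        (≤-trans (lower j) (≤-trans XL≤ (≡⇒≤ split)))
        where
        lem = solve 4 (λ t x B b → t :* x :- (B :* x :+ ♯ 1) := (t :- (b :+ B :+ ♯ 1) :+ b) :* x :+ (x :- ♯ 1)) refl
        opaque
          unfolding _+_ _*_ -_
          eq : ∀ t x B j b → j ≡ b + B → t * x - (B * x + + 1) ≡ (t - (j + + 1) + b) * x + (x - + 1)
          eq t x B _ b refl = lem t x B b
      ≤-diff-1 : ∀ a b → a + + 1 ≤ b → + 1 ≤ b - a
      ≤-diff-1 a b p = ≤-by (≤-diff p) (eq a b)
        where
        eq = solve 2 (λ a b → b :- a :- ♯ 1 := b :- (a :+ ♯ 1)) refl

-- Double sums, the entrywise inner product and spectral moments

sum₂ : ∀ {m n} → (Fin m → Fin n → ℤ) → ℤ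
sum₂ f = sum (λ i → sum (λ j → f i j))

sum₂-cong : ∀ {m n} {f g : Fin m → Fin n → ℤ} → (∀ i j → f i j ≡ g i j) → sum₂ f ≡ sum₂ g
sum₂-cong p = sum-cong (λ i → sum-cong (p i))

sum₂-+ : ∀ {m n} (f g : Fin m → Fin n → ℤ) → sum₂ (λ i j → f i j + g i j) ≡ sum₂ f + sum₂ g
sum₂-+ f g = trans (sum-cong (λ i → sum-+ (f i) (g i))) (sum-+ _ _)

sum₂-*ˡ : ∀ {m n} c (f : Fin m → Fin n → ℤ) → sum₂ (λ i j → c * f i j) ≡ c * sum₂ f
sum₂-*ˡ c f = trans (sum-cong (λ i → sum-*ˡ c (f i))) (sum-*ˡ c _)

sum₂-mono : ∀ {m n} {f g : Fin m → Fin n → ℤ} → (∀ i j → f i j ≤ g i j) → sum₂ f ≤ sum₂ g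
sum₂-mono p = sum-mono (λ i → sum-mono (p i))

sum₂-≥0 : ∀ {m n} {f : Fin m → Fin n → ℤ} → (∀ i j → + 0 ≤ f i j) → + 0 ≤ sum₂ f
sum₂-≥0 p = sum-≥0 (λ i → sum-≥0 (p i))

sum₂-product : ∀ {m n} (f : Fin m → ℤ) (g : Fin n → ℤ) → sum₂ (λ i j → f i * g j) ≡ sum f * sum g
sum₂-product f g = trans (sum-cong (λ i → sum-*ˡ (f i) g)) (sum-*ʳ (sum g) f)

sum₂-form : ∀ {m n} (f : Fin m → ℤ) (q : Fin m → Fin n → ℤ) (g : Fin n → ℤ) → sum₂ (λ i j → f i * (q i j * g j)) ≡ sum (λ i → f i * sum (λ j → q i j * g j))
sum₂-form f q g = sum-cong (λ i → sum-*ˡ (f i) _)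

⟨_,_⟩ : ∀ {n} → Matrix n → Matrix n → ℤ
⟨ a , b ⟩ = sum₂ (λ i j → a i j * b i j)

infixl 7 _·_
_·_ : ∀ {n} → Matrix n → Matrix n → Matrix n
(a · b) i j = sum (λ k → a i k * b k j)

⟨⟩-cong : ∀ {n} {a b c d : Matrix n} → (∀ i j → a i j ≡ c i j) → (∀ i j → b i j ≡ d i j) → ⟨ a , b ⟩ ≡ ⟨ c , d ⟩
⟨⟩-cong p q = sum₂-cong (λ i j → cong₂ _*_ (p i j) (q i j))

norm-diff : ∀ {n} d (a b : Matrix n) → ⟨ (λ i j → a i j - d * b i j) , (λ i j → a i j - d * b i j) ⟩ ≡ ⟨ a , a ⟩ + (- (+ 2 * d) * ⟨ a , b ⟩ + d * d * ⟨ b , b ⟩)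
norm-diff d a b = trans (sum₂-cong (λ i j → eq d (a i j) (b i j))) (trans (sum₂-+ _ _) (cong₂ _+_ refl
  (trans (sum₂-+ _ _) (cong₂ _+_ (sum₂-*ˡ _ _) (sum₂-*ˡ _ _)))))
  where
  eq = solve 3 (λ d a b → (a :- d :* b) :* (a :- d :* b) := a :* a :+ (:- (♯ 2 :* d) :* (a :* b) :+ d :* d :* (b :* b))) refl

-- With loops added, a clique with indicator `l` becomes the rank-one block l lᵀ, whose powers are
-- multiples of itself.
loops : ∀ {n} → Matrix n → Matrix n
loops a i j = a i j + δ i j

pow-one : ∀ {n} (a : Matrix n) i j → pow a 1 i j ≡ a i j
pow-one a i j = sum-δʳ j (a i)

pow-two : ∀ {n} (a : Matrix n) i j → pow a 2 i j ≡ (a · a) i j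
pow-two a i j = sum-cong (λ k → cong₂ _*_ refl (pow-one a k j))

pow-three : ∀ {n} (a : Matrix n) i j → pow a 3 i j ≡ (a · (a · a)) i j
pow-three a i j = sum-cong (λ k → cong₂ _*_ refl (pow-two a k j))

inner-pow : ∀ {n} (a : Matrix n) → Symmetric a → ∀ p q → ⟨ pow a p , pow a q ⟩ ≡ trace (pow a (p ℕ.+ q))
inner-pow a s p q = sum-cong (λ i → trans (sum-cong (λ j → cong₂ _*_ refl (pow-sym a s q i j))) (pow-add a p q i i))

module _ {n} (a b : Matrix n) (tr : ∀ k → trace (pow a k) ≡ trace (pow b k)) where

  private
    mixed : Matrix n → ℕ → ℕ → ℤ
    mixed a j k = trace (pow a j · pow (loops a) k)

    mixed-zero : ∀ a j → mixed a j 0 ≡ trace (pow a j)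
    mixed-zero a j = sum-cong (λ i → sum-δʳ i (pow a j i))

    mixed-suc : ∀ a j k → mixed a j (suc k) ≡ mixed a (suc j) k + mixed a j k
    mixed-suc a j k = trans (sum-cong (λ i → begin
      sum (λ l → pow a j i l * sum (λ m → (a l m + δ l m) * pow (loops a) k m i))
        ≡⟨ sum-cong (λ l → trans (cong₂ _*_ refl (trans (sum-cong (λ m → R.distribʳ _ (a l m) (δ l m))) (trans (sum-+ _ _) (cong₂ _+_ refl (sum-δˡ l (λ m → pow (loops a) k m i)))))) (R.distribˡ (pow a j i l) _ _)) ⟩
      sum (λ l → pow a j i l * sum (λ m → a l m * pow (loops a) k m i) + pow a j i l * pow (loops a) k l i)
        ≡⟨ sum-+ _ _ ⟩
      sum (λ l → pow a j i l * sum (λ m → a l m * pow (loops a) k m i)) + (pow a j · pow (loops a) k) i i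
        ≡⟨ cong₂ _+_ (trans (sum-cong (λ l → trans (sym (sum-*ˡ (pow a j i l) _)) (sum-cong (λ m → sym (R.*-assoc _ _ _))))) (trans (sum-comm _)
             (sum-cong (λ m → trans (sum-*ʳ (pow (loops a) k m i) _) (cong₂ _*_ (sym (pow-sucʳ a j i m)) refl))))) refl ⟩
      (pow a (suc j) · pow (loops a) k) i i + (pow a j · pow (loops a) k) i i ∎)) (sum-+ _ _)
      where open ≡-Reasoning

    mixed-eq : ∀ k j → mixed a j k ≡ mixed b j k
    mixed-eq zero j = trans (mixed-zero a j) (trans (tr j) (sym (mixed-zero b j)))
    mixed-eq (suc k) j = trans (mixed-suc a j k) (trans (cong₂ _+_ (mixed-eq k (suc j)) (mixed-eq k j)) (sym (mixed-suc b j k)))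

  -- The mixed traces of a^j (a + 1)^k satisfy a recursion of Pascal type, so induction on `k`
  -- replaces the binomial theorem.
  loops-trace : ∀ k → trace (pow (loops a) k) ≡ trace (pow (loops b) k)
  loops-trace k = trans (sum-cong (λ i → sym (sum-δˡ i (λ l → pow (loops a) k l i)))) (trans (mixed-eq k 0) (sum-cong (λ i → sum-δˡ i (λ l → pow (loops b) k l i))))

-- For the closed adjacency matrix M of a graph that is close to a clique on d vertices, the matrix
-- defect M d = M² - d M is small.
defect : ∀ {n} → ℤ → Matrix n → Matrix n
defect d M i j = (M · M) i j - d * M i j

module Invariants {n} (M M′ : Matrix n) (sM : Symmetric M) (sM′ : Symmetric M′) (tr : ∀ k → trace (pow M k) ≡ trace (pow M′ k)) where

  private
    inner : ∀ p q → ⟨ pow M p , pow M q ⟩ ≡ ⟨ pow M′ p , pow M′ q ⟩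
    inner p q = trans (inner-pow M sM p q) (trans (tr (p ℕ.+ q)) (sym (inner-pow M′ sM′ p q)))

  ⟨1,1⟩ : ⟨ M , M ⟩ ≡ ⟨ M′ , M′ ⟩
  ⟨1,1⟩ = trans (sym (⟨⟩-cong (pow-one M) (pow-one M))) (trans (inner 1 1) (⟨⟩-cong (pow-one M′) (pow-one M′)))

  ⟨2,1⟩ : ⟨ M · M , M ⟩ ≡ ⟨ M′ · M′ , M′ ⟩
  ⟨2,1⟩ = trans (sym (⟨⟩-cong (pow-two M) (pow-one M))) (trans (inner 2 1) (⟨⟩-cong (pow-two M′) (pow-one M′)))

  ⟨2,2⟩ : ⟨ M · M , M · M ⟩ ≡ ⟨ M′ · M′ , M′ · M′ ⟩
  ⟨2,2⟩ = trans (sym (⟨⟩-cong (pow-two M) (pow-two M))) (trans (inner 2 2) (⟨⟩-cong (pow-two M′) (pow-two M′)))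

  ⟨3,2⟩ : ⟨ M · (M · M) , M · M ⟩ ≡ ⟨ M′ · (M′ · M′) , M′ · M′ ⟩
  ⟨3,2⟩ = trans (sym (⟨⟩-cong (pow-three M) (pow-two M))) (trans (inner 3 2) (⟨⟩-cong (pow-three M′) (pow-two M′)))

  ⟨3,3⟩ : ⟨ M · (M · M) , M · (M · M) ⟩ ≡ ⟨ M′ · (M′ · M′) , M′ · (M′ · M′) ⟩
  ⟨3,3⟩ = trans (sym (⟨⟩-cong (pow-three M) (pow-three M))) (trans (inner 3 3) (⟨⟩-cong (pow-three M′) (pow-three M′)))

  -- Expanded, the squared norms here and in `defect₂-norm` are combinations of traces of powers, up
  -- to the fourth and the sixth respectively, hence spectral invariants.
  defect-norm : ∀ d → ⟨ defect d M , defect d M ⟩ ≡ ⟨ defect d M′ , defect d M′ ⟩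
  defect-norm d = trans (norm-diff d (M · M) M) (trans (cong₂ _+_ ⟨2,2⟩ (cong₂ _+_ (cong₂ _*_ refl ⟨2,1⟩) (cong₂ _*_ refl ⟨1,1⟩))) (sym (norm-diff d (M′ · M′) M′)))

  defect₂-norm : ∀ d → ⟨ M · defect d M , M · defect d M ⟩ ≡ ⟨ M′ · defect d M′ , M′ · defect d M′ ⟩
  defect₂-norm d = trans (⟨⟩-cong (expand M) (expand M)) (trans (norm-diff d (M · (M · M)) (M · M))
      (trans (cong₂ _+_ ⟨3,3⟩ (cong₂ _+_ (cong₂ _*_ refl ⟨3,2⟩) (cong₂ _*_ refl ⟨2,2⟩)))
        (sym (trans (⟨⟩-cong (expand M′) (expand M′)) (norm-diff d (M′ · (M′ · M′)) (M′ · M′))))))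
    where
    expand : ∀ (M : Matrix n) i j → (M · defect d M) i j ≡ (M · (M · M)) i j - d * (M · M) i j
    expand M i j = trans (sum-cong (λ k → eq (M i k) ((M · M) k j) d (M k j))) (trans (sum-+ _ _) (cong₂ _+_ refl (trans (sum-neg _) (cong -_ (sum-*ˡ d _)))))
      where
      eq = solve 4 (λ a b d c → a :* (b :- d :* c) := a :* b :+ :- (d :* (a :* c))) refl

-- Moments of a matrix with a clique block

module Block {n} (M : Matrix n) (sM : Symmetric M) (l : Fin n → ℤ) (l-idem : ∀ i → l i * l i ≡ l i) (d : ℤ) (l-sum : sum l ≡ d)
  (full : ∀ i j → l i * (l j * M i j) ≡ l i * l j) where

  -- What remains after subtracting l lᵀ. It vanishes on the clique block, so `out`, which counts
  -- the edges from a vertex into the clique, is orthogonal to `l`; this kills most cross terms in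
  -- the moments.
  rest : Matrix n
  rest i j = M i j - l i * l j

  out : Fin n → ℤ
  out i = sum (λ j → rest i j * l j)

  rest-sym : Symmetric rest
  rest-sym i j = cong₂ _-_ (sM i j) (R.*-comm (l i) (l j))

  l-rest-l : ∀ i j → l i * (rest i j * l j) ≡ + 0
  l-rest-l i j = trans (eq (l i) (l j) (M i j)) (trans (cong₂ _-_ (full i j) (cong₂ _*_ (l-idem i) (l-idem j))) (R.-‿inverseʳ _))
    where
    eq = solve 3 (λ x y m → x :* ((m :- x :* y) :* y) := x :* (y :* m) :- x :* x :* (y :* y)) refl

  l·out : sum (λ i → l i * out i) ≡ + 0
  l·out = sum-0 (λ i → trans (sym (sum-*ˡ (l i) _)) (sum-0 (l-rest-l i)))

  out′ : ∀ j → sum (λ k → l k * rest k j) ≡ out j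
  out′ j = sum-cong (λ k → trans (R.*-comm _ _) (cong₂ _*_ (rest-sym k j) refl))

  l·l : sum (λ i → l i * l i) ≡ d
  l·l = trans (sum-cong l-idem) l-sum

  private
    M-split : ∀ i j → M i j ≡ l i * l j + rest i j
    M-split i j = eq (M i j) (l i * l j)
      where
      eq = solve 2 (λ m x → m := x :+ (m :- x)) refl

  square : ∀ i j → (M · M) i j ≡ d * (l i * l j) + (out i * l j + (l i * out j + (rest · rest) i j))
  square i j = begin
    sum (λ k → M i k * M k j)
      ≡⟨ sum-cong (λ k → trans (cong₂ _*_ (M-split i k) (M-split k j)) (eq (l i) (l k) (l j) (rest i k) (rest k j))) ⟩
    sum (λ k → (l i * l j) * (l k * l k) + ((rest i k * l k) * l j + (l i * (l k * rest k j) + rest i k * rest k j)))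
      ≡⟨ trans (sum-+ _ _) (cong₂ _+_ (trans (sum-*ˡ (l i * l j) _) (trans (cong₂ _*_ refl l·l) (R.*-comm _ d)))
           (trans (sum-+ _ _) (cong₂ _+_ (sum-*ʳ (l j) _) (trans (sum-+ _ _) (cong₂ _+_ (trans (sum-*ˡ (l i) _) (cong₂ _*_ refl (out′ j))) refl))))) ⟩
    d * (l i * l j) + (out i * l j + (l i * out j + (rest · rest) i j)) ∎
    where
    open ≡-Reasoning
    eq = solve 5 (λ x k y a b → (x :* k :+ a) :* (k :* y :+ b) := (x :* y) :* (k :* k) :+ ((a :* k) :* y :+ (x :* (k :* b) :+ a :* b))) refl

  rest²-l : ∀ i → sum (λ j → (rest · rest) i j * l j) ≡ sum (λ k → rest i k * out k)
  rest²-l i = trans (sum-cong (λ j → trans (sym (sum-*ʳ (l j) _)) (sum-cong (λ k → R.*-assoc _ _ _))))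
    (trans (sum-comm _) (sum-cong (λ k → sum-*ˡ (rest i k) _)))

  P : ℤ
  P = sum (λ i → out i * out i)

  l-rest²-l : sum₂ (λ i j → l i * ((rest · rest) i j * l j)) ≡ P
  l-rest²-l = trans (sum₂-form l (rest · rest) l) (trans (sum-cong (λ i → cong₂ _*_ refl (rest²-l i)))
    (trans (sum-cong (λ i → trans (sym (sum-*ˡ (l i) _)) (sum-cong (λ k → sym (R.*-assoc (l i) (rest i k) (out k))))))
      (trans (sum-comm _) (sum-cong (λ k → trans (sum-*ʳ (out k) _) (cong₂ _*_ (out′ k) refl))))))

  out-rest-out : ℤ
  out-rest-out = sum₂ (λ i k → out i * (rest i k * out k))

  out-rest²-l : sum₂ (λ i j → out i * ((rest · rest) i j * l j)) ≡ out-rest-out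
  out-rest²-l = trans (sum₂-form out (rest · rest) l) (trans (sum-cong (λ i → cong₂ _*_ refl (rest²-l i))) (sym (sum₂-form out rest out)))

  rest²-sym : Symmetric (rest · rest)
  rest²-sym i j = sum-cong (λ k → trans (cong₂ _*_ (rest-sym i k) (rest-sym k j)) (R.*-comm _ _))

  l-rest²-out : sum₂ (λ i j → l i * ((rest · rest) i j * out j)) ≡ out-rest-out
  l-rest²-out = trans (sum-comm _) (trans (sum₂-cong (λ i j → trans (eq (l j) _ (out i)) (cong (λ t → out i * (t * l j)) (rest²-sym j i)))) out-rest²-l)
    where
    eq = solve 3 (λ a b c → a :* (b :* c) := c :* (b :* a)) refl

  -- After d⁴, the only term with a factor `d` is `4 d P`; it is what later limits the edges leaving
  -- the clique.
  fourth-moment : ⟨ M · M , M · M ⟩ ≡ d * d * (d * d) + (+ 4 * d * P + (+ 4 * out-rest-out + ⟨ rest · rest , rest · rest ⟩))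
  fourth-moment = begin
    ⟨ M · M , M · M ⟩
      ≡⟨ sum₂-cong (λ i j → trans (cong₂ _*_ (square i j) (square i j)) (eq d (l i) (l j) (out i) (out j) ((rest · rest) i j))) ⟩
    sum₂ (λ i j → d * d * (l i * l i * (l j * l j)) + (out i * out i * (l j * l j) + (l i * l i * (out j * out j) +
      (+ 2 * d * (l i * out i * (l j * l j)) + (+ 2 * d * (l i * l i * (l j * out j)) + (+ 2 * (l i * out i * (l j * out j)) +
      (+ 2 * d * (l i * (r2 i j * l j)) + (+ 2 * (out i * (r2 i j * l j)) + (+ 2 * (l i * (r2 i j * out j)) + r2 i j * r2 i j)))))))))
      ≡⟨ +ₛ (sum₂-*ˡ (d * d) _) (+ₛ refl (+ₛ refl (+ₛ (sum₂-*ˡ _ _) (+ₛ (sum₂-*ˡ _ _) (+ₛ (sum₂-*ˡ _ _) (+ₛ (sum₂-*ˡ _ _) (+ₛ (sum₂-*ˡ _ _) (+ₛ (sum₂-*ˡ _ _) refl)))))))) ⟩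
    d * d * sum₂ (λ i j → l i * l i * (l j * l j)) + (sum₂ (λ i j → out i * out i * (l j * l j)) + (sum₂ (λ i j → l i * l i * (out j * out j)) +
      (+ 2 * d * sum₂ (λ i j → l i * out i * (l j * l j)) + (+ 2 * d * sum₂ (λ i j → l i * l i * (l j * out j)) + (+ 2 * sum₂ (λ i j → l i * out i * (l j * out j)) +
      (+ 2 * d * sum₂ (λ i j → l i * (r2 i j * l j)) + (+ 2 * sum₂ (λ i j → out i * (r2 i j * l j)) + (+ 2 * sum₂ (λ i j → l i * (r2 i j * out j)) + ⟨ r2 , r2 ⟩))))))))
      ≡⟨ cong₂ _+_ (cong₂ _*_ refl (pr l·l l·l)) (cong₂ _+_ (pr refl l·l) (cong₂ _+_ (pr l·l refl) (cong₂ _+_ (cong₂ _*_ refl (pr l·out l·l))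
           (cong₂ _+_ (cong₂ _*_ refl (pr l·l l·out)) (cong₂ _+_ (cong₂ _*_ refl (pr l·out l·out)) (cong₂ _+_ (cong₂ _*_ refl l-rest²-l)
           (cong₂ _+_ (cong₂ _*_ refl out-rest²-l) (cong₂ _+_ (cong₂ _*_ refl l-rest²-out) refl)))))))) ⟩
    d * d * (d * d) + (P * d + (d * P + (+ 2 * d * (+ 0 * d) + (+ 2 * d * (d * + 0) + (+ 2 * (+ 0 * + 0) +
      (+ 2 * d * P + (+ 2 * out-rest-out + (+ 2 * out-rest-out + ⟨ r2 , r2 ⟩))))))))
      ≡⟨ eq′ d P out-rest-out ⟨ r2 , r2 ⟩ ⟩
    d * d * (d * d) + (+ 4 * d * P + (+ 4 * out-rest-out + ⟨ r2 , r2 ⟩)) ∎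
    where
    open ≡-Reasoning
    r2 : Matrix n
    r2 = rest · rest
    +ₛ : ∀ {f g : Matrix n} {x y} → sum₂ f ≡ x → sum₂ g ≡ y → sum₂ (λ i j → f i j + g i j) ≡ x + y
    +ₛ {f} {g} p q = trans (sum₂-+ f g) (cong₂ _+_ p q)
    pr : ∀ {f g : Fin n → ℤ} {x y} → sum f ≡ x → sum g ≡ y → sum₂ (λ i j → f i * g j) ≡ x * y
    pr {f} {g} p q = trans (sum₂-product f g) (cong₂ _*_ p q)
    eq = solve 6 (λ d x y p q r → (d :* (x :* y) :+ (p :* y :+ (x :* q :+ r))) :* (d :* (x :* y) :+ (p :* y :+ (x :* q :+ r))) := d :* d :* (x :* x :* (y :* y)) :+ (p :* p :* (y :* y) :+ (x :* x :* (q :* q) :+ (♯ 2 :* d :* (x :* p :* (y :* y)) :+ (♯ 2 :* d :* (x :* x :* (y :* q)) :+ (♯ 2 :* (x :* p :* (y :* q)) :+ (♯ 2 :* d :* (x :* (r :* y)) :+ (♯ 2 :* (p :* (r :* y)) :+ (♯ 2 :* (x :* (r :* q)) :+ r :* r))))))))) refl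
    eq′ = solve 4 (λ d p o r → d :* d :* (d :* d) :+ (p :* d :+ (d :* p :+ (♯ 2 :* d :* (♯ 0 :* d) :+ (♯ 2 :* d :* (d :* ♯ 0) :+ (♯ 2 :* (♯ 0 :* ♯ 0) :+ (♯ 2 :* d :* p :+ (♯ 2 :* o :+ (♯ 2 :* o :+ r)))))))) := d :* d :* (d :* d) :+ (♯ 4 :* d :* p :+ (♯ 4 :* o :+ r))) refl

  defect-formula : ∀ i j → defect d M i j ≡ out i * l j + (l i * out j + ((rest · rest) i j - d * rest i j))
  defect-formula i j = trans (cong₂ _-_ (square i j) (cong₂ _*_ refl (M-split i j))) (eq d (l i * l j) (out i * l j) (l i * out j) _ (rest i j))
    where
    eq = solve 6 (λ d x a b r s → d :* x :+ (a :+ (b :+ r)) :- d :* (x :+ s) := a :+ (b :+ (r :- d :* s))) refl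

  third-moment : ⟨ M · M , M ⟩ ≡ d * d * d + (+ 3 * P + ⟨ rest · rest , rest ⟩)
  third-moment = begin
    ⟨ M · M , M ⟩
      ≡⟨ sum₂-cong (λ i j → trans (cong₂ _*_ (square i j) (M-split i j)) (eq d (l i) (l j) (out i) (out j) ((rest · rest) i j) (rest i j))) ⟩
    sum₂ (λ i j → d * (l i * l i * (l j * l j)) + (d * (l i * (rest i j * l j)) + (l i * out i * (l j * l j) + (l i * l i * (l j * out j) +
      (out i * (rest i j * l j) + (l i * rest i j * out j + (l i * ((rest · rest) i j * l j) + (rest · rest) i j * rest i j)))))))
      ≡⟨ +ₛ (sum₂-*ˡ d _) (+ₛ (sum₂-*ˡ d _) (+ₛ refl (+ₛ refl (+ₛ refl (+ₛ refl (+ₛ refl refl)))))) ⟩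
    d * sum₂ (λ i j → l i * l i * (l j * l j)) + (d * sum₂ (λ i j → l i * (rest i j * l j)) + (sum₂ (λ i j → l i * out i * (l j * l j)) + (sum₂ (λ i j → l i * l i * (l j * out j)) +
      (sum₂ (λ i j → out i * (rest i j * l j)) + (sum₂ (λ i j → l i * rest i j * out j) + (sum₂ (λ i j → l i * ((rest · rest) i j * l j)) + ⟨ rest · rest , rest ⟩))))))
      ≡⟨ cong₂ _+_ (cong₂ _*_ refl (pr l·l l·l)) (cong₂ _+_ (cong₂ _*_ refl (sum-0 (λ i → sum-0 (l-rest-l i)))) (cong₂ _+_ (pr l·out l·l) (cong₂ _+_ (pr l·l l·out)
           (cong₂ _+_ (sum₂-form out rest l) (cong₂ _+_ (trans (sum-comm _) (sum-cong (λ j → trans (sum-*ʳ (out j) _) (cong₂ _*_ (out′ j) refl)))) (cong₂ _+_ l-rest²-l refl)))))) ⟩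
    d * (d * d) + (d * + 0 + (+ 0 * d + (d * + 0 + (P + (P + (P + ⟨ rest · rest , rest ⟩))))))
      ≡⟨ eq′ d P _ ⟩
    d * d * d + (+ 3 * P + ⟨ rest · rest , rest ⟩) ∎
    where
    open ≡-Reasoning
    +ₛ : ∀ {f g : Matrix n} {x y} → sum₂ f ≡ x → sum₂ g ≡ y → sum₂ (λ i j → f i j + g i j) ≡ x + y
    +ₛ {f} {g} p q = trans (sum₂-+ f g) (cong₂ _+_ p q)
    pr : ∀ {f g : Fin n → ℤ} {x y} → sum f ≡ x → sum g ≡ y → sum₂ (λ i j → f i * g j) ≡ x * y
    pr {f} {g} p q = trans (sum₂-product f g) (cong₂ _*_ p q)
    eq = solve 7 (λ d x y p q r s → (d :* (x :* y) :+ (p :* y :+ (x :* q :+ r))) :* (x :* y :+ s) := d :* (x :* x :* (y :* y)) :+ (d :* (x :* (s :* y)) :+ (x :* p :* (y :* y) :+ (x :* x :* (y :* q) :+ (p :* (s :* y) :+ (x :* s :* q :+ (x :* (r :* y) :+ r :* s))))))) refl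
    eq′ = solve 3 (λ d p r → d :* (d :* d) :+ (d :* ♯ 0 :+ (♯ 0 :* d :+ (d :* ♯ 0 :+ (p :+ (p :+ (p :+ r)))))) := d :* d :* d :+ (♯ 3 :* p :+ r)) refl

-- Lagrange's identity: twice the difference of the two sides is the sum of w k * w l * (f k - f l)²
-- over all pairs.
cauchy : ∀ {n} (w f : Fin n → ℤ) → (∀ k → + 0 ≤ w k) → sum (λ k → w k * f k) * sum (λ k → w k * f k) ≤ sum w * sum (λ k → w k * (f k * f k))
cauchy w f nw = *-cancel-≤ {+ 2} (+≤+ (s≤s z≤n)) (≤-trans (≡⇒≤ lhs) (≤-trans (sum₂-mono point) (≡⇒≤ rhs)))
  where
  lhs : + 2 * (sum (λ k → w k * f k) * sum (λ k → w k * f k)) ≡ sum₂ (λ k l → + 2 * (w k * f k * (w l * f l)))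
  lhs = trans (cong₂ _*_ refl (sym (sum₂-product (λ k → w k * f k) (λ k → w k * f k)))) (sym (sum₂-*ˡ (+ 2) _))
  rhs : sum₂ (λ k l → w k * (w l * (f l * f l)) + w k * (f k * f k) * w l) ≡ + 2 * (sum w * sum (λ k → w k * (f k * f k)))
  rhs = trans (sum₂-+ _ _) (trans (cong₂ _+_ (sum₂-product w _) (sum₂-product _ w)) (eq (sum w) _))
    where
    eq = solve 2 (λ a b → a :* b :+ b :* a := ♯ 2 :* (a :* b)) refl
  point : ∀ k l → + 2 * (w k * f k * (w l * f l)) ≤ w k * (w l * (f l * f l)) + w k * (f k * f k) * w l
  point k l = ≤-by (nw k ⊠ nw l ⊠ 0≤sq (f k - f l)) (eq (w k) (w l) (f k) (f l))
    where
    eq = solve 4 (λ u v x y → u :* (v :* (y :* y)) :+ u :* (x :* x) :* v :- ♯ 2 :* (u :* x :* (v :* y)) := u :* v :* ((x :- y) :* (x :- y))) refl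

module Schur {n} (r : Matrix n) (nr : ∀ i j → + 0 ≤ r i j) (sr : Symmetric r) (c : ℤ) (nc : + 0 ≤ c) (rows : ∀ i → sum (r i) ≤ c) where

  -- Schur's test: Cauchy-Schwarz in each row, then the column sums, which by symmetry are row sums.
  vector-bound : ∀ (f : Fin n → ℤ) → sum (λ i → sum (λ k → r i k * f k) * sum (λ k → r i k * f k)) ≤ c * c * sum (λ k → f k * f k)
  vector-bound f = begin≤ (sum-mono (λ i → ≤-trans (cauchy (r i) f (nr i)) (*-mono-l (rows i) (sum-≥0 (λ k → nr i k ⊠ 0≤sq (f k))))))
      (≤-trans (≡⇒≤ (trans (sum-*ˡ c _) (cong₂ _*_ refl (trans (sum-comm _) (sum-cong (λ k → trans (sum-*ʳ (f k * f k) _) (cong₂ _*_ (sum-cong (λ i → sr i k)) refl)))))))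
        (≤-trans (*-monoˡ nc (sum-mono (λ k → *-mono-l (rows k) (0≤sq (f k))))) (≡⇒≤ (trans (cong₂ _*_ refl (sum-*ˡ c _)) (sym (R.*-assoc c c _))))))
    where
    begin≤ : ∀ {a b c : ℤ} → a ≤ b → b ≤ c → a ≤ c
    begin≤ = ≤-trans
    *-mono-l : ∀ {a b x} → a ≤ b → + 0 ≤ x → a * x ≤ b * x
    *-mono-l {a} {b} {x} p q = ≤-cong (R.*-comm x a) (R.*-comm x b) (*-monoˡ q p)

  matrix-bound : ∀ (y : Matrix n) → ⟨ r · y , r · y ⟩ ≤ c * c * ⟨ y , y ⟩
  matrix-bound y = ≤-trans (≡⇒≤ (sum-comm _)) (≤-trans (sum-mono (λ j → vector-bound (λ k → y k j))) (≡⇒≤ (trans (sum-*ˡ (c * c) _) (cong₂ _*_ refl (sum-comm _)))))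

square-sum₂ : ∀ a b → (a + b) * (a + b) ≤ + 2 * (a * a + b * b)
square-sum₂ a b = ≤-by (0≤sq (a - b)) (eq a b)
  where
  eq = solve 2 (λ a b → ♯ 2 :* (a :* a :+ b :* b) :- (a :+ b) :* (a :+ b) := (a :- b) :* (a :- b)) refl

module BlockBounds {n} (M : Matrix n) (sM : Symmetric M) (l : Fin n → ℤ) (l-idem : ∀ i → l i * l i ≡ l i) (d : ℤ) (l-sum : sum l ≡ d)
  (full : ∀ i j → l i * (l j * M i j) ≡ l i * l j) (0≤d : + 0 ≤ d) where

  open Block M sM l l-idem d l-sum full

  -- The row bound 5 covers a tail vertex of degree 3 together with its loop, with one unit to
  -- spare; `P ≡ 1` expresses a single edge into the clique.
  module Sparse (nrest : ∀ i j → + 0 ≤ rest i j) (rest-idem : ∀ i j → rest i j * rest i j ≡ rest i j)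
           (rows : ∀ i → sum (rest i) ≤ + 5) (P≡1 : P ≡ + 1) where

    module Sch = Schur rest nrest rest-sym (+ 5) 0≤+ rows

    weight : ℤ
    weight = sum₂ rest

    private
      rest-norm : ⟨ rest , rest ⟩ ≡ weight
      rest-norm = sum₂-cong rest-idem

      V : ℤ
      V = ⟨ defect d M , defect d M ⟩

      w : Fin n → ℤ
      w i = sum (λ k → rest i k * out k)

      opaque
        unfolding _*_
        5*5 : + 5 * + 5 ≡ + 25
        5*5 = refl

      w-norm : sum (λ i → w i * w i) ≤ + 25
      w-norm = ≤-trans (Sch.vector-bound out) (≡⇒≤ (trans (cong₂ _*_ 5*5 P≡1) (R.*-identityʳ _)))

    rest²-bound : ⟨ rest · rest , rest · rest ⟩ ≤ + 25 * weight
    rest²-bound = ≤-trans (Sch.matrix-bound rest) (≡⇒≤ (cong₂ _*_ 5*5 rest-norm))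

    -- The four terms of `defect-formula` are separated by (a + b + c - e)² ≤ 4 (a² + b² + c² + e²).
    defect-bound : V ≤ + 8 * d + + 100 * weight + + 4 * (d * d * weight)
    defect-bound = ≤-trans (sum₂-mono point) (≤-trans (≡⇒≤ (trans (sum₂-*ˡ (+ 4) _) (cong₂ _*_ refl (trans (sum₂-+ _ _) (cong₂ _+_ (sum₂-product _ _)
        (trans (sum₂-+ _ _) (cong₂ _+_ (sum₂-product _ _) (trans (sum₂-+ _ _) (cong₂ _+_ refl (trans (sum₂-*ˡ (d * d) _) (cong₂ _*_ refl rest-norm)))))))))))
        (≤-by (0≤+ {4} ⊠ ≤-diff rest²-bound) (trans (cong₂ (λ p q → + 8 * d + + 100 * weight + + 4 * (d * d * weight) - + 4 * (p * q + (q * p + (⟨ rest · rest , rest · rest ⟩ + d * d * weight)))) P≡1 l·l)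
          (eq′ d weight _))))
      where
      eq = solve 4 (λ a b c e → ♯ 4 :* (a :* a :+ (b :* b :+ (c :* c :+ e :* e))) :- (a :+ (b :+ (c :- e))) :* (a :+ (b :+ (c :- e))) := (a :- b) :* (a :- b) :+ ((a :- c) :* (a :- c) :+ ((a :+ e) :* (a :+ e) :+ ((b :- c) :* (b :- c) :+ ((b :+ e) :* (b :+ e) :+ (c :+ e) :* (c :+ e)))))) refl
      eq′ = solve 3 (λ d x r → ♯ 8 :* d :+ ♯ 100 :* x :+ ♯ 4 :* (d :* d :* x) :- ♯ 4 :* (♯ 1 :* d :+ (d :* ♯ 1 :+ (r :+ d :* d :* x))) := ♯ 4 :* (♯ 25 :* x :- r)) refl
      re = solve 7 (λ p l q m r d s → ♯ 4 :* (p :* p :* (m :* m) :+ (l :* l :* (q :* q) :+ (r :* r :+ d :* d :* (s :* s)))) := ♯ 4 :* (p :* m :* (p :* m) :+ (l :* q :* (l :* q) :+ (r :* r :+ d :* s :* (d :* s))))) refl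
      point : ∀ i j → defect d M i j * defect d M i j ≤ + 4 * (out i * out i * (l j * l j) + (l i * l i * (out j * out j) + ((rest · rest) i j * (rest · rest) i j + d * d * (rest i j * rest i j))))
      point i j = ≤-cong (sym (cong₂ _*_ (defect-formula i j) (defect-formula i j))) (sym (re (out i) (l i) (out j) (l j) ((rest · rest) i j) d (rest i j)))
        (≤-by (0≤sq _ ⊞ (0≤sq _ ⊞ (0≤sq _ ⊞ (0≤sq _ ⊞ (0≤sq _ ⊞ 0≤sq _))))) (eq (out i * l j) (l i * out j) ((rest · rest) i j) (d * rest i j)))

    private
      l-defect : ∀ j → sum (λ k → l k * defect d M k j) ≡ w j
      l-defect j = begin
        sum (λ k → l k * defect d M k j)
          ≡⟨ sum-cong (λ k → trans (cong₂ _*_ refl (defect-formula k j)) (eq (l k) (out k) (l j) (out j) _ d (rest k j))) ⟩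
        sum (λ k → l k * out k * l j + (l k * l k * out j + (l k * (rest · rest) k j + - d * (l k * rest k j))))
          ≡⟨ trans (sum-+ _ _) (cong₂ _+_ (trans (sum-*ʳ (l j) _) (cong₂ _*_ l·out refl)) (trans (sum-+ _ _) (cong₂ _+_ (trans (sum-*ʳ (out j) _) (cong₂ _*_ l·l refl))
               (trans (sum-+ _ _) (cong₂ _+_ (trans (sum-cong (λ k → trans (R.*-comm _ _) (cong₂ _*_ (rest²-sym k j) refl))) (rest²-l j)) (trans (sum-*ˡ (- d) _) (cong₂ _*_ refl (out′ j)))))))) ⟩
        + 0 * l j + (d * out j + (w j + - d * out j))
          ≡⟨ eq′ (l j) d (out j) (w j) ⟩
        w j ∎
        where
        open ≡-Reasoning
        eq = solve 7 (λ l p m q r d s → l :* (p :* m :+ (l :* q :+ (r :- d :* s))) := l :* p :* m :+ (l :* l :* q :+ (l :* r :+ :- d :* (l :* s)))) refl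
        eq′ = solve 4 (λ l d p w → ♯ 0 :* l :+ (d :* p :+ (w :+ :- d :* p)) := w) refl

    -- Although `M` has norm about `d`, multiplying by it does not enlarge the defect by such a
    -- factor: in lᵀ `defect` the two terms `d * out` cancel, so the rank-one part of `M`
    -- contributes only l wᵀ.
    defect₂-bound : ⟨ M · defect d M , M · defect d M ⟩ ≤ + 50 * d + + 50 * V
    defect₂-bound = ≤-trans (sum₂-mono point) (≤-trans (≡⇒≤ (trans (sum₂-*ˡ (+ 2) _) (cong₂ _*_ refl (trans (sum₂-+ _ _) (cong₂ _+_ (trans (sum₂-product _ _) (cong₂ _*_ l·l refl)) refl)))))
        (≤-by (0≤+ {2} ⊠ (0≤d ⊠ ≤-diff w-norm ⊞ ≤-diff (≤-trans (Sch.matrix-bound (defect d M)) (≡⇒≤ (cong₂ _*_ 5*5 refl))))) (eq d (sum (λ j → w j * w j)) V _)))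
      where
      eq = solve 4 (λ d w v x → ♯ 50 :* d :+ ♯ 50 :* v :- ♯ 2 :* (d :* w :+ x) := ♯ 2 :* (d :* (♯ 25 :- w) :+ (♯ 25 :* v :- x))) refl
      sq = solve 2 (λ a b → a :* a :* (b :* b) := a :* b :* (a :* b)) refl
      spl = solve 4 (λ m l k x → m :* x := l :* (k :* x) :+ (m :- l :* k) :* x) refl
      formula : ∀ i j → (M · defect d M) i j ≡ l i * w j + (rest · defect d M) i j
      formula i j = trans (sum-cong (λ k → spl (M i k) (l i) (l k) (defect d M k j))) (trans (sum-+ _ _) (cong₂ _+_ (trans (sum-*ˡ (l i) _) (cong₂ _*_ refl (l-defect j))) refl))
      point : ∀ i j → (M · defect d M) i j * (M · defect d M) i j ≤ + 2 * (l i * l i * (w j * w j) + (rest · defect d M) i j * (rest · defect d M) i j)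
      point i j = ≤-cong (sym (cong₂ _*_ (formula i j) (formula i j))) (cong₂ _*_ refl (cong₂ _+_ (sym (sq (l i) (w j))) refl)) (square-sum₂ (l i * w j) ((rest · defect d M) i j))

    fourth-bound : ⟨ M · M , M · M ⟩ ≤ d * d * (d * d) + (+ 4 * d + (+ 52 + + 25 * weight))
    fourth-bound = ≤-trans (≡⇒≤ fourth-moment) (≤-by (0≤+ {2} ⊠ ≤-diff cross ⊞ ≤-diff rest²-bound)
        (trans (cong (λ p → d * d * (d * d) + (+ 4 * d + (+ 52 + + 25 * weight)) - (d * d * (d * d) + (+ 4 * d * p + (+ 4 * out-rest-out + ⟨ rest · rest , rest · rest ⟩)))) P≡1)
          (eq d weight out-rest-out _)))
      where
      eq = solve 4 (λ d x o r → d :* d :* (d :* d) :+ (♯ 4 :* d :+ (♯ 52 :+ ♯ 25 :* x)) :- (d :* d :* (d :* d) :+ (♯ 4 :* d :* ♯ 1 :+ (♯ 4 :* o :+ r))) := ♯ 2 :* (♯ 26 :- ♯ 2 :* o) :+ (♯ 25 :* x :- r)) refl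
      eq₁ = solve 2 (λ p w → p :* p :+ w :* w :- ♯ 2 :* (p :* w) := (p :- w) :* (p :- w)) refl
      opaque
        unfolding _+_ _*_ -_
        eq₂ : + 1 + + 25 ≡ + 26
        eq₂ = refl
      -- Twice the inner product of `out` and `w` is at most the sum of their squared norms, 1 + 25.
      cross : + 2 * out-rest-out ≤ + 26
      cross = ≤-trans (≡⇒≤ (trans (cong₂ _*_ refl (sum₂-form out rest out)) (sym (sum-*ˡ (+ 2) _))))
        (≤-trans (sum-mono (λ i → ≤-by (0≤sq (out i - w i)) (eq₁ (out i) (w i)))) (≤-trans (≡⇒≤ (sum-+ _ _)) (≤-trans (+-mono (≡⇒≤ P≡1) w-norm) (≡⇒≤ eq₂))))

    third-bound : d * d * d ≤ ⟨ M · M , M ⟩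
    third-bound = ≤-trans (a≤a+b (subst (λ p → + 0 ≤ + 3 * p + ⟨ rest · rest , rest ⟩) (sym P≡1)
      (0≤+ {3} ⊠ 0≤+ {1} ⊞ sum₂-≥0 (λ i j → sum-≥0 (λ k → nrest i k ⊠ nrest k j) ⊠ nrest i j)))) (≡⇒≤ (sym third-moment))

    second-moment : (∀ i j → M i j * M i j ≡ M i j) → ⟨ M , M ⟩ ≡ d * d + weight
    second-moment M-idem = trans (sum₂-cong (λ i j → trans (M-idem i j) (eq (M i j) (l i * l j)))) (trans (sum₂-+ _ _) (cong₂ _+_ (trans (sum₂-product l l) (cong₂ _*_ l-sum l-sum)) refl))
      where
      eq = solve 2 (λ m x → m := x :+ (m :- x)) refl

  fourth-lower : (∀ i j → + 0 ≤ rest i j) → (∀ i → + 0 ≤ out i) → d * d * (d * d) + + 4 * d * P ≤ ⟨ M · M , M · M ⟩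
  fourth-lower nrest nout = ≤-trans (≤-by (0≤+ {4} ⊠ sum₂-≥0 (λ i k → nout i ⊠ (nrest i k ⊠ nout k)) ⊞ sum₂-≥0 (λ i j → 0≤sq ((rest · rest) i j)))
      (eq (d * d * (d * d)) (+ 4 * d * P) out-rest-out _)) (≡⇒≤ (sym fourth-moment))
    where
    eq = solve 4 (λ a b o r → a :+ (b :+ (♯ 4 :* o :+ r)) :- (a :+ b) := ♯ 4 :* o :+ r) refl

-- Extracting the clique from the moments

Bit : ℤ → Set
Bit x = x ≡ + 0 ⊎ x ≡ + 1

bit-≥0 : ∀ {x} → Bit x → + 0 ≤ x
bit-≥0 (inj₁ refl) = ≤-refl
bit-≥0 (inj₂ refl) = 0≤+

bit-≤1 : ∀ {x} → Bit x → + 0 ≤ + 1 - x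
bit-≤1 (inj₁ refl) = ≤-diff 0≤+
bit-≤1 (inj₂ refl) = ≤-diff ≤-refl

bit-idem : ∀ {x} → Bit x → x * x ≡ x
bit-idem (inj₁ refl) = R.zeroˡ (+ 0)
bit-idem (inj₂ refl) = R.*-identityˡ (+ 1)

nonneg-sum-zero : ∀ {n} {f : Fin n → ℤ} → (∀ i → + 0 ≤ f i) → sum f ≡ + 0 → ∀ i → f i ≡ + 0
nonneg-sum-zero nf e i = ℤₚ.≤-antisym (≤-trans (term≤sum nf i) (≡⇒≤ e)) (nf i)

-- A graph whose spectral moments are those of a clique on d vertices with little attached contains
-- such a clique, and few edges leave it.
module CliqueExtraction {n} (M : Matrix n) (sM : Symmetric M) (bM : ∀ i j → Bit (M i j)) (diag : ∀ i → M i i ≡ + 1)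
  (d t w : ℤ) (n≡ : + n ≡ d + t) (1≤t : + 1 ≤ t) (big : + 200000 * t ≤ d) (0≤w : + 0 ≤ w) (w≤ : w ≤ + 10 * t)
  (m₂ : ⟨ M , M ⟩ ≡ d * d + w) (m₃ : d * d * d ≤ ⟨ M · M , M ⟩)
  (m₄ : ⟨ M · M , M · M ⟩ ≤ d * d * (d * d) + (+ 4 * d + (+ 52 + + 25 * w)))
  (V≤ : ⟨ defect d M , defect d M ⟩ ≤ + 48 * (d * d * t))
  (F≤ : ⟨ M · defect d M , M · defect d M ⟩ ≤ + 2450 * (d * d * t)) where

  private
    0≤t : + 0 ≤ t
    0≤t = 1≤⇒0≤ 1≤t

    nM : ∀ i j → + 0 ≤ M i j
    nM i j = bit-≥0 (bM i j)

    0≤d : + 0 ≤ d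
    0≤d = ≤-trans (0≤+ {200000} ⊠ 0≤t) big

    1≤d : + 1 ≤ d
    1≤d = ≤-trans (≤-by (0≤+ {199999} ⊠ 0≤t ⊞ ≤-diff 1≤t) (eq t)) big
      where
      eq = solve 1 (λ t → ♯ 200000 :* t :- ♯ 1 := ♯ 199999 :* t :+ (t :- ♯ 1)) refl

    1≤dd : + 1 ≤ d * d
    1≤dd = ≤-trans (≡⇒≤ (sym (R.*-identityˡ (+ 1)))) (*-mono {+ 1} {d} {+ 1} 0≤+ 0≤+ 1≤d 1≤d)

    c : Fin n → ℤ
    c i = sum (M i)

    -- The threshold 3 d / 4 serves both sides. Two vertices above it have about d / 2 common closed
    -- neighbours, so a missing edge between them makes a large entry of the defect; below it, c (d
    -- - c) is at least c d / 4.
    dichotomy : ∀ i → + 4 * c i ≤ + 3 * d ⊎ + 3 * d + + 1 ≤ + 4 * c i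
    dichotomy i = ≤-total (+ 4 * c i) (+ 3 * d)

    indicator : ∀ {a b : ℤ} {A B : Set} → A ⊎ B → ℤ
    indicator (inj₁ _) = + 0
    indicator (inj₂ _) = + 1

  l : Fin n → ℤ
  l i = indicator {+ 0} {+ 0} (dichotomy i)

  l-bit : ∀ i → Bit (l i)
  l-bit i with dichotomy i
  ... | inj₁ _ = inj₁ refl
  ... | inj₂ _ = inj₂ refl

  private
    large : ∀ i → l i ≡ + 1 → + 3 * d + + 1 ≤ + 4 * c i
    large i e with dichotomy i
    large i () | inj₁ _
    ... | inj₂ p = p

    small : ∀ i → l i ≡ + 0 → + 4 * c i ≤ + 3 * d
    small i e with dichotomy i
    ... | inj₁ p = p
    small i () | inj₂ _

    nl : ∀ i → + 0 ≤ l i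
    nl i = bit-≥0 (l-bit i)

    s : Fin n → ℤ
    s i = + 1 - l i

    ns : ∀ i → + 0 ≤ s i
    ns i = bit-≤1 (l-bit i)

    nc : ∀ i → + 0 ≤ c i
    nc i = sum-≥0 (nM i)

    M²≤c : ∀ i j → (M · M) j i ≤ c i
    M²≤c i j = ≤-trans (sum-mono (λ k → ≤-by (nM k i ⊠ bit-≤1 (bM j k)) (eq (M j k) (M k i)))) (≡⇒≤ (sum-cong (λ k → sM k i)))
      where
      eq = solve 2 (λ a b → b :- a :* b := b :* (♯ 1 :- a)) refl

    Z : Fin n → ℤ
    Z i = (M · defect d M) i i

    -- No vertex shares more than `c i` closed neighbours with `i`, so each of the `c i` terms is at
    -- most `c i - d`.
    Z≤ : ∀ i → Z i ≤ c i * (c i - d)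
    Z≤ i = ≤-trans (sum-mono (λ j → term j (bM i j))) (≡⇒≤ (sum-*ʳ (c i - d) _))
      where
      eq₀ = solve 2 (λ x y → ♯ 0 :* x := ♯ 0 :* y) refl
      eq₁ = solve 3 (λ c d m → ♯ 1 :* (c :- d) :- ♯ 1 :* (m :- d :* ♯ 1) := c :- m) refl
      term : ∀ j → Bit (M i j) → M i j * defect d M j i ≤ M i j * (c i - d)
      term j (inj₁ e) = ≡⇒≤ (trans (cong₂ _*_ e refl) (trans (eq₀ _ _) (cong₂ _*_ (sym e) refl)))
      term j (inj₂ e) = ≤-by (≤-diff (M²≤c i j)) (trans (cong₂ _-_ (cong₂ _*_ e refl) (cong₂ _*_ e (cong₂ _-_ refl (cong₂ _*_ refl (trans (sM j i) e))))) (eq₁ (c i) d _))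

    Q : ℤ
    Q = sum (λ i → s i * (c i * c i))

    Q-point : ∀ i → Bit (l i) → s i * (c i * c i) * (d * d) ≤ + 16 * (Z i * Z i)
    Q-point i (inj₂ e) = ≤-trans (≡⇒≤ (trans (cong (λ x → (+ 1 - x) * (c i * c i) * (d * d)) e) (eq (c i) d))) (0≤+ {16} ⊠ 0≤sq (Z i))
      where
      eq = solve 2 (λ c d → (♯ 1 :- ♯ 1) :* (c :* c) :* (d :* d) := ♯ 0) refl
    Q-point i (inj₁ e) = ≤-cong (trans (eq₁ (c i) d) (cong (λ x → (+ 1 - x) * (c i * c i) * (d * d)) (sym e))) (eq₂ (Z i)) (*-mono (nc i ⊠ 0≤d) (nc i ⊠ 0≤d) bound bound)
      where
      eq₁ = solve 2 (λ c d → c :* d :* (c :* d) := (♯ 1 :- ♯ 0) :* (c :* c) :* (d :* d)) refl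
      eq₂ = solve 1 (λ z → (♯ 4 :* :- z) :* (♯ 4 :* :- z) := ♯ 16 :* (z :* z)) refl
      eq₃ = solve 3 (λ c d z → ♯ 4 :* :- z :- c :* d := ♯ 4 :* (c :* (c :- d) :- z) :+ c :* (♯ 3 :* d :- ♯ 4 :* c)) refl
      bound : c i * d ≤ + 4 * - Z i
      bound = ≤-by (0≤+ {4} ⊠ ≤-diff (Z≤ i) ⊞ nc i ⊠ ≤-diff (small i e)) (eq₃ (c i) d (Z i))

    -- Below the threshold, -`Z i` is at least c d / 4, so the squared degrees there are paid for by
    -- the diagonal of `M · defect d M`; 39200 is 16 times 2450.
    Q≤ : Q ≤ + 39200 * t
    Q≤ = *-cancel-≤ {d * d} 1≤dd (≤-trans (≡⇒≤ (trans (R.*-comm (d * d) Q) (sym (sum-*ʳ (d * d) _))))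
      (≤-trans (sum-mono (λ i → Q-point i (l-bit i))) (≤-trans (≡⇒≤ (sum-*ˡ (+ 16) _))
        (≤-trans (*-monoˡ 0≤+ (≤-trans (sum-mono (λ i → term≤sum (λ j → 0≤sq ((M · defect d M) i j)) i)) F≤)) (≡⇒≤ (eq d t))))))
      where
      eq = solve 2 (λ d t → ♯ 16 :* (♯ 2450 :* (d :* d :* t)) := d :* d :* (♯ 39200 :* t)) refl

    missing : ℤ
    missing = sum₂ (λ i j → l i * l j * (+ 1 - M i j))

    n-missing : ∀ i j → + 0 ≤ l i * l j * (+ 1 - M i j)
    n-missing i j = nl i ⊠ nl j ⊠ bit-≤1 (bM i j)

    common : ∀ i j → c i + c j - + n ≤ (M · M) i j
    common i j = ≤-trans (≡⇒≤ (sym (trans (sum-+ _ _) (cong₂ _+_ (trans (sum-+ _ _) (cong₂ _+_ refl (sum-cong (λ k → sM k j)))) (trans (sum-neg _) (cong -_ (sum-1 n)))))))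
      (sum-mono (λ k → ≤-by (bit-≤1 (bM i k) ⊠ bit-≤1 (bM k j)) (eq (M i k) (M k j))))
      where
      eq = solve 2 (λ a b → a :* b :- (a :+ b :+ :- (♯ 1)) := (♯ 1 :- a) :* (♯ 1 :- b)) refl

    missing-point : ∀ i j → Bit (l i) → Bit (l j) → Bit (M i j) → l i * l j * (+ 1 - M i j) * (d * d) ≤ + 16 * (defect d M i j * defect d M i j)
    missing-point i j (inj₁ e) _ _ = ≤-trans (≡⇒≤ (trans (cong (λ x → x * l j * (+ 1 - M i j) * (d * d)) e) (eq (l j) (+ 1 - M i j) (d * d)))) (0≤+ {16} ⊠ 0≤sq _)
      where
      eq = solve 3 (λ x y z → ♯ 0 :* x :* y :* z := ♯ 0) refl
    missing-point i j (inj₂ _) (inj₁ e) _ = ≤-trans (≡⇒≤ (trans (cong (λ x → l i * x * (+ 1 - M i j) * (d * d)) e) (eq (l i) (+ 1 - M i j) (d * d)))) (0≤+ {16} ⊠ 0≤sq _)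
      where
      eq = solve 3 (λ x y z → x :* ♯ 0 :* y :* z := ♯ 0) refl
    missing-point i j (inj₂ _) (inj₂ _) (inj₂ e) = ≤-trans (≡⇒≤ (trans (cong (λ x → l i * l j * (+ 1 - x) * (d * d)) e) (eq (l i * l j) (d * d)))) (0≤+ {16} ⊠ 0≤sq _)
      where
      eq = solve 2 (λ x z → x :* (♯ 1 :- ♯ 1) :* z := ♯ 0) refl
    missing-point i j (inj₂ p) (inj₂ q) (inj₁ e) = ≤-cong lhs (eq₂ (defect d M i j)) (*-mono 0≤d 0≤d bound bound)
      where
      eq₁ = solve 1 (λ d → d :* d := ♯ 1 :* ♯ 1 :* (♯ 1 :- ♯ 0) :* (d :* d)) refl
      eq₂ = solve 1 (λ x → (♯ 4 :* x) :* (♯ 4 :* x) := ♯ 16 :* (x :* x)) refl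
      eq₃ = solve 5 (λ x y d t m → ♯ 4 :* (m :- d :* ♯ 0) :- d := (♯ 4 :* x :- (♯ 3 :* d :+ ♯ 1)) :+ (♯ 4 :* y :- (♯ 3 :* d :+ ♯ 1)) :+ ♯ 4 :* (m :- (x :+ y :- (d :+ t))) :+ (d :- ♯ 200000 :* t :+ ♯ 199996 :* t :+ ♯ 2)) refl
      lhs : d * d ≡ l i * l j * (+ 1 - M i j) * (d * d)
      lhs = trans (eq₁ d) (cong₂ _*_ (cong₂ _*_ (cong₂ _*_ (sym p) (sym q)) (cong₂ _-_ refl (sym e))) refl)
      bound : d ≤ + 4 * defect d M i j
      bound = ≤-by (≤-diff (large i p) ⊞ ≤-diff (large j q) ⊞ 0≤+ {4} ⊠ ≤-diff (subst (λ x → c i + c j - x ≤ (M · M) i j) n≡ (common i j)) ⊞ (≤-diff big ⊞ 0≤+ {199996} ⊠ 0≤t ⊞ 0≤+ {2}))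
        (trans (cong (λ x → + 4 * ((M · M) i j - d * x) - d) e) (eq₃ (c i) (c j) d t _))

    -- Each missing pair forces an entry of the defect of at least d / 4; 768 is 16 times 48.
    missing≤ : missing ≤ + 768 * t
    missing≤ = *-cancel-≤ {d * d} 1≤dd (≤-trans (≡⇒≤ (trans (R.*-comm (d * d) missing) (trans (sym (sum-*ʳ (d * d) _)) (sum-cong (λ i → sym (sum-*ʳ (d * d) _))))))
      (≤-trans (sum₂-mono (λ i j → missing-point i j (l-bit i) (l-bit j) (bM i j))) (≤-trans (≡⇒≤ (sum₂-*ˡ (+ 16) _)) (≤-trans (*-monoˡ 0≤+ V≤) (≡⇒≤ (eq d t))))))
      where
      eq = solve 2 (λ d t → ♯ 16 :* (♯ 48 :* (d :* d :* t)) := d :* d :* (♯ 768 :* t)) refl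

    0≤missing : + 0 ≤ missing
    0≤missing = sum₂-≥0 n-missing

    ℓ : ℤ
    ℓ = sum l

    0≤ℓ : + 0 ≤ ℓ
    0≤ℓ = sum-≥0 nl

    inside : sum₂ (λ i j → l i * l j * M i j) ≡ ℓ * ℓ - missing
    inside = trans (eq _ missing) (cong (λ x → x - missing) (trans (sym (sum₂-+ _ _)) (trans (sum₂-cong (λ i j → eq′ (l i * l j) (M i j))) (sum₂-product l l))))
      where
      eq = solve 2 (λ a b → a := (a :+ b) :- b) refl
      eq′ = solve 2 (λ x m → x :* m :+ x :* (♯ 1 :- m) := x) refl

    boundary : ℤ
    boundary = sum₂ (λ i j → (+ 1 - l i * l j) * M i j)

    0≤boundary : + 0 ≤ boundary
    0≤boundary = sum₂-≥0 (λ i j → ≤-trans (ns i ⊞ nl i ⊠ ns j) (≡⇒≤ (eq (l i) (l j))) ⊠ nM i j)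
      where
      eq = solve 2 (λ x y → (♯ 1 :- x) :+ x :* (♯ 1 :- y) := ♯ 1 :- x :* y) refl

    1≤c : ∀ i → + 1 ≤ c i
    1≤c i = ≤-trans (≡⇒≤ (sym (diag i))) (term≤sum (nM i) i)

    boundary≤ : boundary ≤ + 2 * Q
    boundary≤ = ≤-trans (sum₂-mono point) (≤-trans (≡⇒≤ (trans (sum₂-+ _ _) (cong₂ _+_ rows (trans (sum-comm _) (trans (sum₂-cong (λ i j → cong₂ _*_ refl (sM j i))) rows)))))
        (≤-trans (+-mono Q₁ Q₁) (≡⇒≤ (eq₂ Q))))
      where
      eq = solve 3 (λ x y m → ((♯ 1 :- x) :* m :+ (♯ 1 :- y) :* m) :- (♯ 1 :- x :* y) :* m := (♯ 1 :- x) :* (♯ 1 :- y) :* m) refl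
      eq₂ = solve 1 (λ q → q :+ q := ♯ 2 :* q) refl
      eq₃ = solve 2 (λ s c → s :* (c :* c) :- s :* c := s :* c :* (c :- ♯ 1)) refl
      point : ∀ i j → (+ 1 - l i * l j) * M i j ≤ s i * M i j + s j * M i j
      point i j = ≤-by (ns i ⊠ ns j ⊠ nM i j) (eq (l i) (l j) (M i j))
      rows : sum₂ (λ i j → s i * M i j) ≡ sum (λ i → s i * c i)
      rows = sum-cong (λ i → sum-*ˡ (s i) _)
      Q₁ : sum (λ i → s i * c i) ≤ Q
      Q₁ = sum-mono (λ i → ≤-by (ns i ⊠ nc i ⊠ ≤-diff (1≤c i)) (eq₃ (s i) (c i)))

    count : ℓ * ℓ - missing + boundary ≡ d * d + w
    count = trans (cong₂ _+_ (sym inside) refl) (trans (sym (sum₂-+ _ _)) (trans (sum₂-cong (λ i j → trans (eq (l i * l j) (M i j)) (sym (bit-idem (bM i j))))) m₂))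
      where
      eq = solve 2 (λ x m → x :* m :+ (♯ 1 :- x) :* m := m) refl

    -- Incompatible inequalities are refuted by adding their slacks: the sum is nonnegative, yet the
    -- ring solver evaluates it to -1.
    absurd : ∀ {x} → + 0 ≤ x → x ≡ - + 1 → ⊥
    absurd p e = 1≰0 (≤-by p (trans eq (sym e)))
      where
      opaque
        unfolding _+_ _*_ -_
        eq : + 0 - + 1 ≡ - + 1
        eq = refl

  -- By `count`, ℓ² differs from d² only by `missing`, `boundary` and `w`, all bounded by a multiple
  -- of `t`, whereas moving `ℓ` away from `d` by one changes the square by about 2 d.
  l-sum : sum l ≡ d
  l-sum with ≤-total ℓ d
  ... | inj₂ p = ⊥-elim (absurd (*-self ⊞ ≤-diff w≤ ⊞ ≤-diff missing≤ ⊞ 0≤boundary ⊞ 0≤+ {2} ⊠ ≤-diff big ⊞ 0≤+ {399222} ⊠ 0≤t)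
        (trans (eq₀ ℓ d w t missing boundary) (trans (cong (λ x → x - (d * d + w) - + 1) count) (eq₁ (d * d + w)))))
    where
    *-self : + 0 ≤ ℓ * ℓ - (d + + 1) * (d + + 1)
    *-self = ≤-diff (*-mono (0≤d ⊞ 0≤+ {1}) (0≤d ⊞ 0≤+ {1}) p p)
    eq₀ = solve 6 (λ ℓ d w t m b → (ℓ :* ℓ :- (d :+ ♯ 1) :* (d :+ ♯ 1)) :+ (♯ 10 :* t :- w) :+ (♯ 768 :* t :- m) :+ b :+ ♯ 2 :* (d :- ♯ 200000 :* t) :+ ♯ 399222 :* t := (ℓ :* ℓ :- m :+ b) :- (d :* d :+ w) :- ♯ 1) refl
    eq₁ = solve 1 (λ x → x :- x :- ♯ 1 := :- ♯ 1) refl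
  ... | inj₁ p with ≤-total d ℓ
  ... | inj₁ q = ℤₚ.≤-antisym p q
  ... | inj₂ q = ⊥-elim (absurd (*-self ⊞ 0≤missing ⊞ 0≤w ⊞ ≤-diff boundary≤ ⊞ 0≤+ {2} ⊠ ≤-diff Q≤ ⊞ 0≤+ {2} ⊠ ≤-diff big ⊞ (0≤+ {321598} ⊠ 0≤t ⊞ 0≤+ {2} ⊠ ≤-diff 1≤t))
        (trans (eq₀ ℓ d w t missing boundary Q) (trans (cong (λ x → (d * d + w) - x - + 1) count) (eq₁ (d * d + w)))))
    where
    *-self : + 0 ≤ (d - + 1) * (d - + 1) - ℓ * ℓ
    *-self = ≤-diff (*-mono 0≤ℓ 0≤ℓ r r)
      where
      r : ℓ ≤ d - + 1
      r = ≤-by (≤-diff q) (eq d ℓ)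
        where
        eq = solve 2 (λ d l → d :- ♯ 1 :- l := d :- (l :+ ♯ 1)) refl
    eq₀ = solve 7 (λ ℓ d w t m b q → ((d :- ♯ 1) :* (d :- ♯ 1) :- ℓ :* ℓ) :+ m :+ w :+ (♯ 2 :* q :- b) :+ ♯ 2 :* (♯ 39200 :* t :- q) :+ ♯ 2 :* (d :- ♯ 200000 :* t) :+ (♯ 321598 :* t :+ ♯ 2 :* (t :- ♯ 1)) := (d :* d :+ w) :- (ℓ :* ℓ :- m :+ b) :- ♯ 1) refl
    eq₁ = solve 1 (λ x → x :- x :- ♯ 1 := :- ♯ 1) refl

  private
    -- A closed triple within the large vertices is counted through its pair `i`, `j` alone. Any
    -- other triple has a corner of small degree and is counted as a star there; each of the three
    -- positions contributes `Q` in total.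
    triangle-point : ∀ i j k → Bit (l i) → Bit (l j) → Bit (l k) →
      M i k * M k j * M i j ≤ (l i * l j * M i j * l k + s i * (M i j * M i k)) + (s j * (M j i * M j k) + s k * (M k i * M k j))
    triangle-point i j k bi bj bk = ≤-trans (core (M i k) (M k j) (M i j) (l i) (l j) (l k) (bM i k) (bM k j) (bM i j) bi bj bk)
        (≡⇒≤ (cong₂ _+_ refl (cong₂ _+_ (cong₂ _*_ refl (cong₂ _*_ (sM i j) (sM k j))) (cong₂ _*_ refl (cong₂ _*_ (sM i k) refl)))))
      where
      e₁ = solve 5 (λ x y z b c → (♯ 0 :* b :* z :* c :+ (♯ 1 :- ♯ 0) :* (z :* x)) :+ ((♯ 1 :- b) :* (z :* y) :+ (♯ 1 :- c) :* (x :* y)) :- x :* y :* z := z :* x :* (♯ 1 :- y) :+ ((♯ 1 :- b) :* (z :* y) :+ (♯ 1 :- c) :* (x :* y))) refl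
      e₂ = solve 4 (λ x y z c → (♯ 1 :* ♯ 0 :* z :* c :+ (♯ 1 :- ♯ 1) :* (z :* x)) :+ ((♯ 1 :- ♯ 0) :* (z :* y) :+ (♯ 1 :- c) :* (x :* y)) :- x :* y :* z := z :* y :* (♯ 1 :- x) :+ (♯ 1 :- c) :* (x :* y)) refl
      e₃ = solve 3 (λ x y z → (♯ 1 :* ♯ 1 :* z :* ♯ 0 :+ (♯ 1 :- ♯ 1) :* (z :* x)) :+ ((♯ 1 :- ♯ 1) :* (z :* y) :+ (♯ 1 :- ♯ 0) :* (x :* y)) :- x :* y :* z := x :* y :* (♯ 1 :- z)) refl
      e₄ = solve 3 (λ x y z → (♯ 1 :* ♯ 1 :* z :* ♯ 1 :+ (♯ 1 :- ♯ 1) :* (z :* x)) :+ ((♯ 1 :- ♯ 1) :* (z :* y) :+ (♯ 1 :- ♯ 1) :* (x :* y)) :- x :* y :* z := z :* (♯ 1 :- x) :+ z :* x :* (♯ 1 :- y)) refl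
      core : ∀ x y z a b c → Bit x → Bit y → Bit z → Bit a → Bit b → Bit c →
        x * y * z ≤ (a * b * z * c + (+ 1 - a) * (z * x)) + ((+ 1 - b) * (z * y) + (+ 1 - c) * (x * y))
      core x y z a b c bx by bz (inj₁ refl) bb bc = ≤-by (bit-≥0 bz ⊠ bit-≥0 bx ⊠ bit-≤1 by ⊞ (bit-≤1 bb ⊠ (bit-≥0 bz ⊠ bit-≥0 by) ⊞ bit-≤1 bc ⊠ (bit-≥0 bx ⊠ bit-≥0 by))) (e₁ x y z b c)
      core x y z a b c bx by bz (inj₂ refl) (inj₁ refl) bc = ≤-by (bit-≥0 bz ⊠ bit-≥0 by ⊠ bit-≤1 bx ⊞ bit-≤1 bc ⊠ (bit-≥0 bx ⊠ bit-≥0 by)) (e₂ x y z c)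
      core x y z a b c bx by bz (inj₂ refl) (inj₂ refl) (inj₁ refl) = ≤-by (bit-≥0 bx ⊠ bit-≥0 by ⊠ bit-≤1 bz) (e₃ x y z)
      core x y z a b c bx by bz (inj₂ refl) (inj₂ refl) (inj₂ refl) = ≤-by (bit-≥0 bz ⊠ bit-≤1 bx ⊞ bit-≥0 bz ⊠ bit-≥0 bx ⊠ bit-≤1 by) (e₄ x y z)

    star : sum (λ i → sum₂ (λ j k → s i * (M i j * M i k))) ≡ Q
    star = sum-cong (λ i → trans (sum₂-*ˡ (s i) _) (cong₂ _*_ refl (sum₂-product (M i) (M i))))

    triangles : ⟨ M · M , M ⟩ ≤ ℓ * (ℓ * ℓ - missing) + + 3 * Q
    triangles = ≤-trans (≡⇒≤ (sum₂-cong (λ i j → sym (sum-*ʳ (M i j) _))))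
      (≤-trans (sum-mono (λ i → sum₂-mono (λ j k → triangle-point i j k (l-bit i) (l-bit j) (l-bit k)))) (≡⇒≤ (begin
        sum (λ i → sum₂ (λ j k → (l i * l j * M i j * l k + s i * (M i j * M i k)) + (s j * (M j i * M j k) + s k * (M k i * M k j))))
          ≡⟨ trans (sum₃-+ _ _) (cong₂ _+_ (sum₃-+ _ _) (sum₃-+ _ _)) ⟩
        (sum (λ i → sum₂ (λ j k → l i * l j * M i j * l k)) + sum (λ i → sum₂ (λ j k → s i * (M i j * M i k)))) +
        (sum (λ i → sum₂ (λ j k → s j * (M j i * M j k))) + sum (λ i → sum₂ (λ j k → s k * (M k i * M k j))))
          ≡⟨ cong₂ _+_ (cong₂ _+_ (trans (sum-cong (λ i → trans (sum-cong (λ j → sum-*ˡ _ l)) (sum-*ʳ ℓ _))) (trans (sum-*ʳ ℓ _) (cong₂ _*_ inside refl))) star)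
               (cong₂ _+_ (trans (sum-comm _) star) (trans (sum-cong (λ i → sum-comm _)) (trans (sum-comm _) star))) ⟩
        ((ℓ * ℓ - missing) * ℓ + Q) + (Q + Q)
          ≡⟨ eq ℓ (ℓ * ℓ - missing) Q ⟩
        ℓ * (ℓ * ℓ - missing) + + 3 * Q ∎)))
      where
      open ≡-Reasoning
      sum₃-+ : ∀ (f g : Fin n → Fin n → Fin n → ℤ) → sum (λ i → sum₂ (λ j k → f i j k + g i j k)) ≡ sum (λ i → sum₂ (f i)) + sum (λ i → sum₂ (g i))
      sum₃-+ f g = trans (sum-cong (λ i → sum₂-+ (f i) (g i))) (sum-+ _ _)
      eq = solve 3 (λ l x q → (x :* l :+ q) :+ (q :+ q) := l :* x :+ ♯ 3 :* q) refl

    -- Every missing pair lowers the bound on the third moment by `d`, while the stars add at most 3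
    -- Q ≤ 117600 t. This is the most demanding use of 200000 t ≤ d.
    missing≡0 : missing ≡ + 0
    missing≡0 with ≤-total missing (+ 0)
    ... | inj₁ p = ℤₚ.≤-antisym p 0≤missing
    ... | inj₂ p = ⊥-elim (absurd (≤-diff m₃ ⊞ (≤-diff (subst (λ x → ⟨ M · M , M ⟩ ≤ x * (x * x - missing) + + 3 * Q) l-sum triangles) ⊞ 0≤d ⊠ ≤-diff p ⊞ 0≤+ {3} ⊠ ≤-diff Q≤ ⊞ ≤-diff big ⊞ (0≤+ {82399} ⊠ 0≤t ⊞ ≤-diff 1≤t)))
        (eq d _ missing Q t))
      where
      eq = solve 5 (λ d x m q t → (x :- d :* d :* d) :+ ((d :* (d :* d :- m) :+ ♯ 3 :* q :- x) :+ d :* (m :- (♯ 0 :+ ♯ 1)) :+ ♯ 3 :* (♯ 39200 :* t :- q) :+ (d :- ♯ 200000 :* t) :+ (♯ 82399 :* t :+ (t :- ♯ 1))) := :- ♯ 1) refl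

  l-idem : ∀ i → l i * l i ≡ l i
  l-idem i = bit-idem (l-bit i)

  full : ∀ i j → l i * (l j * M i j) ≡ l i * l j
  full i j = trans (eq (l i) (l j) (M i j)) (trans (cong₂ _-_ refl (nonneg-sum-zero (n-missing i) (nonneg-sum-zero (λ i → sum-≥0 (n-missing i)) missing≡0 i) j)) (eq₀ (l i * l j)))
    where
    eq = solve 3 (λ x y m → x :* (y :* m) := x :* y :- x :* y :* (♯ 1 :- m)) refl
    eq₀ = solve 1 (λ x → x :- ♯ 0 := x) refl

  open Block M sM l l-idem d l-sum full using (rest; out; P; l-rest-l)

  rest-bit : ∀ i j → Bit (rest i j)
  rest-bit i j with l-bit i | l-bit j
  ... | inj₁ e | _ = subst Bit (trans (eq (M i j) (l j)) (cong (λ x → M i j - x * l j) (sym e))) (bM i j)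
    where
    eq = solve 2 (λ m y → m := m :- ♯ 0 :* y) refl
  ... | inj₂ _ | inj₁ e = subst Bit (trans (eq (M i j) (l i)) (cong (λ x → M i j - l i * x) (sym e))) (bM i j)
    where
    eq = solve 2 (λ m y → m := m :- y :* ♯ 0) refl
  ... | inj₂ e | inj₂ e′ = inj₁ (trans (sym (trans (cong₂ (λ x y → x * (rest i j * y)) e e′) (eq _))) (l-rest-l i j))
    where
    eq = solve 1 (λ m → ♯ 1 :* (m :* ♯ 1) := m) refl

  -- If `P` were 2 or more, the fourth moment would exceed its bound: it would gain a further 4 d,
  -- against a margin of 52 + 25 w.
  P≤1 : P ≤ + 1
  P≤1 with ≤-total P (+ 1)
  ... | inj₁ p = p
  ... | inj₂ p = ⊥-elim (absurd (0≤+ {4} ⊠ 0≤d ⊠ ≤-diff p ⊞ ≤-diff (≤-trans (BlockBounds.fourth-lower M sM l l-idem d l-sum full 0≤d (λ i j → bit-≥0 (rest-bit i j)) (λ i → sum-≥0 (λ j → bit-≥0 (rest-bit i j) ⊠ nl j))) m₄)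
        ⊞ 0≤+ {25} ⊠ ≤-diff w≤ ⊞ 0≤+ {4} ⊠ ≤-diff big ⊞ (0≤+ {799697} ⊠ 0≤t ⊞ 0≤+ {53} ⊠ ≤-diff 1≤t)) (eq d P w t))
    where
    eq = solve 4 (λ d p w t → ♯ 4 :* d :* (p :- (♯ 1 :+ ♯ 1)) :+ (d :* d :* (d :* d) :+ (♯ 4 :* d :+ (♯ 52 :+ ♯ 25 :* w)) :- (d :* d :* (d :* d) :+ ♯ 4 :* d :* p)) :+ ♯ 25 :* (♯ 10 :* t :- w) :+ ♯ 4 :* (d :- ♯ 200000 :* t) :+ (♯ 799697 :* t :+ ♯ 53 :* (t :- ♯ 1)) := :- ♯ 1) refl

-- Walks in a clique with one exit vertex

pow-nonneg : ∀ {n} {a : Matrix n} → (∀ i j → + 0 ≤ a i j) → ∀ k i j → + 0 ≤ pow a k i j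
pow-nonneg na zero i j = δ≥0 i j
  where
  δ≥0 : ∀ {n} (i j : Fin n) → + 0 ≤ δ i j
  δ≥0 i j with i ≟ j
  ... | yes _ = 0≤+
  ... | no _ = ≤-refl
pow-nonneg na (suc k) i j = sum-≥0 (λ l → na i l ⊠ pow-nonneg na k l j)

module RowBound {n} (a : Matrix n) (na : ∀ i j → + 0 ≤ a i j) (b : ℤ) (0≤b : + 0 ≤ b) (rows : ∀ i → sum (a i) ≤ b) where

  pow-rows : ∀ k i → sum (pow a k i) ≤ powers b k
  pow-rows zero i = ≡⇒≤ (trans (sum-cong (λ j → sym (R.*-identityʳ _))) (sum-δˡ i (λ _ → + 1)))
  pow-rows (suc k) i = ≤-trans (≡⇒≤ (trans (sum-comm _) (sum-cong (λ l → sum-*ˡ (a i l) _))))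
    (≤-trans (sum-mono (λ l → *-monoˡ (na i l) (pow-rows k l))) (≤-trans (≡⇒≤ (sum-*ʳ (powers b k) _))
      (≤-cong (R.*-comm _ _) (R.*-comm _ _) (*-monoˡ (powers-nonneg 0≤b k) (rows i)))))

  -- Weighting the last step by `s` makes the trace of the power `k + 1` at most the sum of `s`
  -- times b^k. For the indicator of the outer vertices this is b^(k + 1), without a factor `n`.
  pow-closed : ∀ (s : Fin n → ℤ) → (∀ i j → a i j ≤ s j) → (∀ j → + 0 ≤ s j) → ∀ k i → pow a (suc k) i i ≤ s i * powers b k
  pow-closed s as ns k i = ≤-trans (≡⇒≤ (pow-sucʳ a k i i)) (≤-trans (sum-mono (λ l → *-monoˡ (pow-nonneg na k i l) (as l i)))
    (≤-trans (≡⇒≤ (trans (sum-*ʳ (s i) _) (R.*-comm _ _))) (*-monoˡ (ns i) (pow-rows k i))))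

-- The mixed products vanish. The exponent starts at 1, because the zeroth powers would give the
-- identity twice.
pow-direct-sum : ∀ {n} (c κ o : Matrix n) → (∀ i j → c i j ≡ κ i j + o i j) → (∀ i j k → κ i j * o j k ≡ + 0) → (∀ i j k → o i j * κ j k ≡ + 0) →
  ∀ k i j → pow c (suc k) i j ≡ pow κ (suc k) i j + pow o (suc k) i j
pow-direct-sum c κ o e κo oκ zero i j = trans (sum-cong (λ l → trans (cong₂ _*_ (e i l) refl) (R.distribʳ _ _ _))) (sum-+ _ _)
pow-direct-sum c κ o e κo oκ (suc k) i j = trans (sum-cong (λ l → trans (cong₂ _*_ (e i l) (pow-direct-sum c κ o e κo oκ k l j)) (eq (κ i l) (o i l) _ _)))
    (trans (sum-+ _ _) (cong₂ _+_ (trans (sum-+ _ _) (trans (cong₂ _+_ refl (sum-0 (vanish κ o κo))) (R.+-identityʳ _))) (trans (sum-+ _ _) (trans (cong₂ _+_ (sum-0 (vanish o κ oκ)) refl) (R.+-identityˡ _)))))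
  where
  eq = solve 4 (λ a b x y → (a :+ b) :* (x :+ y) := (a :* x :+ a :* y) :+ (b :* x :+ b :* y)) refl
  vanish : ∀ κ o → (∀ i j k → κ i j * o j k ≡ + 0) → ∀ l → κ i l * pow o (suc k) l j ≡ + 0
  vanish κ o z l = trans (sym (sum-*ˡ (κ i l) _)) (sum-0 (λ m → trans (sym (R.*-assoc _ _ _)) (trans (cong₂ _*_ (z i l m) refl) (R.zeroˡ _))))

-- A graph consisting of a clique l, the rest, and edges from the single clique vertex v to the rest
record Split {n} (a : Matrix n) (d : ℤ) : Set where
  no-eta-equality
  field
    a-sym : Symmetric a
    a-bit : ∀ i j → Bit (a i j)
    a-diag : ∀ i → a i i ≡ + 0
    l : Fin n → ℤ
    l-bit : ∀ i → Bit (l i)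
    l-sum : sum l ≡ d
    l-full : ∀ i j → l i * (l j * loops a i j) ≡ l i * l j
    v : Fin n
    l-v : l v ≡ + 1
    ρ : Fin n → ℤ
    ρ-nonneg : ∀ j → + 0 ≤ ρ j
    -- All edges leaving `l` start at `v`. A zero `ρ` is allowed and covers a clique that no edge
    -- leaves.
    cross : ∀ i j → l i * (a i j * (+ 1 - l j)) ≡ δ v i * ρ j

  s : Fin n → ℤ
  s i = + 1 - l i

  ns : ∀ i → + 0 ≤ s i
  ns i = bit-≤1 (l-bit i)

  outer : Matrix n
  outer i j = s i * (s j * a i j)

  outer-nonneg : ∀ i j → + 0 ≤ outer i j
  outer-nonneg i j = ns i ⊠ (ns j ⊠ bit-≥0 (a-bit i j))

  outer-sym : Symmetric outer
  outer-sym i j = trans (eq (s i) (s j) (a i j)) (cong (λ x → s j * (s i * x)) (a-sym i j))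
    where
    eq = solve 3 (λ a b c → a :* (b :* c) := b :* (a :* c)) refl

  outer-diag : ∀ i → outer i i ≡ + 0
  outer-diag i = trans (cong (λ x → s i * (s i * x)) (a-diag i)) (eq (s i))
    where
    eq = solve 1 (λ a → a :* (a :* ♯ 0) := ♯ 0) refl

  s-outer : ∀ i j → l i ≡ + 1 → outer i j ≡ + 0
  s-outer i j e = trans (cong (λ x → (+ 1 - x) * (s j * a i j)) e) (eq _)
    where
    eq = solve 1 (λ a → (♯ 1 :- ♯ 1) :* a := ♯ 0) refl

  outer≤s : ∀ i j → outer i j ≤ s j
  outer≤s i j = go (l-bit i) (a-bit i j)
    where
    e₀ = solve 2 (λ s a → (♯ 1 :- ♯ 1) :* (s :* a) := ♯ 0) refl
    e₁ = solve 1 (λ s → (♯ 1 :- ♯ 0) :* (s :* ♯ 0) := ♯ 0) refl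
    e₂ = solve 1 (λ s → (♯ 1 :- ♯ 0) :* (s :* ♯ 1) := s) refl
    go : Bit (l i) → Bit (a i j) → outer i j ≤ s j
    go (inj₂ e) _ = ≤-trans (≡⇒≤ (trans (cong (λ x → (+ 1 - x) * (s j * a i j)) e) (e₀ (s j) (a i j)))) (ns j)
    go (inj₁ e) (inj₁ f) = ≤-trans (≡⇒≤ (trans (cong₂ (λ x y → (+ 1 - x) * (s j * y)) e f) (e₁ (s j)))) (ns j)
    go (inj₁ e) (inj₂ f) = ≡⇒≤ (trans (cong₂ (λ x y → (+ 1 - x) * (s j * y)) e f) (e₂ (s j)))

  l′ : Fin n → ℤ
  l′ i = l i - δ v i

  private
    l′-v : l′ v ≡ + 0
    l′-v = trans (cong₂ _-_ l-v (δ-refl v)) (R.-‿inverseʳ (+ 1))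

    l′-other : ∀ {i} → ¬ (v ≡ i) → l′ i ≡ l i
    l′-other {i} p = trans (cong (λ x → l i - x) (δ-≢ p)) (eq (l i))
      where
      eq = solve 1 (λ x → x :- ♯ 0 := x) refl

    l′-idem : ∀ i → l′ i * l′ i ≡ l′ i
    l′-idem i with δ-split v i
    ... | inj₁ (refl , _) = trans (cong₂ _*_ l′-v refl) (trans (R.zeroˡ _) (sym l′-v))
    ... | inj₂ (p , _) = trans (cong₂ _*_ (l′-other p) (l′-other p)) (trans (bit-idem (l-bit i)) (sym (l′-other p)))

    l′-sum : sum l′ ≡ d - + 1
    l′-sum = trans (sum-+ _ _) (cong₂ _+_ l-sum (trans (sum-neg _) (cong -_ (trans (sum-cong (λ j → sym (R.*-identityʳ _))) (sum-δˡ v (λ _ → + 1))))))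

    l′-s : ∀ i → l′ i * s i ≡ + 0
    l′-s i with δ-split v i
    ... | inj₁ (refl , _) = trans (cong₂ _*_ l′-v refl) (R.zeroˡ _)
    ... | inj₂ (p , _) = trans (cong₂ _*_ (l′-other p) refl) (trans (eq (l i)) (trans (cong₂ _-_ refl (bit-idem (l-bit i))) (R.-‿inverseʳ _)))
      where
      eq = solve 1 (λ x → x :* (♯ 1 :- x) := x :- x :* x) refl

  row-v : ∀ j → a v j ≡ l′ j + ρ j
  row-v j = trans (eq (a v j) (l j) (δ v j)) (cong₂ _+_ (trans (cong₂ _-_ full-v δl) refl) cross-v)
    where
    eq = solve 3 (λ a l d → a := (l :* (a :+ d) :- l :* d) :+ a :* (♯ 1 :- l)) refl
    full-v : l j * loops a v j ≡ l j
    full-v = trans (sym (R.*-identityˡ _)) (trans (cong₂ _*_ (sym l-v) refl) (trans (l-full v j) (trans (cong₂ _*_ l-v refl) (R.*-identityˡ _))))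
    δl : l j * δ v j ≡ δ v j
    δl with δ-split v j
    ... | inj₁ (refl , e) = trans (cong₂ _*_ l-v refl) (R.*-identityˡ _)
    ... | inj₂ (_ , e) = trans (cong₂ _*_ refl e) (trans (R.zeroʳ _) (sym e))
    cross-v : a v j * (+ 1 - l j) ≡ ρ j
    cross-v = trans (sym (R.*-identityˡ _)) (trans (cong₂ _*_ (sym l-v) refl) (trans (cross v j) (trans (cong₂ _*_ (δ-refl v) refl) (R.*-identityˡ _))))

  private
    -- The adjacency matrix of the clique without `v`; the indicator `l′` is an eigenvector for the
    -- eigenvalue `d - 2`.
    κ : Matrix n
    κ i j = l′ i * l′ j - l′ i * δ i j

    split-del : ∀ i j → del v a i j ≡ κ i j + outer i j
    split-del i j with δ-split v i | δ-split v j
    ... | inj₁ (refl , _) | _ = trans (del-row v a j) (sym (trans (cong₂ _+_ (cong (λ x → x * l′ j - x * δ v j) l′-v) (s-outer v j l-v)) (eq _ _)))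
      where
      eq = solve 2 (λ x y → ♯ 0 :* x :- ♯ 0 :* y :+ ♯ 0 := ♯ 0) refl
    ... | inj₂ (p , _) | inj₁ (refl , _) = trans (del-col v a i) (sym (trans (cong₂ _+_ (cong₂ (λ x y → l′ i * x - l′ i * y) l′-v (δ-≢ (λ e → p (sym e)))) (trans (outer-sym i v) (s-outer v i l-v))) (eq _)))
      where
      eq = solve 1 (λ x → x :* ♯ 0 :- x :* ♯ 0 :+ ♯ 0 := ♯ 0) refl
    ... | inj₂ (p , δi) | inj₂ (q , δj) = trans (del-other a p q) (trans (eq (l i) (l j) (a i j) (δ i j))
          (trans (cong₂ (λ x y → x + y + outer i j) (trans (cong₂ _-_ (l-full i j) lδ) (sym (cong₂ (λ x y → x * y - x * δ i j) (l′-other p) (l′-other q))))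
            (cong₂ _+_ (trans (cross i j) (trans (cong₂ _*_ δi refl) (R.zeroˡ _))) (trans (cong (λ x → l j * (x * s i)) (a-sym i j)) (trans (cross j i) (trans (cong₂ _*_ δj refl) (R.zeroˡ _)))))) (eq₀ _ _)))
      where
      eq = solve 4 (λ x y a d → a := (x :* (y :* (a :+ d)) :- x :* (y :* d)) :+ (x :* (a :* (♯ 1 :- y)) :+ y :* (a :* (♯ 1 :- x))) :+ (♯ 1 :- x) :* ((♯ 1 :- y) :* a)) refl
      eq₀ = solve 2 (λ x y → x :+ (♯ 0 :+ ♯ 0) :+ y := x :+ y) refl
      lδ : l i * (l j * δ i j) ≡ l i * δ i j
      lδ with δ-split i j
      ... | inj₁ (refl , e) = trans (sym (R.*-assoc _ _ _)) (cong₂ _*_ (bit-idem (l-bit i)) refl)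
      ... | inj₂ (_ , e) = cong₂ _*_ refl (trans (cong₂ _*_ refl e) (trans (R.zeroʳ _) (sym e)))

    κ-outer : ∀ i j k → κ i j * outer j k ≡ + 0
    κ-outer i j k with δ-split i j
    ... | inj₁ (refl , e) = trans (cong (λ x → (l′ i * l′ i - l′ i * x) * outer i k) e) (trans (cong (λ x → (x - l′ i * + 1) * outer i k) (l′-idem i)) (eq (l′ i) _))
      where
      eq = solve 2 (λ x y → (x :- x :* ♯ 1) :* y := ♯ 0) refl
    ... | inj₂ (_ , e) = trans (cong (λ x → (l′ i * l′ j - l′ i * x) * outer j k) e) (trans (eq (l′ i) (l′ j) (s j) _) (trans (cong (λ x → l′ i * x * (s k * a j k)) (l′-s j)) (eq₀ _ _)))
      where
      eq = solve 4 (λ x y s z → (x :* y :- x :* ♯ 0) :* (s :* z) := x :* (y :* s) :* z) refl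
      eq₀ = solve 2 (λ x y → x :* ♯ 0 :* y := ♯ 0) refl

    outer-κ : ∀ i j k → outer i j * κ j k ≡ + 0
    outer-κ i j k = trans (eq (s i) (s j) (a i j) (l′ j) (l′ k) (δ j k)) (trans (cong (λ x → x * (s i * (a i j * (l′ k - δ j k)))) (l′-s j)) (R.zeroˡ _))
      where
      eq = solve 6 (λ s t a x y d → s :* (t :* a) :* (x :* y :- x :* d) := x :* t :* (s :* (a :* (y :- d)))) refl

    pow-del : ∀ k i j → pow (del v a) (suc k) i j ≡ pow κ (suc k) i j + pow outer (suc k) i j
    pow-del = pow-direct-sum (del v a) κ outer split-del κ-outer outer-κ

    κ-l′ : ∀ i → sum (λ j → κ i j * l′ j) ≡ (d - + 2) * l′ i
    κ-l′ i = trans (sum-cong (λ j → trans (eq (l′ i) (l′ j) (δ i j)) (cong₂ _-_ (cong (λ x → l′ i * x) (l′-idem j)) refl)))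
      (trans (sum-+ _ _) (trans (cong₂ _+_ (trans (sum-*ˡ (l′ i) _) (cong₂ _*_ refl l′-sum)) (trans (sum-neg _) (cong -_ (trans (sum-*ˡ (l′ i) _) (cong₂ _*_ refl (sum-δˡ i l′))))))
        (trans (cong (λ x → l′ i * (d - + 1) + - x) (l′-idem i)) (eq₂ d (l′ i)))))
      where
      eq = solve 3 (λ x y e → (x :* y :- x :* e) :* y := x :* (y :* y) :- x :* (e :* y)) refl
      eq₂ = solve 2 (λ d x → x :* (d :- ♯ 1) :+ :- x := (d :- ♯ 2) :* x) refl

    pow-κ-l′ : ∀ k i → sum (λ j → pow κ k i j * l′ j) ≡ powers (d - + 2) k * l′ i
    pow-κ-l′ zero i = trans (sum-δˡ i l′) (sym (R.*-identityˡ _))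
    pow-κ-l′ (suc k) i = trans (sum-cong (λ j → trans (sym (sum-*ʳ (l′ j) _)) (sum-cong (λ m → R.*-assoc _ _ _)))) (trans (sum-comm _)
      (trans (sum-cong (λ m → trans (sum-*ˡ (κ i m) _) (trans (cong₂ _*_ refl (pow-κ-l′ k m)) (eq (κ i m) (powers (d - + 2) k) (l′ m))))) (trans (sum-*ˡ _ _) (trans (cong₂ _*_ refl (κ-l′ i)) (eq′ _ _ _)))))
      where
      eq = solve 3 (λ a b c → a :* (b :* c) := b :* (a :* c)) refl
      eq′ = solve 3 (λ a b c → a :* (b :* c) := b :* a :* c) refl

    ρ-s : ∀ j → l′ j * ρ j ≡ + 0
    ρ-s j = trans (cong₂ _*_ refl ρ≡) (trans (eq (l′ j) (a v j) (s j)) (trans (cong₂ _*_ (l′-s j) refl) (R.zeroˡ _)))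
      where
      eq = solve 3 (λ x a s → x :* (a :* s) := x :* s :* a) refl
      ρ≡ : ρ j ≡ a v j * s j
      ρ≡ = sym (trans (sym (R.*-identityˡ _)) (trans (cong₂ _*_ (sym l-v) refl) (trans (cross v j) (trans (cong₂ _*_ (δ-refl v) refl) (R.*-identityˡ _)))))

    pow-κ-ρ : ∀ k i → sum (λ j → pow κ (suc k) i j * ρ j) ≡ + 0
    pow-κ-ρ k i = sum-0 (λ j → trans (cong₂ _*_ (pow-sucʳ κ k i j) refl) (trans (sym (sum-*ʳ (ρ j) _)) (sum-0 (λ m → trans (R.*-assoc _ _ _) (trans (cong₂ _*_ refl (κρ m j)) (R.zeroʳ _))))))
      where
      κρ : ∀ m j → κ m j * ρ j ≡ + 0
      κρ m j with δ-split m j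
      ... | inj₁ (refl , e) = trans (cong (λ x → (l′ m * l′ m - l′ m * x) * ρ m) e) (trans (eq (l′ m) (ρ m)) (trans (cong (λ x → l′ m * x - x) (ρ-s m)) eq₀))
        where
        eq = solve 2 (λ x r → (x :* x :- x :* ♯ 1) :* r := x :* (x :* r) :- x :* r) refl
        eq₀ : ∀ {x} → x * + 0 - + 0 ≡ + 0
        eq₀ {x} = solve 1 (λ x → x :* ♯ 0 :- ♯ 0 := ♯ 0) refl x
      ... | inj₂ (_ , e) = trans (cong (λ x → (l′ m * l′ j - l′ m * x) * ρ j) e) (trans (eq (l′ m) (l′ j) (ρ j)) (trans (cong₂ _*_ refl (ρ-s j)) (R.zeroʳ _)))
        where
        eq = solve 3 (λ x y r → (x :* y :- x :* ♯ 0) :* r := x :* (y :* r)) refl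

    pow-outer-l′ : ∀ k i → sum (λ j → pow outer (suc k) i j * l′ j) ≡ + 0
    pow-outer-l′ k i = sum-0 (λ j → trans (cong₂ _*_ (pow-sucʳ outer k i j) refl) (trans (sym (sum-*ʳ (l′ j) _)) (sum-0 (λ m → trans (R.*-assoc _ _ _) (trans (cong₂ _*_ refl (ol m j)) (R.zeroʳ _))))))
      where
      ol : ∀ m j → outer m j * l′ j ≡ + 0
      ol m j = trans (eq (s m) (s j) (a m j) (l′ j)) (trans (cong₂ _*_ (l′-s j) refl) (R.zeroˡ _))
        where
        eq = solve 4 (λ s t a x → s :* (t :* a) :* x := x :* t :* (s :* a)) refl

  J : Series
  J k = sum (λ i → ρ i * sum (λ j → pow outer k i j * ρ j))

  private module Rm = Remove a a-sym v (a-diag v)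

  open Rm public using (closed; trace-removal)

  closed-nonneg : NonNeg closed
  closed-nonneg k = pow-nonneg (λ i j → bit-≥0 (a-bit i j)) k v v

  J-nonneg : NonNeg J
  J-nonneg k = sum-≥0 (λ i → ρ-nonneg i ⊠ sum-≥0 (λ j → pow-nonneg outer-nonneg k i j ⊠ ρ-nonneg j))

  private
    α : Fin n → ℤ
    α j = l′ j + ρ j

    -- Between two visits to `v` a walk stays in the remaining clique or in the outer part, as there
    -- is no edge between them. The eigenvector `l′` makes the first contribution geometric.
    returns-eq : Rm.returns ≈ (λ k → (d - + 1) * powers (d - + 2) k) ⊕s J
    returns-eq k = trans (sum-cong (λ i → cong₂ _*_ (row-v i) (trans (sum-cong (λ j → cong₂ _*_ refl (row-v j))) (apply k i)))) (trans (sum-cong (λ i → eq (l′ i) (ρ i) (powers (d - + 2) k) _))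
        (trans (sum-+ _ _) (cong₂ _+_ (trans (sum-*ʳ _ _) (cong₂ _*_ (trans (sum-cong l′-idem) l′-sum) refl)) (trans (sum-+ _ _) (trans (cong₂ _+_ refl (sum-0 (λ i → rest-zero k i))) (R.+-identityʳ _))))))
      where
      apply : ∀ k i → sum (λ j → pow (del v a) k i j * α j) ≡ powers (d - + 2) k * l′ i + sum (λ j → pow outer k i j * ρ j)
      apply zero i = trans (sum-δˡ i α) (cong₂ _+_ (sym (R.*-identityˡ _)) (sym (sum-δˡ i ρ)))
      apply (suc k) i = trans (sum-cong (λ j → trans (cong₂ _*_ (pow-del k i j) refl) (eq′ _ _ (l′ j) (ρ j)))) (trans (sum-+ _ _) (cong₂ _+_ (trans (sum-+ _ _) (trans (cong₂ _+_ (pow-κ-l′ (suc k) i) (pow-κ-ρ k i)) (R.+-identityʳ _)))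
          (trans (sum-+ _ _) (trans (cong₂ _+_ (pow-outer-l′ k i) refl) (R.+-identityˡ _)))))
        where
        eq′ = solve 4 (λ x y l r → (x :+ y) :* (l :+ r) := (x :* l :+ x :* r) :+ (y :* l :+ y :* r)) refl
      eq = solve 4 (λ l r p x → (l :+ r) :* (p :* l :+ x) := l :* l :* p :+ (r :* x :+ (l :* x :+ l :* r :* p))) refl
      rest-zero : ∀ k i → l′ i * sum (λ j → pow outer k i j * ρ j) + l′ i * ρ i * powers (d - + 2) k ≡ + 0
      rest-zero k i = trans (cong₂ _+_ (first k) (trans (cong₂ _*_ (ρ-s i) refl) (R.zeroˡ _))) (R.+-identityʳ _)
        where
        first : ∀ k → l′ i * sum (λ j → pow outer k i j * ρ j) ≡ + 0
        first zero = trans (cong₂ _*_ refl (sum-δˡ i ρ)) (ρ-s i)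
        first (suc k) = trans (sym (sum-*ˡ (l′ i) _)) (sum-0 (λ j → trans (eq₀ (l′ i) _ (ρ j)) (trans (cong₂ _*_ refl (trans (sym (sum-*ˡ (l′ i) _)) (sum-0 (λ m → lo m j)))) (R.zeroʳ _))))
          where
          eq₀ = solve 3 (λ l x r → l :* (x :* r) := r :* (l :* x)) refl
          eq₁ = solve 4 (λ l s y x → l :* (s :* y :* x) := l :* s :* (y :* x)) refl
          lo : ∀ m j → l′ i * (outer i m * pow outer k m j) ≡ + 0
          lo m j = trans (eq₁ (l′ i) (s i) _ _) (trans (cong₂ _*_ (l′-s i) refl) (R.zeroˡ _))

  closed-eq : closed ≈ const (+ 1) ⊕s z⊛ (z⊛ (((λ k → (d - + 1) * powers (d - + 2) k) ⊕s J) ⊛ closed))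
  closed-eq zero = Rm.closed-renewal 0
  closed-eq (suc zero) = Rm.closed-renewal 1
  closed-eq (suc (suc k)) = trans (Rm.closed-renewal (suc (suc k))) (cong₂ _+_ refl (⊛-cong {g = closed} returns-eq (λ _ → refl) k))

  private
    -- For k ≥ 1, the coefficient of l′ l′ᵀ in the power `k` of `κ`; the rest of that power is
    -- (-1)^k on the diagonal of the clique.
    clique-coeff : Series
    clique-coeff zero = + 0
    clique-coeff (suc k) = (d - + 2) * clique-coeff k + powers (- + 1) k

    pow-κ : ∀ k i j → pow κ (suc k) i j ≡ l′ i * l′ j * clique-coeff (suc k) + powers (- + 1) (suc k) * (l′ i * δ i j)
    pow-κ zero i j = trans (sum-δʳ j (κ i)) (eq (l′ i) (l′ j) (δ i j) d)
      where
      eq = solve 4 (λ x y e d → x :* y :- x :* e := x :* y :* ((d :- ♯ 2) :* ♯ 0 :+ ♯ 1) :+ :- ♯ 1 :* ♯ 1 :* (x :* e)) refl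
    pow-κ (suc k) i j = trans (sum-cong (λ m → trans (cong₂ _*_ refl (trans (pow-κ k m j) (cong (λ x → l′ m * l′ j * X + powers (- + 1) (suc k) * x) (R.*-comm (l′ m) (δ m j))))) (eq (κ i m) (l′ m) (l′ j) X S (δ m j))))
        (trans (sum-+ _ _) (trans (cong₂ _+_ (trans (sum-*ˡ _ _) (cong₂ _*_ refl (κ-l′ i))) (trans (sum-*ˡ S _) (cong₂ _*_ refl (trans (sum-δʳ j (λ m → κ i m * l′ m)) (trans (eq₁ (l′ i) (l′ j) (δ i j)) (cong (λ x → l′ i * x - l′ i * δ i j * l′ j) (l′-idem j)))))))
          (trans (eq₂ (l′ i) (l′ j) X S d (l′ i * δ i j * l′ j)) (cong (λ x → l′ i * l′ j * ((d - + 2) * X + S) + - + 1 * S * x) δl′))))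
      where
      X S : ℤ
      X = clique-coeff (suc k)
      S = powers (- + 1) (suc k)
      eq = solve 6 (λ c x y X S e → c :* (x :* y :* X :+ S :* (e :* x)) := y :* X :* (c :* x) :+ S :* (c :* x :* e)) refl
      eq₁ = solve 3 (λ x y e → (x :* y :- x :* e) :* y := x :* (y :* y) :- x :* e :* y) refl
      eq₂ = solve 6 (λ x y X S d e → y :* X :* ((d :- ♯ 2) :* x) :+ S :* (x :* y :- e) := x :* y :* ((d :- ♯ 2) :* X :+ S) :+ :- ♯ 1 :* S :* e) refl
      δl′ : l′ i * δ i j * l′ j ≡ l′ i * δ i j
      δl′ with δ-split i j
      ... | inj₁ (refl , e) = trans (cong (λ x → l′ i * x * l′ i) e) (trans (cong₂ _*_ (R.*-identityʳ (l′ i)) refl) (trans (l′-idem i) (sym (trans (cong (λ x → l′ i * x) e) (R.*-identityʳ _)))))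
      ... | inj₂ (_ , e) = trans (cong (λ x → l′ i * x * l′ j) e) (trans (eq₀ (l′ i) (l′ j)) (sym (trans (cong (λ x → l′ i * x) e) (R.zeroʳ _))))
        where
        eq₀ = solve 2 (λ x y → x :* ♯ 0 :* y := ♯ 0) refl

  clique-trace : Series
  clique-trace k = (d - + 1) * (clique-coeff (suc k) + powers (- + 1) (suc k))

  -- The clique part depends on `d` alone and cancels when two graphs with the same `d` are
  -- compared.
  trace-del : ∀ k → trace (pow (del v a) (suc k)) ≡ clique-trace k + trace (pow outer (suc k))
  trace-del k = trans (sum-cong (λ i → trans (pow-del k i i) (cong₂ _+_ (trans (pow-κ k i i) (trans (cong₂ (λ x y → x * clique-coeff (suc k) + powers (- + 1) (suc k) * (l′ i * y)) (l′-idem i) (δ-refl i)) (eq (l′ i) _ _))) refl)))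
    (trans (sum-+ _ _) (cong₂ _+_ (trans (sum-*ʳ _ _) (cong₂ _*_ l′-sum refl)) refl))
    where
    eq = solve 3 (λ l x s → l :* x :+ s :* (l :* ♯ 1) := l :* (x :+ s)) refl

module Compare {n} {a a₂ : Matrix n} {d b : ℤ} (A₁ : Split a d) (A₂ : Split a₂ d) (n≡ : + n ≡ d + b) (1≤b : + 1 ≤ b) (big : + 200000 * b ≤ d)
  (tr : ∀ k → trace (pow a k) ≡ trace (pow a₂ k)) where

  private
    module A₁ = Split A₁
    module A₂ = Split A₂

    0≤b : + 0 ≤ b
    0≤b = 1≤⇒0≤ 1≤b

    e₁ = solve 2 (λ b d → (d :- ♯ 2) :- ♯ 2 :* b := (d :- ♯ 200000 :* b) :+ ♯ 199996 :* b :+ ♯ 2 :* (b :- ♯ 1)) refl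
    e₂ = solve 2 (λ b d → (d :- ♯ 1) :- ♯ 2 :* b := (d :- ♯ 200000 :* b) :+ ♯ 199997 :* b :+ ♯ 1 :* (b :- ♯ 1)) refl

  module Gr = Growth (d - + 1) (d - + 2) b 1≤b
    (≤-by (≤-diff big ⊞ 0≤+ {199996} ⊠ 0≤b ⊞ 0≤+ {2} ⊠ ≤-diff 1≤b) (e₁ b d)) (≤-by (≤-diff big ⊞ 0≤+ {199997} ⊠ 0≤b ⊞ 0≤+ {1} ⊠ ≤-diff 1≤b) (e₂ b d))

  compare : ∀ S a Y k₀ → NonNeg S → + 1 ≤ S k₀ → shift a Gr.template ⊑ Y → A₁.J ⊕s negs A₂.J ≈ S ⊛ Y → ⊥
  compare S a₀ Y k₀ nS S₀ Y-bound JY = Gr.growth-contradiction A₁.closed A₂.closed A₁.J A₂.J t₁ t₂ S a₀ Y k₀ A₁.closed-nonneg A₁.J-nonneg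
      A₁.closed-eq A₂.closed-eq A₁.trace-removal A₂.trace-removal refl-0 one bound nS S₀ Y-bound JY
    where
    t₁ t₂ : Series
    t₁ = (λ k → trace (pow a k)) ⊕s negs (λ k → trace (pow (del A₁.v a) k))
    t₂ = (λ k → trace (pow a₂ k)) ⊕s negs (λ k → trace (pow (del A₂.v a₂) k))
    refl-0 : t₁ 0 ≡ t₂ 0
    refl-0 = cong₂ _-_ (tr 0) refl
    diff : ∀ k → t₁ (suc k) - t₂ (suc k) ≡ trace (pow A₂.outer (suc k)) - trace (pow A₁.outer (suc k))
    diff k = trans (cong₂ _-_ (cong₂ _-_ (tr (suc k)) (A₁.trace-del k)) (cong₂ _-_ refl (A₂.trace-del k))) (eq _ _ _ _)
      where
      eq = solve 4 (λ t c x y → (t :- (c :+ x)) :- (t :- (c :+ y)) := y :- x) refl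
    trace-one : ∀ {a : Matrix n} → (∀ i → a i i ≡ + 0) → trace (pow a 1) ≡ + 0
    trace-one {a} z = sum-0 (λ i → trans (pow-one a i i) (z i))
    one : t₁ 1 ≡ t₂ 1
    one = minus-zero (trans (diff 0) (trans (cong₂ _-_ (trace-one A₂.outer-diag) (trace-one A₁.outer-diag)) (R.-‿inverseʳ _)))
    s-sum : sum A₂.s ≡ b
    s-sum = trans (sum-+ _ _) (trans (cong₂ _+_ (sum-1 n) (trans (sum-neg _) (cong -_ A₂.l-sum))) (trans (cong₂ _-_ n≡ refl) (eq d b)))
      where
      eq = solve 2 (λ d b → d :+ b :- d := b) refl
    module RB = RowBound A₂.outer A₂.outer-nonneg b 0≤b (λ i → ≤-trans (sum-mono (A₂.outer≤s i)) (≡⇒≤ s-sum))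
    -- Only an upper bound is required, so the nonnegative traces of `A₁.outer` are dropped and
    -- those of `A₂.outer` are bounded by powers of `b`.
    bound : ∀ k → t₁ (suc (suc k)) - t₂ (suc (suc k)) ≤ powers b (suc (suc k))
    bound k = ≤-trans (≡⇒≤ (diff (suc k))) (≤-trans (≤-by (sum-≥0 (λ i → pow-nonneg A₁.outer-nonneg (suc (suc k)) i i)) (eq _ _))
      (≤-trans (sum-mono (RB.pow-closed A₂.s A₂.outer≤s A₂.ns (suc k))) (≡⇒≤ (trans (sum-*ʳ _ _) (cong₂ _*_ s-sum refl)))))
      where
      eq = solve 2 (λ x y → x :- (x :- y) := y) refl

-- Coded trees and their realization in a matrix

data Code : Set where
  tip : Code
  step fork : Code → Code

-- Realizes t o r: the component of r in o is the tree coded by t, rooted at r. The root of step t has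
-- one child; that of fork t has a leaf and a second child, which itself has one child.
Realizes : ∀ {n} → Code → Matrix n → Fin n → Set
Realizes tip o r = ∀ j → o r j ≡ + 0
Realizes {n} (step t) o r = Σ (Fin n) λ c → (∀ j → o r j ≡ δ c j) × Realizes t (del r o) c
Realizes {n} (fork t) o r = Σ (Fin n) λ leaf → Σ (Fin n) λ x → Σ (Fin n) λ c →
  (∀ j → o r j ≡ δ leaf j + δ x j) × (∀ j → del r o leaf j ≡ + 0) × (∀ j → del r o x j ≡ δ c j) × Realizes t (del x (del r o)) c

record Bounded {n} (b : ℤ) (o : Matrix n) : Set where
  no-eta-equality
  field
    o-sym : Symmetric o
    o-bit : ∀ i j → Bit (o i j)
    o-diag : ∀ i → o i i ≡ + 0
    o-rows : ∀ i → sum (o i) ≤ b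

  nonneg : ∀ i j → + 0 ≤ o i j
  nonneg i j = bit-≥0 (o-bit i j)

del-bit : ∀ {n} (v : Fin n) {a : Matrix n} → (∀ i j → Bit (a i j)) → ∀ i j → Bit (del v a i j)
del-bit v {a} bits i j with δ-split v i | δ-split v j
... | inj₁ (refl , _) | _ = inj₁ (del-row v a j)
... | inj₂ _ | inj₁ (refl , _) = inj₁ (del-col v a i)
... | inj₂ (p , _) | inj₂ (q , _) = subst Bit (sym (del-other a p q)) (bits i j)

del-≤ : ∀ {n} (v : Fin n) {a : Matrix n} → (∀ i j → Bit (a i j)) → ∀ i j → del v a i j ≤ a i j
del-≤ v {a} bits i j with δ-split v i | δ-split v j
... | inj₁ (refl , _) | _ = ≤-trans (≡⇒≤ (del-row v a j)) (bit-≥0 (bits v j))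
... | inj₂ _ | inj₁ (refl , _) = ≤-trans (≡⇒≤ (del-col v a i)) (bit-≥0 (bits i v))
... | inj₂ (p , _) | inj₂ (q , _) = ≡⇒≤ (del-other a p q)

del-bounded : ∀ {n} {b} (v : Fin n) {o : Matrix n} → Bounded b o → Bounded b (del v o)
del-bounded v {o} B = record
  { o-sym = del-sym v o o-sym
  ; o-bit = del-bit v o-bit
  ; o-diag = λ i → ℤₚ.≤-antisym (≤-trans (del-≤ v o-bit i i) (≡⇒≤ (o-diag i))) (bit-≥0 (del-bit v o-bit i i))
  ; o-rows = λ i → ≤-trans (sum-mono (del-≤ v o-bit i)) (o-rows i) }
  where open Bounded B

walks : ∀ {n} → Matrix n → Fin n → Series
walks o r k = pow o k r r

find-one : ∀ {n} (f : Fin n → ℤ) → (∀ i → Bit (f i)) → (∀ i → f i ≡ + 0) ⊎ Σ (Fin n) λ c → f c ≡ + 1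
find-one {zero} f bits = inj₁ (λ ())
find-one {suc n} f bits with bits zero | find-one (λ i → f (suc i)) (λ i → bits (suc i))
... | inj₂ e | _ = inj₂ (zero , e)
... | inj₁ _ | inj₂ (c , e) = inj₂ (suc c , e)
... | inj₁ e | inj₁ z = inj₁ (λ { zero → e ; (suc i) → z i })

remove-one : ∀ {n} (f : Fin n → ℤ) → (∀ i → Bit (f i)) → ∀ c → f c ≡ + 1 → ∀ i → Bit (f i - δ c i)
remove-one f bits c e i with δ-split c i
... | inj₁ (refl , d) = inj₁ (trans (cong₂ _-_ e d) (R.-‿inverseʳ _))
... | inj₂ (_ , d) = subst Bit (trans (eq (f i)) (cong (λ x → f i - x) (sym d))) (bits i)
  where
  eq = solve 1 (λ x → x := x :- ♯ 0) refl

restore : ∀ x y z → x - y ≡ z → x ≡ y + z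
restore x y z e = trans (eq x y) (cong (λ t → y + t) e)
  where
  eq = solve 2 (λ x y → x := y :+ (x :- y)) refl

sum-remove-δ : ∀ {n} (f : Fin n → ℤ) c → sum f ≡ + 1 + sum (λ i → f i - δ c i)
sum-remove-δ f c = restore (sum f) (+ 1) _ (sym (trans (sum-+ _ _) (cong₂ _+_ refl (trans (sum-neg _) (cong -_ (trans (sum-cong (λ j → sym (R.*-identityʳ _))) (sum-δˡ c (λ _ → + 1))))))))

classify₁ : ∀ {n} (f : Fin n → ℤ) → (∀ i → Bit (f i)) → (∀ i → f i ≡ + 0) ⊎ ((Σ (Fin n) λ c → ∀ j → f j ≡ δ c j) ⊎ + 2 ≤ sum f)
classify₁ f bits with find-one f bits
... | inj₁ z = inj₁ z
... | inj₂ (c , e) with find-one (λ i → f i - δ c i) (remove-one f bits c e)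
... | inj₁ z = inj₂ (inj₁ (c , λ j → trans (restore _ _ _ (z j)) (R.+-identityʳ _)))
... | inj₂ (c′ , e′) = inj₂ (inj₂ (≤-trans (≡⇒≤ two) (≤-trans (+-mono ≤-refl (≤-trans (≡⇒≤ (sym e′)) (term≤sum (λ i → bit-≥0 (remove-one f bits c e i)) c′))) (≡⇒≤ (sym (sum-remove-δ f c))))))
  where
  opaque
    unfolding _+_
    two : + 2 ≡ + 1 + + 1
    two = refl

classify₂ : ∀ {n} (f : Fin n → ℤ) → (∀ i → Bit (f i)) →
  (∀ i → f i ≡ + 0) ⊎ ((Σ (Fin n) λ c → ∀ j → f j ≡ δ c j) ⊎ ((Σ (Fin n) λ c → Σ (Fin n) λ c′ → ∀ j → f j ≡ δ c j + δ c′ j) ⊎ + 3 ≤ sum f))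
classify₂ f bits with find-one f bits
... | inj₁ z = inj₁ z
... | inj₂ (c , e) with classify₁ (λ i → f i - δ c i) (remove-one f bits c e)
... | inj₁ z = inj₂ (inj₁ (c , λ j → trans (restore _ _ _ (z j)) (R.+-identityʳ _)))
... | inj₂ (inj₁ (c′ , z)) = inj₂ (inj₂ (inj₁ (c , c′ , λ j → restore _ _ _ (z j))))
... | inj₂ (inj₂ p) = inj₂ (inj₂ (inj₂ (≤-trans (≡⇒≤ three) (≤-trans (+-mono ≤-refl p) (≡⇒≤ (sym (sum-remove-δ f c)))))))
  where
  opaque
    unfolding _+_
    three : + 3 ≡ + 1 + + 2
    three = refl

sum-δ : ∀ {n} (c : Fin n) → sum (δ c) ≡ + 1
sum-δ c = trans (sum-cong (λ j → sym (R.*-identityʳ _))) (sum-δˡ c (λ _ → + 1))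

-- First-return series at r

module Root {n} {b} {o : Matrix n} (B : Bounded b o) (r : Fin n) where
  open Bounded B
  private module Rm = Remove o o-sym r (o-diag r)

  E : Series
  E = Rm.returns

  renewal : walks o r ≈ const (+ 1) ⊕s z⊛ (z⊛ (E ⊛ walks o r))
  renewal = Rm.closed-renewal

  o′ : Matrix n
  o′ = del r o

  B′ : Bounded b o′
  B′ = del-bounded r B

  E-nonneg : NonNeg E
  E-nonneg k = sum-≥0 (λ i → nonneg r i ⊠ sum-≥0 (λ j → pow-nonneg (Bounded.nonneg B′) k i j ⊠ nonneg r j))

  E-degree : E 0 ≡ sum (o r)
  E-degree = sum-cong (λ i → trans (cong₂ _*_ refl (sum-δˡ i (o r))) (bit-idem (o-bit r i)))

  E-none : (∀ j → o r j ≡ + 0) → ∀ k → E k ≡ + 0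
  E-none z k = sum-0 (λ i → trans (cong₂ _*_ (z i) refl) (R.zeroˡ _))

  E-one : ∀ c → (∀ j → o r j ≡ δ c j) → E ≈ walks o′ c
  E-one c e k = trans (sum-cong (λ i → cong₂ _*_ (e i) (trans (sum-cong (λ j → cong₂ _*_ refl (trans (e j) (δ-sym c j)))) (sum-δʳ c (pow o′ k i))))) (sum-δˡ c (λ i → pow o′ k i c))

  E-two : ∀ c c′ → (∀ j → o r j ≡ δ c j + δ c′ j) → ∀ k → E k ≡ (pow o′ k c c + pow o′ k c c′) + (pow o′ k c′ c + pow o′ k c′ c′)
  E-two c c′ e k = trans (sum-cong (λ i → trans (cong₂ _*_ (e i) (inner i)) (R.distribʳ _ _ _))) (trans (sum-+ _ _) (cong₂ _+_ (sum-δˡ c _) (sum-δˡ c′ _)))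
    where
    inner : ∀ i → sum (λ j → pow o′ k i j * o r j) ≡ pow o′ k i c + pow o′ k i c′
    inner i = trans (sum-cong (λ j → trans (cong₂ _*_ refl (trans (e j) (cong₂ _+_ (δ-sym c j) (δ-sym c′ j)))) (R.distribˡ _ _ _))) (trans (sum-+ _ _) (cong₂ _+_ (sum-δʳ c _) (sum-δʳ c′ _)))

  two-distinct : ∀ {c c′} → (∀ j → o r j ≡ δ c j + δ c′ j) → ¬ (c ≡ c′)
  two-distinct {c} e refl with trans (sym (e c)) refl | o-bit r c
  ... | _ | inj₁ z = 2≢ (trans (sym (trans (e c) (cong₂ _+_ (δ-refl c) (δ-refl c)))) z)
    where
    opaque
      unfolding _+_
      2≢ : ¬ (+ 1 + + 1 ≡ + 0)
      2≢ ()
  ... | _ | inj₂ z = 2≢ (trans (sym (trans (e c) (cong₂ _+_ (δ-refl c) (δ-refl c)))) z)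
    where
    opaque
      unfolding _+_
      2≢ : ¬ (+ 1 + + 1 ≡ + 1)
      2≢ ()

  -- Once `r` is deleted the leaf is isolated: only its empty walk counts, and the mixed terms with
  -- `x` vanish.
  E-leaf : ∀ leaf x → (∀ j → o r j ≡ δ leaf j + δ x j) → (∀ j → o′ leaf j ≡ + 0) → E ≈ const (+ 1) ⊕s walks o′ x
  E-leaf leaf x e z k = trans (E-two leaf x e k) (trans (cong₂ _+_ (cong₂ _+_ (isolated k leaf) (isolated k x)) (cong₂ _+_ (trans (pow-sym o′ (Bounded.o-sym B′) k x leaf) (isolated k x)) refl))
      (values k))
    where
    isolated : ∀ k j → pow o′ k leaf j ≡ const (δ leaf j) k
    isolated zero j = refl
    isolated (suc k) j = sum-0 (λ l → trans (cong₂ _*_ (z l) refl) (R.zeroˡ _))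
    eq = solve 1 (λ w → (♯ 1 :+ ♯ 0) :+ (♯ 0 :+ w) := ♯ 1 :+ w) refl
    eq₀ = solve 1 (λ w → (♯ 0 :+ ♯ 0) :+ (♯ 0 :+ w) := ♯ 0 :+ w) refl
    values : ∀ k → (const (δ leaf leaf) k + const (δ leaf x) k) + (const (δ leaf x) k + pow o′ k x x) ≡ const (+ 1) k + pow o′ k x x
    values zero = trans (cong₂ (λ a b → (a + b) + (b + pow o′ 0 x x)) (δ-refl leaf) (δ-≢ {i = leaf} {x} (two-distinct {leaf} {x} e))) (eq _)
    values (suc k) = eq₀ _

walks-one : ∀ {n} {b} {o : Matrix n} → Bounded b o → ∀ x c → (∀ j → o x j ≡ δ c j) → ∀ k → walks o x (suc (suc k)) ≡ walks o c k
walks-one {o = o} B x c e k = trans (sum-cong (λ l → cong₂ _*_ (e l) refl)) (trans (sum-δˡ c (λ l → pow o (suc k) l x)) (trans (pow-sym o (Bounded.o-sym B) (suc k) c x)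
  (trans (sum-cong (λ l → cong₂ _*_ (e l) refl)) (sum-δˡ c (λ l → pow o k l c)))))

walks-zero : ∀ {n} (o : Matrix n) r → walks o r 0 ≡ + 1
walks-zero o r = δ-refl r

walks-1 : ∀ {n} {b} {o : Matrix n} → Bounded b o → ∀ r → walks o r 1 ≡ + 0
walks-1 {o = o} B r = trans (pow-one o r r) (Bounded.o-diag B r)

walks-nonneg : ∀ {n} {b} {o : Matrix n} → Bounded b o → ∀ r → NonNeg (walks o r)
walks-nonneg B r k = pow-nonneg (Bounded.nonneg B) k r r

-- Comparing two rooted graphs, the second of which realizes a code

module Decode {n : ℕ} (b : ℤ) (0≤b : + 0 ≤ b) (J₁ J₂ : Series) (T : Series) (T≡ : T ≈ const (+ 1) ⊕s negs (z⊛ (z⊛ (λ k → b * powers b k))))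
  (no-excess : ∀ S a Y k₀ → NonNeg S → + 1 ≤ S k₀ → shift a T ⊑ Y → J₁ ⊕s negs J₂ ≈ S ⊛ Y → ⊥)
  (no-deficit : ∀ S a Y k₀ → NonNeg S → + 1 ≤ S k₀ → shift a T ⊑ Y → J₂ ⊕s negs J₁ ≈ S ⊛ Y → ⊥) where

  private
    walks-≤ : ∀ {o : Matrix n} → Bounded b o → ∀ r k → walks o r (suc (suc k)) ≤ b * powers b k
    walks-≤ {o} B r k = ≤-trans (RowBound.pow-closed o (Bounded.nonneg B) b 0≤b (Bounded.o-rows B) (λ _ → + 1) (λ i j → bit≤1 (Bounded.o-bit B i j)) (λ _ → 0≤+) (suc k) r) (≡⇒≤ (R.*-identityˡ _))
      where
      bit≤1 : ∀ {x} → Bit x → x ≤ + 1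
      bit≤1 (inj₁ refl) = 0≤+
      bit≤1 (inj₂ refl) = ≤-refl

    0-x = solve 1 (λ x → ♯ 0 :+ :- x := :- x) refl
    opaque
      unfolding _+_ _*_ -_
      1-0 : + 1 + - + 0 ≡ + 1
      1-0 = refl
      0-0 : + 0 + - + 0 ≡ + 0
      0-0 = refl

    lower₀ : ∀ {Y} → + 1 ≤ Y 0 → + 0 ≤ Y 1 → (∀ k → - (b * powers b k) ≤ Y (suc (suc k))) → shift 0 T ⊑ Y
    lower₀ p q r zero = ≤-trans (≡⇒≤ (trans (T≡ 0) 1-0)) p
    lower₀ p q r (suc zero) = ≤-trans (≡⇒≤ (trans (T≡ 1) 0-0)) q
    lower₀ p q r (suc (suc k)) = ≤-trans (≡⇒≤ (trans (T≡ (suc (suc k))) (0-x _))) (r k)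

    lower₂ : ∀ {Y} → + 0 ≤ Y 0 → + 0 ≤ Y 1 → shift 0 T ⊑ (λ k → Y (suc (suc k))) → shift 2 T ⊑ Y
    lower₂ p q r zero = p
    lower₂ p q r (suc zero) = q
    lower₂ p q r (suc (suc k)) = r k

    minus-≥ : ∀ {x y c} → + 0 ≤ x → y ≤ c → - c ≤ x - y
    minus-≥ {x} {y} {c} p q = ≤-by (p ⊞ ≤-diff q) (eq x y c)
      where
      eq = solve 3 (λ x y c → x :- y :- :- c := x :+ (c :- y)) refl

    minus-≥0 : ∀ {x y} → + 0 ≤ x → y ≡ + 0 → + 0 ≤ x - y
    minus-≥0 {x} p e = subst (λ y → + 0 ≤ x - y) (sym e) (≤-diff p)

    gap : ∀ {x y c} → c + + 1 ≤ x → y ≡ c → + 1 ≤ x - y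
    gap {x} {y} {c} p refl = ≤-by (≤-diff p) (eq x y)
      where
      eq = solve 2 (λ x y → x :- y :- ♯ 1 := x :- (y :+ ♯ 1)) refl

    opaque
      unfolding _+_
      0+1 : + 0 + + 1 ≡ + 1
      0+1 = refl
      1+1 : + 1 + + 1 ≡ + 2
      1+1 = refl
      2+1 : + 2 + + 1 ≡ + 3
      2+1 = refl

    negb : ∀ k → - (b * powers b k) ≤ + 0
    negb k = ≤-by (0≤b ⊠ powers-nonneg 0≤b k) (eq _)
      where
      eq = solve 1 (λ x → ♯ 0 :- :- x := x) refl

    -- Every difference met on the way down equals J₁ - J₂ up to the nonnegative, nonzero factor
    -- `S`, so a sign found deep in the tree can be tested against the top. `S` collects the factors
    -- z² w₁ w₂ of the levels passed.
    Invariant : Series → Series → Set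
    Invariant w₁ w₂ = Σ Series λ S → Σ ℕ λ k₀ → NonNeg S × + 1 ≤ S k₀ × J₁ ⊕s negs J₂ ≈ S ⊛ (w₁ ⊕s negs w₂)

    excess : ∀ {w₁ w₂} a → Invariant w₁ w₂ → shift a T ⊑ w₁ ⊕s negs w₂ → ⊥
    excess a (S , k₀ , nS , S₀ , e) lb = no-excess S a _ k₀ nS S₀ lb e

    deficit : ∀ {w₁ w₂} a → Invariant w₁ w₂ → shift a T ⊑ w₂ ⊕s negs w₁ → ⊥
    deficit {w₁} {w₂} a (S , k₀ , nS , S₀ , e) lb = no-deficit S a _ k₀ nS S₀ lb (λ k → trans (negate _ _ _ (e k))
        (SeriesSolver.solve 3 (λ s w₁ w₂ → (:⊖ (s :⊛ (w₁ :⊕ (:⊖ w₂)))) :≈ s :⊛ (w₂ :⊕ (:⊖ w₁))) (λ _ → refl) S w₁ w₂ k))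
      where
      eq = solve 2 (λ x y → y :- x := :- (x :- y)) refl
      negate : ∀ x y z → x - y ≡ z → y - x ≡ - z
      negate x y z e = trans (eq x y) (cong -_ e)

    invariant-cong : ∀ {w₁ w₂ u₁ u₂} → w₁ ⊕s negs w₂ ≈ u₁ ⊕s negs u₂ → Invariant w₁ w₂ → Invariant u₁ u₂
    invariant-cong p (S , k₀ , nS , S₀ , e) = S , k₀ , nS , S₀ , λ k → trans (e k) (⊛-cong {f = S} (λ _ → refl) p k)

    -- The renewal equations read 1/w = 1 - z² E, hence w₁ - w₂ = z² w₁ w₂ (E₁ - E₂). The factor z²
    -- w₁ w₂ has leading coefficient 1 at exponent 2, whence the witness `k₀ + 2`.
    descend : ∀ {o₁ o₂ : Matrix n} (B₁ : Bounded b o₁) (B₂ : Bounded b o₂) r₁ r₂ → Invariant (walks o₁ r₁) (walks o₂ r₂) → Invariant (Root.E B₁ r₁) (Root.E B₂ r₂)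
    descend {o₁} {o₂} B₁ B₂ r₁ r₂ (S , k₀ , nS , S₀ , e) = S′ , k₀ ℕ.+ 2 , nS′ , S′₀ , λ k → trans (e k) (trans (⊛-cong {f = S} (λ _ → refl) difference k)
        (SeriesSolver.solve 4 (λ s w e₁ e₂ → s :⊛ (w :⊛ (e₁ :⊕ (:⊖ e₂))) :≈ s :⊛ w :⊛ (e₁ :⊕ (:⊖ e₂))) (λ _ → refl) S W E₁ E₂ k))
      where
      w₁ w₂ E₁ E₂ W S′ : Series
      w₁ = walks o₁ r₁
      w₂ = walks o₂ r₂
      E₁ = Root.E B₁ r₁
      E₂ = Root.E B₂ r₂
      W = z⊛ (z⊛ (w₁ ⊛ w₂))
      S′ = S ⊛ W
      nW : NonNeg W
      nW zero = ≤-refl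
      nW (suc zero) = ≤-refl
      nW (suc (suc k)) = ⊛-nonneg (walks-nonneg B₁ r₁) (walks-nonneg B₂ r₂) k
      nS′ : NonNeg S′
      nS′ = ⊛-nonneg nS nW
      S′₀ : + 1 ≤ S′ (k₀ ℕ.+ 2)
      S′₀ = ≤-trans S₀ (≤-trans (≡⇒≤ (sym (trans (cong₂ _*_ refl (trans (cong₂ _*_ (walks-zero o₁ r₁) (walks-zero o₂ r₂)) (R.*-identityˡ (+ 1)))) (R.*-identityʳ _)))) (term≤⊛ nS nW k₀ 2))
      zz : Series → Series
      zz f = zs ⊛ (zs ⊛ f)
      zz-eq : ∀ f → z⊛ (z⊛ f) ≈ zz f
      zz-eq f zero = sym (zs-⊛ (zs ⊛ f) 0)
      zz-eq f (suc k) = sym (trans (zs-⊛ (zs ⊛ f) (suc k)) (zs-⊛ f k))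
      vanish : ∀ w E → w ≈ const (+ 1) ⊕s z⊛ (z⊛ (E ⊛ w)) → w ⊕s negs (const (+ 1) ⊕s zz (E ⊛ w)) ≈ (λ _ → + 0)
      vanish w E r k = trans (cong₂ _-_ (trans (r k) (cong₂ _+_ refl (zz-eq _ k))) refl) (R.-‿inverseʳ _)
      kill : ∀ {p} f → p ≈ (λ _ → + 0) → f ⊛ p ≈ (λ _ → + 0)
      kill f z k = trans (⊛-cong {f = f} (λ _ → refl) z k) (trans (⊛-comm f _ k) (⊛-zeroˡ f k))
      difference : w₁ ⊕s negs w₂ ≈ W ⊛ (E₁ ⊕s negs E₂)
      difference k = trans (SeriesSolver.solve 5 (λ w₁ w₂ e₁ e₂ z → w₁ :⊕ (:⊖ w₂) :≈
            (w₂ :⊛ (w₁ :⊕ (:⊖ (:const (+ 1) :⊕ z :⊛ (z :⊛ (e₁ :⊛ w₁))))) :⊕ (:⊖ w₁) :⊛ (w₂ :⊕ (:⊖ (:const (+ 1) :⊕ z :⊛ (z :⊛ (e₂ :⊛ w₂))))))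
            :⊕ z :⊛ (z :⊛ (w₁ :⊛ w₂)) :⊛ (e₁ :⊕ (:⊖ e₂))) (λ _ → refl) w₁ w₂ E₁ E₂ zs k)
          (trans (cong₂ _+_ (trans (cong₂ _+_ (kill w₂ (vanish w₁ E₁ (Root.renewal B₁ r₁)) k) (kill (negs w₁) (vanish w₂ E₂ (Root.renewal B₂ r₂)) k)) (R.+-identityˡ _))
            (⊛-cong {g = E₁ ⊕s negs E₂} (≈-sym (zz-eq (w₁ ⊛ w₂))) (λ _ → refl) k)) (R.+-identityˡ _))

    single-child : ∀ {o₁ o₂ : Matrix n} (B₁ : Bounded b o₁) (B₂ : Bounded b o₂) r₁ r₂ c₁ c₂ → (∀ j → o₁ r₁ j ≡ δ c₁ j) → (∀ j → o₂ r₂ j ≡ δ c₂ j) →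
      Invariant (walks o₁ r₁) (walks o₂ r₂) → Invariant (walks (del r₁ o₁) c₁) (walks (del r₂ o₂) c₂)
    single-child B₁ B₂ r₁ r₂ c₁ c₂ e₁ e₂ inv = invariant-cong (λ k → cong₂ _-_ (Root.E-one B₁ r₁ c₁ e₁ k) (Root.E-one B₂ r₂ c₂ e₂ k)) (descend B₁ B₂ r₁ r₂ inv)

  -- The constant coefficient of the first-return series is the number of children. A wrong number
  -- makes the difference at least 1 in one direction there, and later coefficients undercut this by
  -- at most `b * powers b k`, so the difference lies above `T` and is excluded. With the right
  -- number the comparison passes to the child on the spine.
  decode : ∀ t {o₁ o₂ : Matrix n} (B₁ : Bounded b o₁) (B₂ : Bounded b o₂) r₁ r₂ → Realizes t o₂ r₂ → Invariant (walks o₁ r₁) (walks o₂ r₂) → Realizes t o₁ r₁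
  decode tip {o₁} B₁ B₂ r₁ r₂ none inv with find-one (o₁ r₁) (Bounded.o-bit B₁ r₁)
  ... | inj₁ z = z
  ... | inj₂ (c , e) = ⊥-elim (excess 0 (descend B₁ B₂ r₁ r₂ inv) (lower₀
      (gap (≤-trans (≡⇒≤ 0+1) (≤-trans (≡⇒≤ (sym e)) (≤-trans (term≤sum (Bounded.nonneg B₁ r₁) c) (≡⇒≤ (sym R₁.E-degree))))) (R₂.E-none none 0))
      (minus-≥0 (R₁.E-nonneg 1) (R₂.E-none none 1)) (λ k → ≤-trans (negb k) (minus-≥0 (R₁.E-nonneg (suc (suc k))) (R₂.E-none none (suc (suc k)))))))
    where
    module R₁ = Root B₁ r₁
    module R₂ = Root B₂ r₂
  decode (step t) {o₁} B₁ B₂ r₁ r₂ (c₂ , e₂ , real) inv with classify₁ (o₁ r₁) (Bounded.o-bit B₁ r₁)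
  ... | inj₁ z = ⊥-elim (deficit 0 (descend B₁ B₂ r₁ r₂ inv) (lower₀
      (gap (≤-trans (≡⇒≤ 0+1) (≡⇒≤ (sym (trans (R₂.E-one c₂ e₂ 0) (δ-refl c₂))))) (R₁.E-none z 0))
      (minus-≥0 (R₂.E-nonneg 1) (R₁.E-none z 1)) (λ k → ≤-trans (negb k) (minus-≥0 (R₂.E-nonneg (suc (suc k))) (R₁.E-none z (suc (suc k)))))))
    where
    module R₁ = Root B₁ r₁
    module R₂ = Root B₂ r₂
  ... | inj₂ (inj₁ (c₁ , e₁)) = c₁ , e₁ , decode t (del-bounded r₁ B₁) (del-bounded r₂ B₂) c₁ c₂ real (single-child B₁ B₂ r₁ r₂ c₁ c₂ e₁ e₂ inv)
  ... | inj₂ (inj₂ p) = ⊥-elim (excess 0 (descend B₁ B₂ r₁ r₂ inv) (lower₀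
      (gap (≤-trans (≡⇒≤ 1+1) (≤-trans p (≡⇒≤ (sym R₁.E-degree)))) (trans (R₂.E-one c₂ e₂ 0) (δ-refl c₂)))
      (minus-≥0 (R₁.E-nonneg 1) (trans (R₂.E-one c₂ e₂ 1) (walks-1 R₂.B′ c₂)))
      (λ k → minus-≥ (R₁.E-nonneg (suc (suc k))) (≤-trans (≡⇒≤ (R₂.E-one c₂ e₂ (suc (suc k)))) (walks-≤ R₂.B′ c₂ k)))))
    where
    module R₁ = Root B₁ r₁
    module R₂ = Root B₂ r₂
  decode (fork t) {o₁} {o₂} B₁ B₂ r₁ r₂ (leaf₂ , x₂ , c₂ , e₂ , leaf-none , ex₂ , real) inv = by-children (classify₂ (o₁ r₁) (Bounded.o-bit B₁ r₁))
    where
    module R₁ = Root B₁ r₁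
    module R₂ = Root B₂ r₂

    E₂-eq : R₂.E ≈ const (+ 1) ⊕s walks R₂.o′ x₂
    E₂-eq = R₂.E-leaf leaf₂ x₂ e₂ leaf-none

    E₂-0 : R₂.E 0 ≡ + 2
    E₂-0 = trans (E₂-eq 0) (trans (cong₂ _+_ refl (δ-refl x₂)) 1+1)

    E₂-1 : R₂.E 1 ≡ + 0
    E₂-1 = trans (E₂-eq 1) (trans (R.+-identityˡ _) (walks-1 R₂.B′ x₂))

    E₂-suc : ∀ k → R₂.E (suc k) ≡ walks R₂.o′ x₂ (suc k)
    E₂-suc k = trans (E₂-eq (suc k)) (R.+-identityˡ _)

    E₂-2+ : ∀ k → R₂.E (suc (suc k)) ≡ walks R₂.o′ c₂ k
    E₂-2+ k = trans (E₂-suc (suc k)) (walks-one R₂.B′ x₂ c₂ ex₂ k)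

    matched : ∀ leaf₁ x₁ c₁ → (∀ j → o₁ r₁ j ≡ δ leaf₁ j + δ x₁ j) → (∀ j → R₁.o′ leaf₁ j ≡ + 0) → (∀ j → R₁.o′ x₁ j ≡ δ c₁ j) → Realizes (fork t) o₁ r₁
    matched leaf₁ x₁ c₁ e₁ z ex₁ = leaf₁ , x₁ , c₁ , e₁ , z , ex₁ ,
      -- The leaf adds the constant 1 to both first-return series and cancels, which leaves the walk
      -- series at `x₁` and `x₂`.
      decode t (del-bounded x₁ R₁.B′) (del-bounded x₂ R₂.B′) c₁ c₂ real (single-child R₁.B′ R₂.B′ x₁ x₂ c₁ c₂ ex₁ ex₂
        (invariant-cong (λ k → trans (cong₂ _-_ (R₁.E-leaf leaf₁ x₁ e₁ z k) (E₂-eq k)) (eq (const (+ 1) k) _ _)) (descend B₁ B₂ r₁ r₂ inv)))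
      where
      eq = solve 3 (λ c x y → (c :+ x) :- (c :+ y) := x :- y) refl

    module Two (c c′ : Fin n) (e₁ : ∀ j → o₁ r₁ j ≡ δ c j + δ c′ j) where

      pn : ∀ k i j → + 0 ≤ pow R₁.o′ k i j
      pn = pow-nonneg (Bounded.nonneg R₁.B′)

      E₁-0 : R₁.E 0 ≡ + 2
      E₁-0 = trans R₁.E-degree (trans (sum-cong e₁) (trans (sum-+ _ _) (trans (cong₂ _+_ (sum-δ c) (sum-δ c′)) 1+1)))

      degree : ∀ i → pow R₁.o′ 2 i i ≡ sum (R₁.o′ i)
      degree i = trans (pow-two R₁.o′ i i) (sum-cong (λ k → trans (cong₂ _*_ refl (Bounded.o-sym R₁.B′ k i)) (bit-idem (Bounded.o-bit R₁.B′ i k))))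

      E₁-2 : sum (R₁.o′ c) + sum (R₁.o′ c′) ≤ R₁.E 2
      E₁-2 = ≤-trans (≤-by (pn 2 c c′ ⊞ pn 2 c′ c) (trans (cong₂ (λ x y → (pow R₁.o′ 2 c c + pow R₁.o′ 2 c c′) + (pow R₁.o′ 2 c′ c + pow R₁.o′ 2 c′ c′) - (x + y)) (sym (degree c)) (sym (degree c′))) (eq _ _ _ _)))
          (≡⇒≤ (sym (R₁.E-two c c′ e₁ 2)))
        where
        eq = solve 4 (λ x y z w → (x :+ y) :+ (z :+ w) :- (x :+ w) := y :+ z) refl

      too-many : + 2 ≤ sum (R₁.o′ c) + sum (R₁.o′ c′) → ⊥
      -- The constant terms agree and coefficient 1 of `R₂.E` is zero, so coefficient 2 decides: at
      -- least the degree sum of the two children here, exactly 1 in the coded tree.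
      too-many p = excess 2 (descend B₁ B₂ r₁ r₂ inv) (lower₂
        (≡⇒≤ (sym (trans (cong₂ _-_ E₁-0 E₂-0) (R.-‿inverseʳ _)))) (minus-≥0 (R₁.E-nonneg 1) E₂-1)
        (lower₀ (gap (≤-trans (≡⇒≤ 1+1) (≤-trans p E₁-2)) (trans (E₂-2+ 0) (δ-refl c₂)))
          (minus-≥0 (R₁.E-nonneg 3) (trans (E₂-2+ 1) (walks-1 R₂.B′ c₂)))
          (λ k → minus-≥ (R₁.E-nonneg (suc (suc (suc (suc k))))) (≤-trans (≡⇒≤ (E₂-2+ (suc (suc k)))) (walks-≤ R₂.B′ c₂ k)))))

      too-few : (∀ j → R₁.o′ c j ≡ + 0) → (∀ j → R₁.o′ c′ j ≡ + 0) → ⊥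
      too-few z z′ = deficit 2 (descend B₁ B₂ r₁ r₂ inv) (lower₂
        (≡⇒≤ (sym (trans (cong₂ _-_ E₂-0 E₁-0) (R.-‿inverseʳ _)))) (minus-≥0 (R₂.E-nonneg 1) (E₁-suc 0))
        (lower₀ (gap (≤-trans (≡⇒≤ 0+1) (≡⇒≤ (sym (trans (E₂-2+ 0) (δ-refl c₂))))) (E₁-suc 1))
          (minus-≥0 (R₂.E-nonneg 3) (E₁-suc 2)) (λ k → ≤-trans (negb k) (minus-≥0 (R₂.E-nonneg (suc (suc (suc (suc k))))) (E₁-suc (suc (suc (suc k))))))))
        where
        pow-0 : ∀ i → (∀ j → R₁.o′ i j ≡ + 0) → ∀ k j → pow R₁.o′ (suc k) i j ≡ + 0
        pow-0 i z k j = sum-0 (λ l → trans (cong₂ _*_ (z l) refl) (R.zeroˡ _))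
        opaque
          unfolding _+_
          eq : (+ 0 + + 0) + (+ 0 + + 0) ≡ + 0
          eq = refl
        E₁-suc : ∀ k → R₁.E (suc k) ≡ + 0
        E₁-suc k = trans (R₁.E-two c c′ e₁ (suc k)) (trans (cong₂ _+_ (cong₂ _+_ (pow-0 c z k c) (pow-0 c z k c′)) (cong₂ _+_ (pow-0 c′ z′ k c) (pow-0 c′ z′ k c′))) eq)

      resolve : (∀ i → R₁.o′ c i ≡ + 0) ⊎ ((Σ (Fin n) λ y → ∀ j → R₁.o′ c j ≡ δ y j) ⊎ + 2 ≤ sum (R₁.o′ c)) →
                (∀ i → R₁.o′ c′ i ≡ + 0) ⊎ ((Σ (Fin n) λ y → ∀ j → R₁.o′ c′ j ≡ δ y j) ⊎ + 2 ≤ sum (R₁.o′ c′)) → Realizes (fork t) o₁ r₁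
      resolve (inj₁ z) (inj₁ z′) = ⊥-elim (too-few z z′)
      resolve (inj₁ z) (inj₂ (inj₁ (y , e))) = matched c c′ y e₁ z e
      resolve (inj₂ (inj₁ (y , e))) (inj₁ z) = matched c′ c y (λ j → trans (e₁ j) (R.+-comm _ _)) z e
      resolve (inj₂ (inj₁ (y , e))) (inj₂ (inj₁ (y′ , e′))) = ⊥-elim (too-many (≡⇒≤ (sym (trans (cong₂ _+_ (trans (sum-cong e) (sum-δ y)) (trans (sum-cong e′) (sum-δ y′))) 1+1))))
      resolve (inj₂ (inj₂ p)) _ = ⊥-elim (too-many (≤-trans p (a≤a+b (sum-≥0 (Bounded.nonneg R₁.B′ c′)))))
      resolve _ (inj₂ (inj₂ p)) = ⊥-elim (too-many (≤-trans p (≤-trans (a≤a+b (sum-≥0 (Bounded.nonneg R₁.B′ c))) (≡⇒≤ (R.+-comm _ _)))))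

    by-children : (∀ i → o₁ r₁ i ≡ + 0) ⊎ ((Σ (Fin n) λ c → ∀ j → o₁ r₁ j ≡ δ c j) ⊎ ((Σ (Fin n) λ c → Σ (Fin n) λ c′ → ∀ j → o₁ r₁ j ≡ δ c j + δ c′ j) ⊎ + 3 ≤ sum (o₁ r₁))) → Realizes (fork t) o₁ r₁
    by-children (inj₁ z) = ⊥-elim (deficit 0 (descend B₁ B₂ r₁ r₂ inv) (lower₀
      (gap (≤-trans (≡⇒≤ 0+1) (≤-trans (+≤+ (s≤s z≤n)) (≡⇒≤ (sym E₂-0)))) (R₁.E-none z 0))
      (minus-≥0 (R₂.E-nonneg 1) (R₁.E-none z 1)) (λ k → ≤-trans (negb k) (minus-≥0 (R₂.E-nonneg (suc (suc k))) (R₁.E-none z (suc (suc k)))))))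
    by-children (inj₂ (inj₁ (c₁ , e₁))) = ⊥-elim (deficit 0 (descend B₁ B₂ r₁ r₂ inv) (lower₀
      (gap (≤-trans (≡⇒≤ 1+1) (≡⇒≤ (sym E₂-0))) (trans (R₁.E-one c₁ e₁ 0) (δ-refl c₁)))
      (minus-≥0 (R₂.E-nonneg 1) (trans (R₁.E-one c₁ e₁ 1) (walks-1 R₁.B′ c₁)))
      (λ k → minus-≥ (R₂.E-nonneg (suc (suc k))) (≤-trans (≡⇒≤ (R₁.E-one c₁ e₁ (suc (suc k)))) (walks-≤ R₁.B′ c₁ k)))))
    by-children (inj₂ (inj₂ (inj₁ (c , c′ , e₁)))) = Two.resolve c c′ e₁ (classify₁ (R₁.o′ c) (Bounded.o-bit R₁.B′ c)) (classify₁ (R₁.o′ c′) (Bounded.o-bit R₁.B′ c′))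
    by-children (inj₂ (inj₂ (inj₂ p))) = ⊥-elim (excess 0 (descend B₁ B₂ r₁ r₂ inv) (lower₀
      (gap (≤-trans (≡⇒≤ 2+1) (≤-trans p (≡⇒≤ (sym R₁.E-degree)))) E₂-0)
      (minus-≥0 (R₁.E-nonneg 1) E₂-1)
      (λ k → minus-≥ (R₁.E-nonneg (suc (suc k))) (≤-trans (≡⇒≤ (E₂-suc (suc k))) (walks-≤ R₂.B′ x₂ k)))))

  decode-start : ∀ t {o₁ o₂ : Matrix n} (B₁ : Bounded b o₁) (B₂ : Bounded b o₂) r₁ r₂ → Realizes t o₂ r₂ → J₁ ≈ walks o₁ r₁ → J₂ ≈ walks o₂ r₂ → Realizes t o₁ r₁
  decode-start t B₁ B₂ r₁ r₂ real e₁ e₂ = decode t B₁ B₂ r₁ r₂ real (const (+ 1) , 0 , n1 , ≤-refl , λ k → trans (cong₂ _-_ (e₁ k) (e₂ k)) (sym (⊛-identityˡ _ k)))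
    where
    n1 : NonNeg (const (+ 1))
    n1 zero = 0≤+
    n1 (suc k) = ≤-refl

-- Construction of the tails

bit : Bool → ℤ
bit b = if b then + 1 else + 0

bit-Bit : ∀ b → Bit (bit b)
bit-Bit false = inj₁ refl
bit-Bit true = inj₂ refl

bit-injective : ∀ b c → bit b ≡ bit c → b ≡ c
bit-injective false false e = refl
bit-injective true true e = refl

Injective : ∀ {m n} → (Fin m → Fin n) → Set
Injective f = ∀ {i j} → f i ≡ f j → i ≡ j

δ-injective : ∀ {m n} {φ : Fin m → Fin n} → Injective φ → ∀ i j → δ (φ i) (φ j) ≡ δ i j
δ-injective {φ = φ} inj i j with δ-split i j
... | inj₁ (refl , e) = trans (δ-refl (φ i)) (sym e)
... | inj₂ (p , e) = trans (δ-≢ {i = φ i} {φ j} (λ q → p (inj q))) (sym e)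

-- The new vertex 0 is joined to the first `a` old vertices. The root of a tree is always vertex 0,
-- so `a = 1` places a new root above it.
ext : ∀ {n} → ℕ → Graph n → Graph (suc n)
ext a G = record { adj = adj′ ; sym = sym′ ; irrefl = irrefl′ }
  where
  adj′ : Fin _ → Fin _ → Bool
  adj′ zero zero = false
  adj′ zero (suc j) = toℕ j <ᵇ a
  adj′ (suc i) zero = toℕ i <ᵇ a
  adj′ (suc i) (suc j) = adj G i j
  sym′ : ∀ i j → adj′ i j ≡ adj′ j i
  sym′ zero zero = refl
  sym′ zero (suc j) = refl
  sym′ (suc i) zero = refl
  sym′ (suc i) (suc j) = Graph.sym G i j
  irrefl′ : ∀ i → adj′ i i ≡ false
  irrefl′ zero = refl
  irrefl′ (suc i) = Graph.irrefl G i

size : Code → ℕ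
size tip = 1
size (step t) = suc (size t)
size (fork t) = suc (suc (suc (size t)))

root : ∀ t → Fin (size t)
root tip = zero
root (step t) = zero
root (fork t) = zero

tree : ∀ t → Graph (size t)
tree tip = ext 0 (record { adj = λ () ; sym = λ () ; irrefl = λ () })
tree (step t) = ext 1 (tree t)
-- Order of the vertices: root, leaf, spine vertex, then `t`. `ext 0` adds the leaf still isolated,
-- and `ext 2` joins the root to leaf and spine vertex.
tree (fork t) = ext 2 (ext 0 (ext 1 (tree t)))

first-bit : ∀ t j → bit (toℕ j <ᵇ 1) ≡ δ (root t) j
first-bit tip zero = refl
first-bit (step t) zero = refl
first-bit (step t) (suc j) = refl
first-bit (fork t) zero = refl
first-bit (fork t) (suc j) = refl

-- No edge of `o` leaves the image of `φ`, so the coded component is seen unchanged; both hypotheses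
-- survive the deletion of a vertex in the image.
Realizes-map : ∀ t {m n} {τ : Matrix m} {o : Matrix n} (φ : Fin m → Fin n) → Injective φ → (∀ i j → o (φ i) (φ j) ≡ τ i j) →
  (∀ i y → (∀ j → ¬ (φ j ≡ y)) → o (φ i) y ≡ + 0) → ∀ r → Realizes t τ r → Realizes t o (φ r)
Realizes-map t {τ = τ} {o} φ inj agree outside r real = go t r real
  where
  transfer : ∀ r (g : Fin _ → ℤ) (h : Fin _ → ℤ) → (∀ j → g (φ j) ≡ h j) → (∀ y → (∀ j → ¬ (φ j ≡ y)) → g y ≡ + 0) → (∀ j → τ r j ≡ h j) → ∀ y → o (φ r) y ≡ g y
  transfer r g h gh g0 e y with any? (λ j → φ j ≟ y)
  ... | yes (j , refl) = trans (agree r j) (trans (e j) (sym (gh j)))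
  ... | no p = trans (outside r y (λ j q → p (j , q))) (sym (g0 y (λ j q → p (j , q))))
  δ-transfer : ∀ r c → (∀ j → τ r j ≡ δ c j) → ∀ y → o (φ r) y ≡ δ (φ c) y
  δ-transfer r c = transfer r (δ (φ c)) (δ c) (δ-injective inj c) (λ y p → δ-≢ {i = φ c} {y} (p c))
  zero-transfer : ∀ r → (∀ j → τ r j ≡ + 0) → ∀ y → o (φ r) y ≡ + 0
  zero-transfer r = transfer r (λ _ → + 0) (λ _ → + 0) (λ _ → refl) (λ _ _ → refl)
  del-agree : ∀ r i j → del (φ r) o (φ i) (φ j) ≡ del r τ i j
  del-agree r i j = cong₂ _*_ (cong₂ _-_ refl (δ-injective inj r i)) (cong₂ _*_ (cong₂ _-_ refl (δ-injective inj r j)) (agree i j))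
  del-outside : ∀ r i y → (∀ j → ¬ (φ j ≡ y)) → del (φ r) o (φ i) y ≡ + 0
  del-outside r i y p = trans (cong₂ _*_ refl (trans (cong₂ _*_ refl (outside i y p)) (R.zeroʳ _))) (R.zeroʳ _)
  go : ∀ t r → Realizes t τ r → Realizes t o (φ r)
  go tip r z = zero-transfer r z
  go (step t) r (c , e , real) = φ c , δ-transfer r c e , Realizes-map t φ inj (del-agree r) (del-outside r) c real
  go (fork t) r (leaf , x , c , e , z , ex , real) = φ leaf , φ x , φ c ,
      transfer r (λ y → δ (φ leaf) y + δ (φ x) y) (λ j → δ leaf j + δ x j) (λ j → cong₂ _+_ (δ-injective inj leaf j) (δ-injective inj x j))
        (λ y p → trans (cong₂ _+_ (δ-≢ {i = φ leaf} {y} (p leaf)) (δ-≢ {i = φ x} {y} (p x))) (R.+-identityˡ _)) e ,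
      (λ y → lift leaf (λ _ → + 0) (λ _ → + 0) (λ _ → refl) (λ _ _ → refl) z y) ,
      (λ y → lift x (δ (φ c)) (δ c) (δ-injective inj c) (λ y p → δ-≢ {i = φ c} {y} (p c)) ex y) ,
      Realizes-map t φ inj (λ i j → cong₂ _*_ (cong₂ _-_ refl (δ-injective inj x i)) (cong₂ _*_ (cong₂ _-_ refl (δ-injective inj x j)) (del-agree r i j)))
        (λ i y p → trans (cong₂ _*_ refl (trans (cong₂ _*_ refl (del-outside r i y p)) (R.zeroʳ _))) (R.zeroʳ _)) c real
    where
    lift : ∀ u (g : Fin _ → ℤ) (h : Fin _ → ℤ) → (∀ j → g (φ j) ≡ h j) → (∀ y → (∀ j → ¬ (φ j ≡ y)) → g y ≡ + 0) → (∀ j → del r τ u j ≡ h j) → ∀ y → del (φ r) o (φ u) y ≡ g y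
    lift u g h gh g0 e y with any? (λ j → φ j ≟ y)
    ... | yes (j , refl) = trans (del-agree r u j) (trans (e j) (sym (gh j)))
    ... | no p = trans (del-outside r u y (λ j q → p (j , q))) (sym (g0 y (λ j q → p (j , q))))

tree-realizes : ∀ t → Realizes t (A (tree t)) (root t)
tree-realizes tip zero = refl
tree-realizes (step t) = suc (root t) , row , Realizes-map t suc suc-injective (λ i j → del-other {v = zero} {suc i} {suc j} (A (tree (step t))) (λ ()) (λ ())) outside (root t) (tree-realizes t)
  where
  row : ∀ j → A (tree (step t)) zero j ≡ δ (suc (root t)) j
  row zero = refl
  row (suc j) = first-bit t j
  outside : ∀ i y → (∀ j → ¬ (suc j ≡ y)) → del zero (A (tree (step t))) (suc i) y ≡ + 0
  outside i zero p = del-col zero (A (tree (step t))) (suc i)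
  outside i (suc y) p = ⊥-elim (p y refl)
tree-realizes (fork t) = suc zero , suc (suc zero) , suc (suc (suc (root t))) , row , leaf-row , x-row ,
    Realizes-map t (λ i → suc (suc (suc i))) (λ e → suc-injective (suc-injective (suc-injective e)))
      (λ i j → trans (del-other {v = suc (suc zero)} {suc (suc (suc i))} {suc (suc (suc j))} (del zero a) (λ ()) (λ ())) (del-other {v = zero} {suc (suc (suc i))} {suc (suc (suc j))} a (λ ()) (λ ()))) outside (root t) (tree-realizes t)
  where
  a : Matrix (size (fork t))
  a = A (tree (fork t))
  opaque
    unfolding _+_
    e₁ : + 1 ≡ + 1 + + 0
    e₁ = refl
    e₂ : + 1 ≡ + 0 + + 1
    e₂ = refl
    e₃ : + 0 ≡ + 0 + + 0
    e₃ = refl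
  row : ∀ j → a zero j ≡ δ (suc zero) j + δ (suc (suc zero)) j
  row zero = e₃
  row (suc zero) = e₁
  row (suc (suc zero)) = e₂
  row (suc (suc (suc j))) = e₃
  leaf-row : ∀ j → del zero a (suc zero) j ≡ + 0
  leaf-row zero = del-col zero a (suc zero)
  leaf-row (suc j) = trans (del-other {v = zero} {suc zero} {suc j} a (λ ()) (λ ())) (leaf j)
    where
    leaf : ∀ j → a (suc zero) (suc j) ≡ + 0
    leaf zero = refl
    leaf (suc j) = refl
  x-row : ∀ j → del zero a (suc (suc zero)) j ≡ δ (suc (suc (suc (root t)))) j
  x-row zero = del-col zero a (suc (suc zero))
  x-row (suc j) = trans (del-other {v = zero} {suc (suc zero)} {suc j} a (λ ()) (λ ())) (x j)
    where
    x : ∀ j → a (suc (suc zero)) (suc j) ≡ δ (suc (suc (suc (root t)))) (suc j)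
    x zero = refl
    x (suc zero) = refl
    x (suc (suc j)) = first-bit t j
  outside : ∀ i y → (∀ j → ¬ (suc (suc (suc j)) ≡ y)) → del (suc (suc zero)) (del zero a) (suc (suc (suc i))) y ≡ + 0
  outside i zero p = trans (del-other {v = suc (suc zero)} {suc (suc (suc i))} {zero} (del zero a) (λ ()) (λ ())) (del-col zero a (suc (suc (suc i))))
  outside i (suc zero) p = trans (del-other {v = suc (suc zero)} {suc (suc (suc i))} {suc zero} (del zero a) (λ ()) (λ ())) (del-other {v = zero} {suc (suc (suc i))} {suc zero} a (λ ()) (λ ()))
  outside i (suc (suc zero)) p = del-col (suc (suc zero)) (del zero a) (suc (suc (suc i)))
  outside i (suc (suc (suc y))) p = ⊥-elim (p y refl)

threshold-sum : ∀ n a → sum {n} (λ j → bit (toℕ j <ᵇ a)) ≤ + a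
threshold-sum zero a = ≤-trans (≡⇒≤ (sum-zero _)) 0≤+
threshold-sum (suc n) zero = ≡⇒≤ (sum-0 (λ j → refl))
threshold-sum (suc n) (suc a) = ≤-trans (≡⇒≤ (sum-suc _)) (≤-trans (+-mono ≤-refl (threshold-sum n a)) (≡⇒≤ (sym (suc≡1+ a))))

-- The first summand reserves room for the edge from the root to its parent or to the clique, which
-- makes the bound inductive.
tree-degree : ∀ t i → bit (toℕ i <ᵇ 1) + sum (A (tree t) i) ≤ + 3
tree-degree tip zero = ≤-trans (≡⇒≤ (trans (cong₂ _+_ refl (trans (sum-suc _) (trans (R.+-identityˡ _) (sum-zero _)))) (R.+-identityʳ _))) (+≤+ (s≤s z≤n))
tree-degree (step t) zero = ≤-trans (+-mono ≤-refl (≤-trans (≡⇒≤ (trans (sum-suc _) (R.+-identityˡ _))) (threshold-sum (size t) 1))) two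
  where
  opaque
    unfolding _+_
    two : + 1 + + 1 ≤ + 3
    two = +≤+ (s≤s (s≤s z≤n))
tree-degree (step t) (suc i) = ≤-trans (≡⇒≤ (trans (R.+-identityˡ _) (sum-suc _))) (tree-degree t i)
tree-degree (fork t) zero = ≤-trans (+-mono ≤-refl (≤-trans (≡⇒≤ (trans (sum-suc _) (R.+-identityˡ _))) (threshold-sum _ 2))) three
  where
  opaque
    unfolding _+_
    three : + 1 + + 2 ≤ + 3
    three = ≤-refl
tree-degree (fork t) (suc zero) = ≤-trans (≡⇒≤ (trans (R.+-identityˡ _) (trans (sum-suc _) (cong₂ _+_ refl (sum-0 zeros))))) one
  where
  zeros : ∀ j → A (tree (fork t)) (suc zero) (suc j) ≡ + 0
  zeros zero = refl
  zeros (suc j) = refl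
  opaque
    unfolding _+_
    one : + 1 + + 0 ≤ + 3
    one = +≤+ (s≤s z≤n)
tree-degree (fork t) (suc (suc zero)) = ≤-trans (≡⇒≤ (trans (R.+-identityˡ _) (trans (sum-suc _) (cong₂ _+_ refl (trans (sum-suc _) (trans (R.+-identityˡ _) (trans (sum-suc _) (R.+-identityˡ _))))))))
    (≤-trans (+-mono ≤-refl (threshold-sum (size t) 1)) two)
  where
  opaque
    unfolding _+_
    two : + 1 + + 1 ≤ + 3
    two = +≤+ (s≤s (s≤s z≤n))
tree-degree (fork t) (suc (suc (suc i))) = ≤-trans (≡⇒≤ (trans (R.+-identityˡ _) (trans (sum-suc _) (trans (R.+-identityˡ _) (trans (sum-suc _) (trans (R.+-identityˡ _) (sum-suc _))))))) (tree-degree t i)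

-- Reading an embedding off a realization

record Embedding {m n} (G : Graph m) (o : Matrix n) : Set where
  no-eta-equality
  constructor embedding
  field
    fn : Fin m → Fin n
    injective : Injective fn
    agree : ∀ i j → o (fn i) (fn j) ≡ A G i j

module _ {m n} {G : Graph m} {o : Matrix n} (so : Symmetric o) (E : Embedding G o) (u : Fin n) (open-u : o u u ≡ + 0)
         (fresh : ∀ i → ¬ (Embedding.fn E i ≡ u)) (a : ℕ) (new : ∀ i → o u (Embedding.fn E i) ≡ bit (toℕ i <ᵇ a)) where

  open Embedding E

  extend : Embedding (ext a G) o
  extend = embedding f f-inj f-agree
    where
    f : Fin (suc m) → Fin n
    f zero = u
    f (suc i) = fn i
    f-inj : Injective f
    f-inj {zero} {zero} e = refl
    f-inj {zero} {suc j} e = ⊥-elim (fresh j (sym e))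
    f-inj {suc i} {zero} e = ⊥-elim (fresh i e)
    f-inj {suc i} {suc j} e = cong suc (injective e)
    f-agree : ∀ i j → o (f i) (f j) ≡ A (ext a G) i j
    f-agree zero zero = open-u
    f-agree zero (suc j) = new j
    f-agree (suc i) zero = trans (so (fn i) u) (new i)
    f-agree (suc i) (suc j) = agree i j

record RootedEmbedding {n} (t : Code) (o : Matrix n) (r : Fin n) : Set where
  no-eta-equality
  constructor rooted
  field
    emb : Embedding (tree t) o
  open Embedding emb public
  field
    fn-root : fn (root t) ≡ r
    -- Deleted vertices have become isolated, so this shows that the image of a subtree misses the
    -- vertices above it.
    avoids : ∀ u → ¬ (u ≡ r) → (∀ j → o u j ≡ + 0) → ∀ i → ¬ (fn i ≡ u)

1≢0 : ¬ (+ 1 ≡ + 0)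
1≢0 ()

del-zero-row : ∀ {n} (v : Fin n) (o : Matrix n) u → (∀ j → o u j ≡ + 0) → ∀ j → del v o u j ≡ + 0
del-zero-row v o u z j = trans (cong₂ _*_ refl (trans (cong₂ _*_ refl (z j)) (R.zeroʳ _))) (R.zeroʳ _)

root-row : ∀ {n} {t} {o : Matrix n} {c} (I : RootedEmbedding t o c) (v : Fin n → ℤ) → (∀ j → v j ≡ δ c j) → ∀ i → v (RootedEmbedding.fn I i) ≡ bit (toℕ i <ᵇ 1)
root-row {t = t} I v e i = trans (e (I.fn i)) (trans (cong (λ y → δ y (I.fn i)) (sym I.fn-root)) (trans (δ-injective I.injective (root t) i) (sym (first-bit t i))))
  where module I = RootedEmbedding I

embed : ∀ t {n} {b} {o : Matrix n} → Bounded b o → ∀ r → Realizes t o r → RootedEmbedding t o r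
embed tip {o = o} B r z = rooted (embedding (λ _ → r) (λ { {zero} {zero} _ → refl }) (λ { zero zero → z r })) refl (λ u p _ _ q → p (sym q))
embed (step t) {o = o} B r (c , e , real) = rooted (extend o-sym E r (o-diag r) fresh 1 new) refl avoids
  where
  open Bounded B
  ih : RootedEmbedding t (del r o) c
  ih = embed t (del-bounded r B) c real
  module I = RootedEmbedding ih
  r≢c : ¬ (r ≡ c)
  r≢c p = 1≢0 (trans (sym (trans (e c) (δ-refl c))) (trans (cong (o r) (sym p)) (o-diag r)))
  fresh : ∀ i → ¬ (I.fn i ≡ r)
  fresh = I.avoids r r≢c (del-row r o)
  E : Embedding (tree t) o
  E = embedding I.fn I.injective (λ i j → trans (sym (del-other o (λ p → fresh i (sym p)) (λ p → fresh j (sym p)))) (I.agree i j))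
  new : ∀ i → o r (I.fn i) ≡ bit (toℕ i <ᵇ 1)
  new = root-row ih (o r) e
  avoids : ∀ u → ¬ (u ≡ r) → (∀ j → o u j ≡ + 0) → ∀ i → ¬ (Embedding.fn (extend o-sym E r (o-diag r) fresh 1 new) i ≡ u)
  avoids u p z zero q = p (sym q)
  avoids u p z (suc i) q = I.avoids u u≢c (del-zero-row r o u z) i q
    where
    u≢c : ¬ (u ≡ c)
    u≢c refl = 1≢0 (trans (sym (trans (e u) (δ-refl u))) (trans (o-sym r u) (z r)))
embed (fork t) {o = o} B r (leaf , x , c , e , leaf-row , ex , real) = rooted E₃ refl avoids
  where
  open Bounded B
  o′ : Matrix _
  o′ = del r o
  B′ : Bounded _ o′
  B′ = del-bounded r B
  module B′ = Bounded B′
  ih : RootedEmbedding t (del x o′) c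
  ih = embed t (del-bounded x B′) c real
  module I = RootedEmbedding ih
  distinct : ¬ (leaf ≡ x)
  distinct = Root.two-distinct B r e
  r-leaf : o r leaf ≡ + 1
  r-leaf = trans (e leaf) (trans (cong₂ _+_ (δ-refl leaf) (δ-≢ {i = x} {leaf} (λ p → distinct (sym p)))) (R.+-identityʳ _))
  r-x : o r x ≡ + 1
  r-x = trans (e x) (trans (cong₂ _+_ (δ-≢ {i = leaf} {x} distinct) (δ-refl x)) (R.+-identityˡ _))
  x-c : o′ x c ≡ + 1
  x-c = trans (ex c) (δ-refl c)
  leaf≢r : ¬ (leaf ≡ r)
  leaf≢r p = 1≢0 (trans (sym r-leaf) (trans (cong (o r) p) (o-diag r)))
  x≢r : ¬ (x ≡ r)
  x≢r p = 1≢0 (trans (sym r-x) (trans (cong (o r) p) (o-diag r)))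
  c≢r : ¬ (c ≡ r)
  c≢r p = 1≢0 (trans (sym x-c) (trans (cong (o′ x) p) (del-col r o x)))
  c≢x : ¬ (c ≡ x)
  c≢x p = 1≢0 (trans (sym x-c) (trans (cong (o′ x) p) (B′.o-diag x)))
  c≢leaf : ¬ (c ≡ leaf)
  c≢leaf p = 1≢0 (trans (sym x-c) (trans (cong (o′ x) p) (trans (B′.o-sym x leaf) (leaf-row x))))
  ≢r : ∀ i → ¬ (I.fn i ≡ r)
  ≢r = I.avoids r (λ p → c≢r (sym p)) (del-zero-row x o′ r (del-row r o))
  ≢x : ∀ i → ¬ (I.fn i ≡ x)
  ≢x = I.avoids x (λ p → c≢x (sym p)) (del-row x o′)
  ≢leaf : ∀ i → ¬ (I.fn i ≡ leaf)
  ≢leaf = I.avoids leaf (λ p → c≢leaf (sym p)) (del-zero-row x o′ leaf leaf-row)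
  E : Embedding (tree t) o
  E = embedding I.fn I.injective (λ i j → trans (sym (trans (del-other o′ (λ p → ≢x i (sym p)) (λ p → ≢x j (sym p))) (del-other o (λ p → ≢r i (sym p)) (λ p → ≢r j (sym p))))) (I.agree i j))
  x-new : ∀ i → o x (I.fn i) ≡ bit (toℕ i <ᵇ 1)
  x-new i = trans (sym (del-other {v = r} {x} {I.fn i} o (λ p → x≢r (sym p)) (λ p → ≢r i (sym p)))) (root-row ih (o′ x) ex i)
  E₁ : Embedding (ext 1 (tree t)) o
  E₁ = extend o-sym E x (o-diag x) ≢x 1 x-new
  fresh₁ : ∀ i → ¬ (Embedding.fn E₁ i ≡ leaf)
  fresh₁ zero p = distinct (sym p)
  fresh₁ (suc i) p = ≢leaf i p
  new₁ : ∀ i → o leaf (Embedding.fn E₁ i) ≡ bit (toℕ i <ᵇ 0)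
  new₁ zero = trans (sym (del-other o (λ p → leaf≢r (sym p)) (λ p → x≢r (sym p)))) (leaf-row x)
  new₁ (suc i) = trans (sym (del-other o (λ p → leaf≢r (sym p)) (λ p → ≢r i (sym p)))) (leaf-row (I.fn i))
  E₂ : Embedding (ext 0 (ext 1 (tree t))) o
  E₂ = extend o-sym E₁ leaf (o-diag leaf) fresh₁ 0 new₁
  fresh₂ : ∀ i → ¬ (Embedding.fn E₂ i ≡ r)
  fresh₂ zero p = leaf≢r p
  fresh₂ (suc zero) p = x≢r p
  fresh₂ (suc (suc i)) p = ≢r i p
  new₂ : ∀ i → o r (Embedding.fn E₂ i) ≡ bit (toℕ i <ᵇ 2)
  new₂ zero = r-leaf
  new₂ (suc zero) = r-x
  new₂ (suc (suc i)) = trans (e (I.fn i)) (trans (cong₂ _+_ (δ-≢ {i = leaf} {I.fn i} (λ p → ≢leaf i (sym p))) (δ-≢ {i = x} {I.fn i} (λ p → ≢x i (sym p)))) (R.+-identityˡ _))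
  E₃ : Embedding (tree (fork t)) o
  E₃ = extend o-sym E₂ r (o-diag r) fresh₂ 2 new₂
  avoids : ∀ u → ¬ (u ≡ r) → (∀ j → o u j ≡ + 0) → ∀ i → ¬ (Embedding.fn E₃ i ≡ u)
  avoids u p z zero q = p (sym q)
  avoids u p z (suc zero) q = 1≢0 (trans (sym r-leaf) (trans (o-sym r leaf) (trans (cong (λ y → o y r) q) (z r))))
  avoids u p z (suc (suc zero)) q = 1≢0 (trans (sym r-x) (trans (o-sym r x) (trans (cong (λ y → o y r) q) (z r))))
  avoids u p z (suc (suc (suc i))) q = I.avoids u u≢c (del-zero-row x o′ u (del-zero-row r o u z)) i q
    where
    u≢c : ¬ (u ≡ c)
    u≢c refl = 1≢0 (trans (sym x-c) (trans (B′.o-sym x u) (del-zero-row r o u z x)))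

-- The root has 0, 1 or 2 children according to the constructor. In a fork the leaf is told from the
-- other child by its empty row.
Realizes-unique : ∀ t t′ {n} {b} {o : Matrix n} → Bounded b o → ∀ r → Realizes t o r → Realizes t′ o r → t ≡ t′
Realizes-unique t t′ {o = o} B r p q = go t t′ B r p q
  where
  sums : ∀ {n} {f g : Fin n → ℤ} → (∀ j → f j ≡ g j) → ∀ {x y} → sum f ≡ x → sum g ≡ y → x ≡ y
  sums e p q = trans (sym p) (trans (sum-cong e) q)
  δ-eq : ∀ {n} {c c′ : Fin n} → (∀ j → δ c j ≡ δ c′ j) → c ≡ c′
  δ-eq {c = c} {c′} e with δ-split c c′
  ... | inj₁ (p , _) = p
  ... | inj₂ (_ , z) = ⊥-elim (1≢0 (trans (sym (δ-refl c′)) (trans (sym (e c′)) z)))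
  sum-two : ∀ {n} (c c′ : Fin n) → sum (λ j → δ c j + δ c′ j) ≡ + 1 + + 1
  sum-two c c′ = trans (sum-+ _ _) (cong₂ _+_ (sum-δ c) (sum-δ c′))
  opaque
    unfolding _+_
    0≢2 : ¬ (+ 0 ≡ + 1 + + 1)
    0≢2 ()
    1≢2 : ¬ (+ 1 ≡ + 1 + + 1)
    1≢2 ()
  go : ∀ t t′ {n} {b} {o : Matrix n} → Bounded b o → ∀ r → Realizes t o r → Realizes t′ o r → t ≡ t′
  go tip tip B r p q = refl
  go tip (step t′) B r p (c , e , _) = ⊥-elim (1≢0 (sym (sums {g = δ c} (λ j → trans (sym (p j)) (e j)) (sum-0 (λ _ → refl)) (sum-δ c))))
  go tip (fork t′) B r p (y , x , c , e , _) = ⊥-elim (0≢2 (sums (λ j → trans (sym (p j)) (e j)) (sum-0 (λ _ → refl)) (sum-two y x)))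
  go (step t) tip B r (c , e , _) p = ⊥-elim (1≢0 (sums {f = δ c} (λ j → trans (sym (e j)) (p j)) (sum-δ c) (sum-0 (λ _ → refl))))
  go (fork t) tip B r (y , x , c , e , _) p = ⊥-elim (0≢2 (sym (sums (λ j → trans (sym (e j)) (p j)) (sum-two y x) (sum-0 (λ _ → refl)))))
  go (step t) (fork t′) B r (c , e , _) (y , x , _ , e′ , _) = ⊥-elim (1≢2 (sums {f = δ c} (λ j → trans (sym (e j)) (e′ j)) (sum-δ c) (sum-two y x)))
  go (fork t) (step t′) B r (y , x , _ , e , _) (c , e′ , _) = ⊥-elim (1≢2 (sym (sums {g = δ c} (λ j → trans (sym (e j)) (e′ j)) (sum-two y x) (sum-δ c))))
  go (step t) (step t′) B r (c , e , p) (c′ , e′ , p′) with δ-eq {c = c} {c′} (λ j → trans (sym (e j)) (e′ j))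
  ... | refl = cong step (go t t′ (del-bounded r B) c p p′)
  go (fork t) (fork t′) {o = o} B r (y , x , c , e , z , ex , p) (y′ , x′ , c′ , e′ , z′ , ex′ , p′) with same-child
    where
    same-child : x ≡ x′
    same-child with δ-split y′ x | δ-split x′ x
    ... | _ | inj₁ (q , _) = sym q
    ... | inj₁ (refl , _) | inj₂ _ = ⊥-elim (1≢0 (trans (sym (δ-refl c)) (trans (sym (ex c)) (z′ c))))
    ... | inj₂ (_ , d) | inj₂ (_ , d′) = ⊥-elim (1≢0 (trans (sym (trans (e x) (trans (cong₂ _+_ (δ-≢ {i = y} {x} (Root.two-distinct B r e)) (δ-refl x)) (R.+-identityˡ _)))) (trans (e′ x) (trans (cong₂ _+_ d d′) (R.+-identityˡ _)))))
  ... | refl with δ-eq {c = c} {c′} (λ j → trans (sym (ex j)) (ex′ j))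
  ... | refl = cong fork (go t t′ (del-bounded x (del-bounded r B)) c p p′)

-- The lollipop graphs and their moments

sum-split : ∀ d {m} (f : Fin (d ℕ.+ m) → ℤ) → sum f ≡ sum (λ i → f (i ↑ˡ m)) + sum (λ j → f (d ↑ʳ j))
sum-split zero f = trans (sym (R.+-identityˡ _)) (cong₂ _+_ (sym (sum-zero _)) refl)
sum-split (suc d) f = trans (sum-suc f) (trans (cong₂ _+_ refl (sum-split d (λ i → f (suc i)))) (trans (sym (R.+-assoc _ _ _)) (cong₂ _+_ (sym (sum-suc _)) refl)))

module Lollipop (k : ℕ) (t : Code) where

  d m : ℕ
  d = suc k
  m = size t

  adjacent : Fin d ⊎ Fin m → Fin d ⊎ Fin m → Bool
  adjacent (inj₁ i) (inj₁ j) = not (does (i ≟ j))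
  adjacent (inj₁ i) (inj₂ j) = does (zero ≟ i) ∧ does (root t ≟ j)
  adjacent (inj₂ i) (inj₁ j) = does (zero ≟ j) ∧ does (root t ≟ i)
  adjacent (inj₂ i) (inj₂ j) = adj (tree t) i j

  private
    ≟-sym : ∀ {n} (i j : Fin n) → does (i ≟ j) ≡ does (j ≟ i)
    ≟-sym i j = bit-injective _ _ (δ-sym i j)

    ≟-refl : ∀ {n} (i : Fin n) → does (i ≟ i) ≡ true
    ≟-refl i = bit-injective _ _ (δ-refl i)

    adjacent-sym : ∀ x y → adjacent x y ≡ adjacent y x
    adjacent-sym (inj₁ i) (inj₁ j) = cong not (≟-sym i j)
    adjacent-sym (inj₁ i) (inj₂ j) = refl
    adjacent-sym (inj₂ i) (inj₁ j) = refl
    adjacent-sym (inj₂ i) (inj₂ j) = Graph.sym (tree t) i j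

    adjacent-irrefl : ∀ x → adjacent x x ≡ false
    adjacent-irrefl (inj₁ i) = cong not (≟-refl i)
    adjacent-irrefl (inj₂ i) = Graph.irrefl (tree t) i

  graph : Graph (d ℕ.+ m)
  graph = record
    { adj = λ x y → adjacent (splitAt d x) (splitAt d y)
    ; sym = λ x y → adjacent-sym (splitAt d x) (splitAt d y)
    ; irrefl = λ x → adjacent-irrefl (splitAt d x) }

  a : Matrix (d ℕ.+ m)
  a = A graph

  L : Fin d → Fin (d ℕ.+ m)
  L i = i ↑ˡ m

  T : Fin m → Fin (d ℕ.+ m)
  T j = d ↑ʳ j

  elim : (Q : Fin (d ℕ.+ m) → Set) → (∀ i → Q (L i)) → (∀ j → Q (T j)) → ∀ x → Q x
  elim Q p q x = subst Q (join-splitAt d m x) (go (splitAt d x))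
    where
    go : ∀ s → Q (join d m s)
    go (inj₁ i) = p i
    go (inj₂ j) = q j

  a-LL : ∀ i j → a (L i) (L j) ≡ + 1 - δ i j
  a-LL i j = trans (cong₂ (λ x y → bit (adjacent x y)) (splitAt-↑ˡ d i m) (splitAt-↑ˡ d j m)) (neg (does (i ≟ j)))
    where
    opaque
      unfolding _+_ -_
      neg : ∀ b → bit (not b) ≡ + 1 - bit b
      neg false = refl
      neg true = refl

  bit-∧ : ∀ b c → bit (b ∧ c) ≡ bit b * bit c
  bit-∧ false c = sym (R.zeroˡ _)
  bit-∧ true c = sym (R.*-identityˡ _)

  a-LT : ∀ i j → a (L i) (T j) ≡ δ zero i * δ (root t) j
  a-LT i j = trans (cong₂ (λ x y → bit (adjacent x y)) (splitAt-↑ˡ d i m) (splitAt-↑ʳ d m j)) (bit-∧ _ _)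

  a-TL : ∀ j i → a (T j) (L i) ≡ δ zero i * δ (root t) j
  a-TL j i = trans (A-sym graph (T j) (L i)) (a-LT i j)

  a-TT : ∀ i j → a (T i) (T j) ≡ A (tree t) i j
  a-TT i j = cong₂ (λ x y → bit (adjacent x y)) (splitAt-↑ʳ d m i) (splitAt-↑ʳ d m j)

  l : Fin (d ℕ.+ m) → ℤ
  l x = [ (λ _ → + 1) , (λ _ → + 0) ]′ (splitAt d x)

  l-L : ∀ i → l (L i) ≡ + 1
  l-L i = cong [ (λ _ → + 1) , (λ _ → + 0) ]′ (splitAt-↑ˡ d i m)

  l-T : ∀ j → l (T j) ≡ + 0
  l-T j = cong [ (λ _ → + 1) , (λ _ → + 0) ]′ (splitAt-↑ʳ d m j)

  δ-LL : ∀ i j → δ (L i) (L j) ≡ δ i j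
  δ-LL = δ-injective (λ {i} {j} → ↑ˡ-injective m i j)

  δ-TT : ∀ i j → δ (T i) (T j) ≡ δ i j
  δ-TT = δ-injective (λ {i} {j} → ↑ʳ-injective d i j)

  L≢T : ∀ {i j} → ¬ (L i ≡ T j)
  L≢T {i} {j} e = 1≢0 (trans (sym (l-L i)) (trans (cong l e) (l-T j)))

  δ-LT : ∀ i j → δ (L i) (T j) ≡ + 0
  δ-LT i j = δ-≢ {i = L i} {T j} L≢T

  private
    e₁ = solve 1 (λ x → ♯ 1 :* (♯ 1 :* (♯ 1 :- x :+ x)) := ♯ 1 :* ♯ 1) refl
    e₂ = solve 1 (λ x → ♯ 1 :* (♯ 0 :* x) := ♯ 1 :* ♯ 0) refl
    e₃ = solve 2 (λ x y → ♯ 0 :* (y :* x) := ♯ 0 :* y) refl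
    e₄ = solve 2 (λ x y → ♯ 1 :* ((♯ 1 :- x) :* (♯ 1 :- ♯ 1)) := y :* ♯ 0) refl
    e₅ = solve 1 (λ x → ♯ 1 :* (x :* (♯ 1 :- ♯ 0)) := x) refl
    e₆ = solve 2 (λ x y → ♯ 0 :* x := ♯ 0 :* y) refl

  full : ∀ x y → l x * (l y * loops a x y) ≡ l x * l y
  full = elim _ (λ i → elim _ (λ j → trans (cong₂ _*_ (l-L i) (cong₂ _*_ (l-L j) (cong₂ _+_ (a-LL i j) (δ-LL i j)))) (trans (e₁ _) (sym (cong₂ _*_ (l-L i) (l-L j)))))
      (λ j → trans (cong₂ _*_ (l-L i) (cong₂ _*_ (l-T j) refl)) (trans (e₂ _) (sym (cong₂ _*_ (l-L i) (l-T j))))))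
    (λ i y → trans (cong₂ _*_ (l-T i) refl) (trans (e₃ _ (l y)) (sym (cong₂ _*_ (l-T i) refl))))

  r v : Fin (d ℕ.+ m)
  r = T (root t)
  v = L zero

  split : Split a (+ d)
  split = record
    { a-sym = A-sym graph ; a-bit = λ x y → bit-Bit _ ; a-diag = A-diag graph ; l = l
    ; l-bit = elim _ (λ i → inj₂ (l-L i)) (λ j → inj₁ (l-T j))
    ; l-sum = trans (sum-split d l) (trans (cong₂ _+_ (trans (sum-cong l-L) (sum-1 d)) (sum-0 l-T)) (R.+-identityʳ _))
    ; l-full = full ; v = v ; l-v = l-L zero ; ρ = δ r ; ρ-nonneg = λ j → bit-≥0 (bit-Bit (does (r ≟ j)))
    ; cross = elim _ (λ i → elim _ (λ j → trans (cong₂ _*_ (l-L i) (cong₂ _*_ (a-LL i j) (cong₂ _-_ refl (l-L j)))) (trans (e₄ _ (δ v (L i))) (cong₂ _*_ refl (sym (trans (δ-sym r (L j)) (δ-LT j (root t)))))))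
          (λ j → trans (cong₂ _*_ (l-L i) (cong₂ _*_ (a-LT i j) (cong₂ _-_ refl (l-T j)))) (trans (e₅ _) (sym (cong₂ _*_ (δ-LL zero i) (δ-TT (root t) j))))))
        (λ i y → trans (cong₂ _*_ (l-T i) refl) (trans (e₆ _ (δ r y)) (cong₂ _*_ (sym (δ-LT zero i)) refl))) }

  open Split split using (outer; l-bit; l-sum)

  realizes : Realizes t outer r
  realizes = Realizes-map t T (λ {i} {j} → ↑ʳ-injective d i j) (λ i j → trans (cong₂ (λ x y → (+ 1 - x) * ((+ 1 - y) * a (T i) (T j))) (l-T i) (l-T j)) (trans (e _) (a-TT i j)))
      (λ i → elim _ (λ j _ → trans (cong (λ x → (+ 1 - l (T i)) * ((+ 1 - x) * a (T i) (L j))) (l-L j)) (e′ _ _)) (λ j p → ⊥-elim (p j refl))) (root t) (tree-realizes t)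
    where
    e = solve 1 (λ x → (♯ 1 :- ♯ 0) :* ((♯ 1 :- ♯ 0) :* x) := x) refl
    e′ = solve 2 (λ x y → x :* ((♯ 1 :- ♯ 1) :* y) := ♯ 0) refl

  private
    M : Matrix (d ℕ.+ m)
    M = loops a

    sM : Symmetric M
    sM x y = cong₂ _+_ (A-sym graph x y) (δ-sym x y)

  module Bk = Block M sM l (λ x → bit-idem (l-bit x)) (+ d) l-sum full
  open Bk using (rest; out; P)

  private
    f₁ = solve 1 (λ x → ♯ 1 :- x :+ x :- ♯ 1 :* ♯ 1 := ♯ 0) refl
    f₂ = solve 1 (λ x → x :+ ♯ 0 :- ♯ 1 :* ♯ 0 := x) refl
    f₃ = solve 1 (λ x → x :+ ♯ 0 :- ♯ 0 :* ♯ 1 := x) refl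
    f₄ = solve 2 (λ x y → x :+ y :- ♯ 0 :* ♯ 0 := x :+ y) refl

  rest-LL : ∀ i j → rest (L i) (L j) ≡ + 0
  rest-LL i j = trans (cong₂ _-_ (cong₂ _+_ (a-LL i j) (δ-LL i j)) (cong₂ _*_ (l-L i) (l-L j))) (f₁ _)

  rest-LT : ∀ i j → rest (L i) (T j) ≡ δ zero i * δ (root t) j
  rest-LT i j = trans (cong₂ _-_ (cong₂ _+_ (a-LT i j) (δ-LT i j)) (cong₂ _*_ (l-L i) (l-T j))) (f₂ _)

  rest-TL : ∀ j i → rest (T j) (L i) ≡ δ zero i * δ (root t) j
  rest-TL j i = trans (cong₂ _-_ (cong₂ _+_ (a-TL j i) (trans (δ-sym (T j) (L i)) (δ-LT i j))) (cong₂ _*_ (l-T j) (l-L i))) (f₃ _)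

  rest-TT : ∀ i j → rest (T i) (T j) ≡ A (tree t) i j + δ i j
  rest-TT i j = trans (cong₂ _-_ (cong₂ _+_ (a-TT i j) (δ-TT i j)) (cong₂ _*_ (l-T i) (l-T j))) (f₄ _ _)

  rest-bit : ∀ x y → Bit (rest x y)
  rest-bit = elim _ (λ i → elim _ (λ j → inj₁ (rest-LL i j)) (λ j → subst Bit (sym (rest-LT i j)) (prod _ _)))
    (λ i → elim _ (λ j → subst Bit (sym (rest-TL i j)) (prod _ _)) (λ j → subst Bit (sym (rest-TT i j)) (closed-bit i j)))
    where
    prod : ∀ b c → Bit (bit b * bit c)
    prod b c = subst Bit (bit-∧ b c) (bit-Bit (b ∧ c))
    closed-bit : ∀ i j → Bit (A (tree t) i j + δ i j)
    closed-bit i j with δ-split i j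
    ... | inj₁ (refl , e) = inj₂ (trans (cong₂ _+_ (A-diag (tree t) i) e) (R.+-identityˡ _))
    ... | inj₂ (_ , e) = subst Bit (sym (trans (cong₂ _+_ refl e) (R.+-identityʳ _))) (bit-Bit _)

  row-L : ∀ i → sum (rest (L i)) ≡ δ zero i
  row-L i = trans (sum-split d _) (trans (cong₂ _+_ (sum-0 (rest-LL i)) (trans (sum-cong (rest-LT i)) (trans (sum-*ˡ (δ zero i) _) (trans (cong₂ _*_ refl (sum-δ (root t))) (R.*-identityʳ _))))) (R.+-identityˡ _))

  row-T : ∀ j → sum (rest (T j)) ≤ + 4
  row-T j = ≤-trans (≡⇒≤ (trans (sum-split d _) (trans (cong₂ _+_ (trans (sum-cong (rest-TL j)) (trans (sum-*ʳ (δ (root t) j) _) (trans (cong₂ _*_ (sum-δ {d} zero) refl) (trans (R.*-identityˡ _) (sym (first-bit t j))))))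
      (trans (sum-cong (rest-TT j)) (trans (sum-+ _ _) (cong₂ _+_ refl (sum-δ j))))) (sym (R.+-assoc _ _ _))))) (≤-trans (+-mono (tree-degree t j) ≤-refl) four)
    where
    opaque
      unfolding _+_
      four : + 3 + + 1 ≤ + 4
      four = ≤-refl

  δ≤1 : ∀ {n} (i j : Fin n) → δ i j ≤ + 1
  δ≤1 i j with δ-split i j
  ... | inj₁ (_ , e) = ≡⇒≤ e
  ... | inj₂ (_ , e) = ≤-trans (≡⇒≤ e) 0≤+

  rows : ∀ x → sum (rest x) ≤ + 5
  rows = elim _ (λ i → ≤-trans (≡⇒≤ (row-L i)) (≤-trans (δ≤1 zero i) (+≤+ (s≤s z≤n)))) (λ j → ≤-trans (row-T j) (+≤+ (s≤s (s≤s (s≤s (s≤s z≤n))))))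

  P≡1 : P ≡ + 1
  P≡1 = trans (sum-split d _) (trans (cong₂ _+_ (sum-0 (λ i → trans (cong₂ _*_ (out-L i) refl) (R.zeroˡ _))) (trans (sum-cong (λ j → cong₂ _*_ (out-T j) (out-T j))) (trans (sum-δˡ (root t) (δ (root t))) (δ-refl (root t))))) (R.+-identityˡ _))
    where
    out-L : ∀ i → out (L i) ≡ + 0
    out-L i = trans (sum-split d _) (trans (cong₂ _+_ (sum-0 (λ j → trans (cong₂ _*_ (rest-LL i j) refl) (R.zeroˡ _))) (sum-0 (λ j → trans (cong₂ _*_ refl (l-T j)) (R.zeroʳ _)))) (R.+-identityˡ _))
    out-T : ∀ j → out (T j) ≡ δ (root t) j
    out-T j = trans (sum-split d _) (trans (cong₂ _+_ (trans (sum-cong (λ i → trans (cong₂ _*_ (rest-TL j i) (l-L i)) (R.*-identityʳ _))) (trans (sum-*ʳ _ _) (trans (cong₂ _*_ (sum-δ {d} zero) refl) (R.*-identityˡ _))))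
      (sum-0 (λ i → trans (cong₂ _*_ refl (l-T i)) (R.zeroʳ _)))) (R.+-identityʳ _))

  module Bounds = BlockBounds M sM l (λ x → bit-idem (l-bit x)) (+ d) l-sum full 0≤+
  module Bd = Bounds.Sparse (λ x y → bit-≥0 (rest-bit x y)) (λ x y → bit-idem (rest-bit x y)) rows P≡1

  1≤m : + 1 ≤ + m
  1≤m = +≤+ (positive t)
    where
    positive : ∀ t → 1 ℕ.≤ size t
    positive tip = s≤s z≤n
    positive (step t) = s≤s z≤n
    positive (fork t) = s≤s z≤n

  -- The clique rows of `rest` sum to 1 altogether and each tail row to at most 4; the constant 10
  -- is not sharp.
  weight≤ : Bd.weight ≤ + 10 * + m
  weight≤ = ≤-trans (≡⇒≤ (trans (sum-split d _) (cong₂ _+_ (trans (sum-cong row-L) (sum-δ {d} zero)) refl)))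
    (≤-trans (+-mono ≤-refl (≤-trans (sum-mono (λ j → ≤-trans (row-T j) (≡⇒≤ (sym (R.*-identityʳ (+ 4)))))) (≡⇒≤ (trans (sum-*ˡ (+ 4) _) (cong₂ _*_ refl (sum-1 m))))))
      (≤-by (≤-diff 1≤m ⊞ 0≤+ {5} ⊠ 0≤+ {m}) (eq (+ m))))
    where
    eq = solve 1 (λ m → ♯ 10 :* m :- (♯ 1 :+ ♯ 4 :* m) := (m :- ♯ 1) :+ ♯ 5 :* m) refl

  module _ (big : + 200000 * + m ≤ + d) where

    private
      dℤ W t′ V : ℤ
      dℤ = + d
      W = Bd.weight
      t′ = + m
      V = ⟨ defect dℤ M , defect dℤ M ⟩

      eqV = solve 3 (λ d w t → ♯ 48 :* (d :* d :* t) :- (♯ 8 :* d :+ ♯ 100 :* w :+ ♯ 4 :* (d :* d :* w)) := ♯ 100 :* (♯ 10 :* t :- w) :+ ♯ 4 :* (d :* d :* (♯ 10 :* t :- w)) :+ (♯ 8 :* (d :* d :* (t :- ♯ 1)) :+ ((d :- ♯ 1000 :* t) :+ d :* (♯ 8 :* (d :- ♯ 2) :+ ♯ 7)))) refl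
      eqF = solve 3 (λ d v t → ♯ 2450 :* (d :* d :* t) :- (♯ 50 :* d :+ ♯ 50 :* v) := ♯ 50 :* (♯ 48 :* (d :* d :* t) :- v) :+ ♯ 50 :* (d :* d :* (t :- ♯ 1) :+ d :* ((d :- ♯ 2) :+ ♯ 1))) refl
      eq₁ = solve 2 (λ d t → d :- ♯ 1000 :* t := (d :- ♯ 200000 :* t) :+ ♯ 199000 :* t) refl
      eq₂ = solve 2 (λ d t → d :- ♯ 2 := (d :- ♯ 1000 :* t) :+ (♯ 998 :* t :+ ♯ 2 :* (t :- ♯ 1))) refl

      0≤dℤ : + 0 ≤ dℤ
      0≤dℤ = 0≤+

      1000t≤d : + 1000 * t′ ≤ dℤ
      1000t≤d = ≤-by (≤-diff big ⊞ 0≤+ {199000} ⊠ 0≤+ {m}) (eq₁ dℤ t′)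

      2≤d : + 2 ≤ dℤ
      2≤d = ≤-by (≤-diff 1000t≤d ⊞ (0≤+ {998} ⊠ 0≤+ {m} ⊞ 0≤+ {2} ⊠ ≤-diff 1≤m)) (eq₂ dℤ t′)

      excess-t : + 0 ≤ dℤ * dℤ * (t′ - + 1)
      excess-t = 0≤dℤ ⊠ 0≤dℤ ⊠ ≤-diff 1≤m

    -- The main term 4 d² w of `defect-bound` gives 40 d² t by `weight≤`; a further 8 d² t absorbs
    -- the terms of lower order.
    V≤ : V ≤ + 48 * (dℤ * dℤ * t′)
    V≤ = ≤-trans Bd.defect-bound (≤-by (0≤+ {100} ⊠ ≤-diff weight≤ ⊞ 0≤+ {4} ⊠ (0≤dℤ ⊠ 0≤dℤ ⊠ ≤-diff weight≤) ⊞ (0≤+ {8} ⊠ excess-t ⊞ (≤-diff 1000t≤d ⊞ 0≤dℤ ⊠ (0≤+ {8} ⊠ ≤-diff 2≤d ⊞ 0≤+ {7}))))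
      (eqV dℤ W t′))

    -- 2450 is 50 times 48 plus 50 for the linear term.
    F≤ : ⟨ M · defect dℤ M , M · defect dℤ M ⟩ ≤ + 2450 * (dℤ * dℤ * t′)
    F≤ = ≤-trans Bd.defect₂-bound (≤-by (0≤+ {50} ⊠ ≤-diff V≤ ⊞ 0≤+ {50} ⊠ (excess-t ⊞ 0≤dℤ ⊠ (≤-diff 2≤d ⊞ 0≤+ {1}))) (eqF dℤ V t′))

-- Cliques with a coded tail

module _ {n} {a : Matrix n} {d : ℤ} (S : Split a d) where
  open Split S

  outer-bit : ∀ i j → Bit (outer i j)
  outer-bit i j with l-bit i | l-bit j
  ... | inj₂ e | _ = inj₁ (s-outer i j e)
  ... | inj₁ _ | inj₂ e = inj₁ (trans (outer-sym i j) (s-outer j i e))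
  ... | inj₁ e | inj₁ e′ = subst Bit (sym (outside e e′)) (a-bit i j)
    where
    eq = solve 1 (λ x → (♯ 1 :- ♯ 0) :* ((♯ 1 :- ♯ 0) :* x) := x) refl
    outside : l i ≡ + 0 → l j ≡ + 0 → outer i j ≡ a i j
    outside e e′ = trans (cong₂ (λ x y → (+ 1 - x) * ((+ 1 - y) * a i j)) e e′) (eq _)

  outer-inside : ∀ {i j} → l i ≡ + 0 → l j ≡ + 0 → outer i j ≡ a i j
  outer-inside {i} {j} e e′ = trans (cong₂ (λ x y → (+ 1 - x) * ((+ 1 - y) * a i j)) e e′) (eq _)
    where
    eq = solve 1 (λ x → (♯ 1 :- ♯ 0) :* ((♯ 1 :- ♯ 0) :* x) := x) refl

  outer-bounded : ∀ {b} → + n ≡ d + b → Bounded b outer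
  outer-bounded {b} n≡ = record { o-sym = outer-sym ; o-bit = outer-bit ; o-diag = outer-diag ; o-rows = λ i → ≤-trans (sum-mono (outer≤s i)) (≡⇒≤ s-sum) }
    where
    s-sum : sum s ≡ b
    s-sum = trans (sum-+ _ _) (trans (cong₂ _+_ (sum-1 n) (trans (sum-neg _) (cong -_ l-sum))) (trans (cong₂ _-_ n≡ refl) (eq d b)))
      where
      eq = solve 2 (λ d b → d :+ b :- d := b) refl

  J-walks : ∀ {r} → (∀ j → ρ j ≡ δ r j) → J ≈ walks outer r
  J-walks {r} e k = trans (sum-cong (λ i → cong₂ _*_ (e i) (trans (sum-cong (λ j → cong₂ _*_ refl (trans (e j) (δ-sym r j)))) (sum-δʳ r (pow outer k i))))) (sum-δˡ r (λ i → pow outer k i r))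

record Chain {n} (a : Matrix n) (d : ℤ) (t : Code) : Set where
  no-eta-equality
  field
    split : Split a d
    r : Fin n
    ρ≡δ : ∀ j → Split.ρ split j ≡ δ r j
    realizes : Realizes t (Split.outer split) r

chain-decode : ∀ {n} {a₁ a₂ : Matrix n} {d b} {t} (S : Split a₁ d) r → (∀ j → Split.ρ S j ≡ δ r j) → Chain a₂ d t → + n ≡ d + b → + 1 ≤ b → + 200000 * b ≤ d →
  (∀ k → trace (pow a₁ k) ≡ trace (pow a₂ k)) → Realizes t (Split.outer S) r
chain-decode {b = b} {t} S r e C n≡ 1≤b big tr = De.decode-start t (outer-bounded S n≡) (outer-bounded C.split n≡) r C.r C.realizes (J-walks S e) (J-walks C.split C.ρ≡δ)
  where
  module C = Chain C
  module C₁ = Compare S C.split n≡ 1≤b big tr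
  module C₂ = Compare C.split S n≡ 1≤b big (λ k → sym (tr k))
  module De = Decode b (1≤⇒0≤ 1≤b) (Split.J S) (Split.J C.split) C₁.Gr.template (λ _ → refl) C₁.compare C₂.compare

-- This separates the constructed graphs: isomorphic graphs have equal traces, so distinct codes
-- exclude an isomorphism without any analysis of vertex maps.
chain-unique : ∀ {n} {a₁ a₂ : Matrix n} {d b} {t t′} → Chain a₁ d t → Chain a₂ d t′ → + n ≡ d + b → + 1 ≤ b → + 200000 * b ≤ d →
  (∀ k → trace (pow a₁ k) ≡ trace (pow a₂ k)) → t ≡ t′
chain-unique {t = t} {t′} C C′ n≡ 1≤b big tr = sym (Realizes-unique t′ t (outer-bounded C.split n≡) C.r (chain-decode C.split C.r C.ρ≡δ C′ n≡ 1≤b big tr) C.realizes)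
  where module C = Chain C

-- Excludes a mate whose clique no edge leaves. There the series `J` is zero, while that of the
-- chain has constant term 1 and no negative coefficient, so it lies above the template.
chain-attached : ∀ {n} {a₁ a₂ : Matrix n} {d b} {t} → Chain a₁ d t → (S : Split a₂ d) → (∀ j → Split.ρ S j ≡ + 0) → + n ≡ d + b → + 1 ≤ b → + 200000 * b ≤ d →
  (∀ k → trace (pow a₁ k) ≡ trace (pow a₂ k)) → ⊥
chain-attached {b = b} C S ρ≡0 n≡ 1≤b big tr = Cm.compare (const (+ 1)) 0 (Split.J C.split) 0 const-nonneg ≤-refl lower difference
  where
  module C = Chain C
  module Cm = Compare C.split S n≡ 1≤b big tr
  const-nonneg : NonNeg (const (+ 1))
  const-nonneg zero = 0≤+
  const-nonneg (suc k) = ≤-refl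
  0-x = solve 1 (λ x → ♯ 0 :- (♯ 0 :+ :- x) := x) refl
  x-0 = solve 1 (λ x → x :- ♯ 0 := x) refl
  J≈ : Split.J C.split ≈ walks (Split.outer C.split) C.r
  J≈ = J-walks C.split C.ρ≡δ
  lower : shift 0 Cm.Gr.template ⊑ Split.J C.split
  lower zero = ≡⇒≤ (trans (x-0 (+ 1)) (sym (trans (J≈ 0) (walks-zero (Split.outer C.split) C.r))))
  lower (suc zero) = ≤-trans (≡⇒≤ (x-0 (+ 0))) (Split.J-nonneg C.split 1)
  lower (suc (suc k)) = ≤-trans (≤-by (1≤⇒0≤ 1≤b ⊠ powers-nonneg (1≤⇒0≤ 1≤b) k) (0-x (b * powers b k))) (Split.J-nonneg C.split (suc (suc k)))
  difference : Split.J C.split ⊕s negs (Split.J S) ≈ const (+ 1) ⊛ Split.J C.split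
  difference j = trans (cong₂ _-_ refl (sum-0 (λ i → trans (cong₂ _*_ (ρ≡0 i) refl) (R.zeroˡ _)))) (trans (x-0 (Split.J C.split j)) (sym (⊛-identityˡ (Split.J C.split) j)))

-- At most one edge leaves the clique

find-positive : ∀ {n} (f : Fin n → ℤ) → (∀ i → + 0 ≤ f i) → (∀ i → f i ≡ + 0) ⊎ Σ (Fin n) λ i → + 1 ≤ f i
find-positive {zero} f nf = inj₁ (λ ())
find-positive {suc n} f nf with ≤-total (f zero) (+ 0) | find-positive (λ i → f (suc i)) (λ i → nf (suc i))
... | inj₂ p | _ = inj₂ (zero , ≤-trans (≡⇒≤ (sym (R.+-identityˡ _))) p)
... | inj₁ _ | inj₂ (i , p) = inj₂ (suc i , p)
... | inj₁ p | inj₁ z = inj₁ (λ { zero → ℤₚ.≤-antisym p (nf zero) ; (suc i) → z i })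

two-terms : ∀ {n} (f : Fin n → ℤ) → (∀ i → + 0 ≤ f i) → ∀ i j → ¬ (i ≡ j) → f i + f j ≤ sum f
two-terms f nf i j p = ≤-by (≤-diff (term≤sum {f = λ k → f k - δ i k * f k} g-nonneg j)) (trans (eq (f i) (f j) (sum f)) (trans (cong (λ x → sum f + - x - f j) (sym (sum-δˡ i f)))
    (trans (cong₂ _-_ (trans (cong₂ _+_ refl (sym (sum-neg _))) (sym (sum-+ _ _))) (trans (eq₀ (f j)) (cong (λ x → f j - x * f j) (sym (δ-≢ {i = i} {j} p))))) refl)))
  where
  eq = solve 3 (λ x y s → s :- (x :+ y) := s :+ :- x :- y) refl
  eq₀ = solve 1 (λ y → y := y :- ♯ 0 :* y) refl
  eq₁ = solve 1 (λ y → y :- ♯ 1 :* y := ♯ 0) refl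
  g-nonneg : ∀ k → + 0 ≤ f k - δ i k * f k
  g-nonneg k with δ-split i k
  ... | inj₁ (_ , e) = ≡⇒≤ (sym (trans (cong (λ x → f k - x * f k) e) (eq₁ _)))
  ... | inj₂ (_ , e) = ≤-trans (nf k) (≡⇒≤ (trans (eq₀ _) (cong (λ x → f k - x * f k) (sym e))))

module FromClique {n} (H : Graph n) (d : ℤ) (1≤d : + 1 ≤ d) (l : Fin n → ℤ) (l-bit : ∀ i → Bit (l i)) (l-sum : sum l ≡ d)
  (full : ∀ i j → l i * (l j * loops (A H) i j) ≡ l i * l j) where

  private
    sM : Symmetric (loops (A H))
    sM i j = cong₂ _+_ (A-sym H i j) (δ-sym i j)

  open Block (loops (A H)) sM l (λ i → bit-idem (l-bit i)) d l-sum full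

  module _ (rest-bit : ∀ i j → Bit (rest i j)) (P≤1 : P ≤ + 1) where
    private
      term : Fin n → Fin n → ℤ
      term j i = rest j i * l i

      term-bit : ∀ j i → Bit (term j i)
      term-bit j i with rest-bit j i | l-bit i
      ... | inj₁ e | _ = inj₁ (trans (cong₂ _*_ e refl) (R.zeroˡ _))
      ... | inj₂ e | inj₁ e′ = inj₁ (trans (cong₂ _*_ refl e′) (R.zeroʳ _))
      ... | inj₂ e | inj₂ e′ = inj₂ (trans (cong₂ _*_ e e′) (R.*-identityˡ _))

      out-nonneg : ∀ j → + 0 ≤ out j
      out-nonneg j = sum-≥0 (λ i → bit-≥0 (term-bit j i))

      cross-term : ∀ i j → l i * (A H i j * (+ 1 - l j)) ≡ (+ 1 - l j) * term j i
      cross-term i j = trans (eq (l i) (l j) (A H i j) (δ j i)) (trans (cong₂ (λ x y → (+ 1 - l j) * ((x + δ j i - l j * l i) * l i) - y + (l j - l j * l j) * (l i * l i)) (A-sym H i j) δ-term)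
          (trans (cong (λ x → (+ 1 - l j) * term j i - + 0 + (l j - x) * (l i * l i)) (bit-idem (l-bit j))) (eq₀ _ (l j) (l i * l i))))
        where
        eq = solve 4 (λ x y a e → x :* (a :* (♯ 1 :- y)) := (♯ 1 :- y) :* ((a :+ e :- y :* x) :* x) :- (♯ 1 :- y) :* x :* e :+ (y :- y :* y) :* (x :* x)) refl
        eq₀ = solve 3 (λ a y z → a :- ♯ 0 :+ (y :- y) :* z := a) refl
        eq₁ = solve 1 (λ y → (♯ 1 :- y) :* y :* ♯ 1 := y :- y :* y) refl
        δ-term : (+ 1 - l j) * l i * δ j i ≡ + 0
        δ-term with δ-split j i
        ... | inj₁ (refl , e) = trans (cong₂ _*_ refl e) (trans (eq₁ (l j)) (trans (cong₂ _-_ refl (bit-idem (l-bit j))) (R.-‿inverseʳ _)))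
        ... | inj₂ (_ , e) = trans (cong₂ _*_ refl e) (R.zeroʳ _)

      mk-split : ∀ v → l v ≡ + 1 → (ρ : Fin n → ℤ) → (∀ j → + 0 ≤ ρ j) → (∀ i j → (+ 1 - l j) * term j i ≡ δ v i * ρ j) → Split (A H) d
      mk-split v l-v ρ nρ c = record
        { a-sym = A-sym H ; a-bit = λ i j → bit-Bit _ ; a-diag = A-diag H ; l = l ; l-bit = l-bit ; l-sum = l-sum ; l-full = full
        ; v = v ; l-v = l-v ; ρ = ρ ; ρ-nonneg = nρ ; cross = λ i j → trans (cross-term i j) (c i j) }

    -- `P` is the sum of the squares of `out`, so P ≤ 1 leaves at most one vertex `r` with an edge
    -- into the clique, and only one such edge. If there is none, any clique vertex may serve as
    -- `v`; one exists because 1 ≤ d.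
    dichotomy : (Σ (Split (A H) d) λ S → ∀ j → Split.ρ S j ≡ + 0) ⊎ (Σ (Split (A H) d) λ S → Σ (Fin n) λ r → (∀ j → Split.ρ S j ≡ δ r j) × Split.l S r ≡ + 0)
    dichotomy with find-positive out out-nonneg
    ... | inj₁ none = inj₁ (no-edges (find-one l l-bit))
      where
      no-edges : (∀ i → l i ≡ + 0) ⊎ (Σ (Fin n) λ c → l c ≡ + 1) → Σ (Split (A H) d) λ S → ∀ j → Split.ρ S j ≡ + 0
      no-edges (inj₁ z) = ⊥-elim (1≰0 (≤-trans 1≤d (≡⇒≤ (trans (sym l-sum) (sum-0 z)))))
      no-edges (inj₂ (v , l-v)) = mk-split v l-v (λ _ → + 0) (λ _ → ≤-refl)
        (λ i j → trans (cong₂ _*_ refl (nonneg-sum-zero (λ i → bit-≥0 (term-bit j i)) (none j) i)) (trans (R.zeroʳ _) (sym (R.zeroʳ (δ v i))))) , λ _ → refl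
    ... | inj₂ (r , p) = inj₂ (one-edge (classify₁ (term r) (term-bit r)))
      where
      eq₂ = solve 1 (λ x → (♯ 1 :- ♯ 0) :* x := x :* ♯ 1) refl
      eq₃ = solve 2 (λ x y → x :* ♯ 0 := y :* ♯ 0) refl
      opaque
        unfolding _+_ _*_ -_
        2≰1 : ¬ (+ 1 * + 2 ≤ + 1)
        2≰1 (+≤+ (s≤s ()))
      others : ∀ j → ¬ (r ≡ j) → out j ≡ + 0
      others j q = square-zero (ℤₚ.≤-antisym upper (0≤sq (out j)))
        where
        square-zero : out j * out j ≡ + 0 → out j ≡ + 0
        square-zero e with mul-zero {out j} {out j} e
        ... | inj₁ z = z
        ... | inj₂ z = z
        upper : out j * out j ≤ + 0
        upper = ≤-by (≤-diff (≤-trans (two-terms (λ i → out i * out i) (λ i → 0≤sq (out i)) r j q) P≤1) ⊞ ≤-diff (≤-trans (≡⇒≤ (sym (R.*-identityˡ (+ 1)))) (*-mono {+ 1} {out r} {+ 1} 0≤+ 0≤+ p p))) (eq (out r * out r) (out j * out j))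
          where
          eq = solve 2 (λ x y → ♯ 0 :- y := (♯ 1 :- (x :+ y)) :+ (x :- ♯ 1)) refl
      one-edge : (∀ i → term r i ≡ + 0) ⊎ ((Σ (Fin n) λ c → ∀ j → term r j ≡ δ c j) ⊎ + 2 ≤ sum (term r)) →
        Σ (Split (A H) d) λ S → Σ (Fin n) λ r → (∀ j → Split.ρ S j ≡ δ r j) × Split.l S r ≡ + 0
      one-edge (inj₁ z) = ⊥-elim (1≰0 (≤-trans p (≡⇒≤ (sum-0 z))))
      one-edge (inj₂ (inj₂ q)) = ⊥-elim (2≰1 (≤-trans (*-mono {+ 1} {out r} {+ 2} 0≤+ 0≤+ p q) (≤-trans (term≤sum (λ i → 0≤sq (out i)) r) P≤1)))
      one-edge (inj₂ (inj₁ (v , e))) = mk-split v l-v (δ r) (λ j → bit-≥0 (bit-Bit (does (r ≟ j)))) cross-eq , r , (λ _ → refl) , l-r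
        where
        l-v : l v ≡ + 1
        l-v with l-bit v
        ... | inj₂ q = q
        ... | inj₁ q = ⊥-elim (1≢0 (trans (sym (trans (e v) (δ-refl v))) (trans (cong₂ _*_ refl q) (R.zeroʳ _))))
        l-r : l r ≡ + 0
        l-r with l-bit r
        ... | inj₁ q = q
        ... | inj₂ q = ⊥-elim (1≢0 (trans (sym (trans (e v) (δ-refl v))) (trans (sym (trans (cong₂ _*_ q refl) (R.*-identityˡ _))) (l-rest-l r v))))
        cross-eq : ∀ i j → (+ 1 - l j) * term j i ≡ δ v i * δ r j
        cross-eq i j with δ-split r j
        ... | inj₁ (refl , d′) = trans (cong₂ (λ x y → (+ 1 - x) * y) l-r (e i)) (trans (eq₂ _) (cong₂ _*_ refl (sym d′)))
        ... | inj₂ (q , d′) = trans (cong₂ _*_ refl (nonneg-sum-zero (λ i → bit-≥0 (term-bit j i)) (others j q) i)) (trans (eq₃ _ (δ v i)) (cong₂ _*_ refl (sym d′)))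

-- From the decoded structure to an isomorphism

enumerate : ∀ k {n} (f : Fin n → ℤ) → (∀ i → Bit (f i)) → sum f ≡ + k → Σ (Fin k → Fin n) λ e → Injective e × (∀ i → f (e i) ≡ + 1)
-- The first value is prescribed so that vertex 0 of the lollipop's clique, where the tail hangs,
-- can be sent to `v`.
enumerate-from : ∀ k {n} (f : Fin n → ℤ) → (∀ i → Bit (f i)) → sum f ≡ + suc k → ∀ c → f c ≡ + 1 → Σ (Fin (suc k) → Fin n) λ e → e zero ≡ c × Injective e × (∀ i → f (e i) ≡ + 1)
enumerate zero f bits e = (λ ()) , (λ { {()} }) , λ ()
enumerate (suc k) f bits e with find-one f bits
... | inj₁ z = ⊥-elim (suc≢0 (trans (sym e) (sum-0 z)))
  where
  suc≢0 : ¬ (+ suc k ≡ + 0)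
  suc≢0 ()
... | inj₂ (c , p) = proj₁ E , proj₂ (proj₂ E)
  where
  E : Σ (Fin (suc k) → Fin _) λ e → e zero ≡ c × Injective e × (∀ i → f (e i) ≡ + 1)
  E = enumerate-from k f bits e c p
enumerate-from k {n} f bits e c p = g , refl , (λ {i} {j} → g-inj i j) , g-one
  where
  f′ : Fin n → ℤ
  f′ i = f i - δ c i
  cancel : ∀ x y → + 1 + x ≡ + 1 + y → x ≡ y
  cancel x y q = trans (eq x) (trans (cong (λ t → t - + 1) q) (sym (eq y)))
    where
    eq = solve 1 (λ x → x := ♯ 1 :+ x :- ♯ 1) refl
  rec : Σ (Fin k → Fin n) λ e → Injective e × (∀ i → f′ (e i) ≡ + 1)
  rec = enumerate k f′ (remove-one f bits c p) (cancel _ _ (trans (sym (sum-remove-δ f c)) (trans e (suc≡1+ k))))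
  g : Fin (suc k) → Fin n
  g zero = c
  g (suc i) = proj₁ rec i
  fresh : ∀ i → ¬ (c ≡ g (suc i))
  fresh i q = 1≢0 (trans (sym (proj₂ (proj₂ rec) i)) (trans (cong f′ (sym q)) (trans (cong₂ _-_ p (δ-refl c)) (R.-‿inverseʳ _))))
  g-inj : ∀ i j → g i ≡ g j → i ≡ j
  g-inj zero zero q = refl
  g-inj zero (suc j) q = ⊥-elim (fresh j q)
  g-inj (suc i) zero q = ⊥-elim (fresh i (sym q))
  g-inj (suc i) (suc j) q = cong suc (proj₁ (proj₂ rec) q)
  g-one : ∀ i → f (g i) ≡ + 1
  g-one zero = p
  g-one (suc i) = trans (restore _ _ _ refl) (trans (cong₂ _+_ (δ-≢ {i = c} {g (suc i)} (fresh i)) (proj₂ (proj₂ rec) i)) (R.+-identityˡ _))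

injection⇒bijection : ∀ {n} (f : Fin n → Fin n) → Injective f → Σ (Fin n ↔ Fin n) λ σ → ∀ i → Inverse.to σ i ≡ f i
injection⇒bijection {n} f inj = mk↔ₛ′ f (λ y → proj₁ (preimage y)) (λ y → proj₂ (preimage y)) (λ x → inj (proj₂ (preimage (f x)))) , λ _ → refl
  where
  surjective : ∀ {n} (f : Fin n → Fin n) → Injective f → ∀ y → Σ (Fin n) λ x → f x ≡ y
  surjective {suc n} f inj y with any? (λ x → f x ≟ y)
  ... | yes q = q
  ... | no q = ⊥-elim (ℕₚ.<-irrefl refl (injective⇒≤ {f = λ x → punchOut {i = y} (λ e → q (x , sym e))} (λ {x} {x′} e → inj (punchOut-injective {i = y} _ _ e))))
  preimage : ∀ y → Σ (Fin n) λ x → f x ≡ y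
  preimage = surjective f inj

module _ (k : ℕ) (t : Code) where

  private module G = Lollipop k t
  open G using (d; m; L; T)

  chain : Chain G.a (+ d) t
  chain = record { split = G.split ; r = G.r ; ρ≡δ = λ _ → refl ; realizes = G.realizes }

  total : + (d ℕ.+ m) ≡ + d + + m
  total = pos-+ d m

  glue : (H : Graph (d ℕ.+ m)) (S : Split (A H) (+ d)) (r : Fin (d ℕ.+ m)) → (∀ j → Split.ρ S j ≡ δ r j) → Split.l S r ≡ + 0 → RootedEmbedding t (Split.outer S) r →
    (e : Fin d → Fin (d ℕ.+ m)) → e zero ≡ Split.v S → Injective e → (∀ i → Split.l S (e i) ≡ + 1) → Iso G.graph H
  glue H S r ρ≡δ l-r I e e-zero e-inj l-e = proj₁ bijection , λ x y → bit-injective _ _ (trans (cong₂ (A H) (proj₂ bijection x) (proj₂ bijection y)) (agree x y))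
    where
    open Split S
    module E = RootedEmbedding I
    l-fn : ∀ j → l (E.fn j) ≡ + 0
    l-fn j with l-bit (E.fn j)
    ... | inj₁ q = q
    -- A clique vertex has an empty row in `outer` and differs from `r`, so the embedded tail cannot
    -- contain it.
    ... | inj₂ q = ⊥-elim (E.avoids (E.fn j) (λ p → 1≢0 (trans (sym q) (trans (cong l p) l-r))) (λ i → s-outer (E.fn j) i q) j refl)
    σ : Fin (d ℕ.+ m) → Fin (d ℕ.+ m)
    σ x = [ e , E.fn ]′ (splitAt d x)
    σ-L : ∀ i → σ (L i) ≡ e i
    σ-L i = cong [ e , E.fn ]′ (splitAt-↑ˡ d i m)
    σ-T : ∀ j → σ (T j) ≡ E.fn j
    σ-T j = cong [ e , E.fn ]′ (splitAt-↑ʳ d m j)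
    apart : ∀ {i j} → ¬ (e i ≡ E.fn j)
    apart {i} {j} q = 1≢0 (trans (sym (l-e i)) (trans (cong l q) (l-fn j)))
    σ-inj : ∀ x y → σ x ≡ σ y → x ≡ y
    σ-inj = G.elim _ (λ i → G.elim _ (λ j q → cong L (e-inj (trans (sym (σ-L i)) (trans q (σ-L j))))) (λ j q → ⊥-elim (apart (trans (sym (σ-L i)) (trans q (σ-T j))))))
      (λ i → G.elim _ (λ j q → ⊥-elim (apart (trans (sym (σ-L j)) (trans (sym q) (σ-T i))))) (λ j q → cong T (E.injective (trans (sym (σ-T i)) (trans q (σ-T j))))))
    bijection : Σ (Fin (d ℕ.+ m) ↔ Fin (d ℕ.+ m)) λ τ → ∀ i → Inverse.to τ i ≡ σ i
    bijection = injection⇒bijection σ (λ {x} {y} → σ-inj x y)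
    eq₁ = solve 2 (λ a e → a := ♯ 1 :* (♯ 1 :* (a :+ e)) :- e) refl
    eq₃ = solve 1 (λ a → a := ♯ 1 :* (a :* (♯ 1 :- ♯ 0))) refl
    opaque
      unfolding _+_ _*_ -_
      eq₂ : + 1 * + 1 ≡ + 1
      eq₂ = refl
    agree-ee : ∀ i j → A H (e i) (e j) ≡ + 1 - δ i j
    agree-ee i j = trans (eq₁ (A H (e i) (e j)) (δ (e i) (e j))) (trans (cong (λ x → x - δ (e i) (e j)) (trans (cong₂ (λ x y → x * (y * loops (A H) (e i) (e j))) (sym (l-e i)) (sym (l-e j))) (trans (l-full (e i) (e j)) (trans (cong₂ _*_ (l-e i) (l-e j)) eq₂))))
      (cong₂ _-_ refl (δ-injective e-inj i j)))
    agree-ef : ∀ i j → A H (e i) (E.fn j) ≡ δ zero i * δ (root t) j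
    agree-ef i j = trans (eq₃ _) (trans (cong₂ (λ x y → x * (A H (e i) (E.fn j) * (+ 1 - y))) (sym (l-e i)) (sym (l-fn j))) (trans (cross (e i) (E.fn j))
      (cong₂ _*_ (trans (cong (λ x → δ x (e i)) (sym e-zero)) (δ-injective e-inj zero i)) (trans (ρ≡δ (E.fn j)) (trans (cong (λ x → δ x (E.fn j)) (sym E.fn-root)) (δ-injective E.injective (root t) j))))))
    agree-ff : ∀ i j → A H (E.fn i) (E.fn j) ≡ A (tree t) i j
    agree-ff i j = trans (sym (outer-inside S (l-fn i) (l-fn j))) (E.agree i j)
    agree : ∀ x y → A H (σ x) (σ y) ≡ A G.graph x y
    agree = G.elim _ (λ i → G.elim _ (λ j → trans (cong₂ (A H) (σ-L i) (σ-L j)) (trans (agree-ee i j) (sym (G.a-LL i j)))) (λ j → trans (cong₂ (A H) (σ-L i) (σ-T j)) (trans (agree-ef i j) (sym (G.a-LT i j)))))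
      (λ i → G.elim _ (λ j → trans (cong₂ (A H) (σ-T i) (σ-L j)) (trans (A-sym H _ _) (trans (agree-ef j i) (sym (G.a-TL i j))))) (λ j → trans (cong₂ (A H) (σ-T i) (σ-T j)) (trans (agree-ff i j) (sym (G.a-TT i j)))))

  chain⇒iso : (H : Graph (d ℕ.+ m)) (S : Split (A H) (+ d)) (r : Fin (d ℕ.+ m)) → (∀ j → Split.ρ S j ≡ δ r j) → Split.l S r ≡ + 0 → Realizes t (Split.outer S) r → Iso G.graph H
  chain⇒iso H S r ρ≡δ l-r real with enumerate-from k (Split.l S) (Split.l-bit S) (Split.l-sum S) (Split.v S) (Split.l-v S)
  ... | e , e-zero , e-inj , l-e = glue H S r ρ≡δ l-r (embed t (outer-bounded S total) r real) e e-zero e-inj l-e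

  module _ (big : + 200000 * + m ≤ + d) (H : Graph (d ℕ.+ m)) (cospectral : Cospectral G.graph H) where
    private
      tr : ∀ j → trace (pow (A H) j) ≡ trace (pow G.a j)
      tr j = sym (cospectral-trace G.graph H cospectral j)

      sym-loops : ∀ {n} (H : Graph n) → Symmetric (loops (A H))
      sym-loops H i j = cong₂ _+_ (A-sym H i j) (δ-sym i j)

      loops-bit : ∀ {n} (H : Graph n) i j → Bit (loops (A H) i j)
      loops-bit H i j with δ-split i j
      ... | inj₁ (refl , e) = inj₂ (trans (cong₂ _+_ (A-diag H i) e) (R.+-identityˡ _))
      ... | inj₂ (_ , e) = subst Bit (sym (trans (cong₂ _+_ refl e) (R.+-identityʳ _))) (bit-Bit (adj H i j))

      loops-diag : ∀ {n} (H : Graph n) i → loops (A H) i i ≡ + 1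
      loops-diag H i = trans (cong₂ _+_ (A-diag H i) (δ-refl i)) (R.+-identityˡ _)

      module Inv = Invariants (loops (A H)) (loops G.a) (sym-loops H) (sym-loops G.graph) (loops-trace (A H) G.a tr)

      module X = CliqueExtraction (loops (A H)) (sym-loops H) (loops-bit H) (loops-diag H) (+ d) (+ m) G.Bd.weight total G.1≤m big
        (sum₂-≥0 (λ x y → bit-≥0 (G.rest-bit x y))) G.weight≤
        (trans Inv.⟨1,1⟩ (G.Bd.second-moment (λ x y → bit-idem (loops-bit G.graph x y))))
        (≤-trans G.Bd.third-bound (≡⇒≤ (sym Inv.⟨2,1⟩)))
        (≤-trans (≡⇒≤ Inv.⟨2,2⟩) G.Bd.fourth-bound)
        (≤-trans (≡⇒≤ (Inv.defect-norm (+ d))) (G.V≤ big))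
        (≤-trans (≡⇒≤ (Inv.defect₂-norm (+ d))) (G.F≤ big))

      module F = FromClique H (+ d) (+≤+ (s≤s z≤n)) X.l X.l-bit X.l-sum X.full

    decoded : (S : Split (A H) (+ d)) (r : Fin (d ℕ.+ m)) → (∀ j → Split.ρ S j ≡ δ r j) → Realizes t (Split.outer S) r
    decoded S r ρ≡δ = chain-decode {a₁ = A H} {a₂ = G.a} {d = + d} {b = + m} {t = t} S r ρ≡δ chain total G.1≤m big tr

    cospectral⇒iso : Iso G.graph H
    cospectral⇒iso = by-cases (F.dichotomy X.rest-bit X.P≤1)
      where
      by-cases : (Σ (Split (A H) (+ d)) λ S → ∀ j → Split.ρ S j ≡ + 0) ⊎ (Σ (Split (A H) (+ d)) λ S → Σ (Fin (d ℕ.+ m)) λ r → (∀ j → Split.ρ S j ≡ δ r j) × Split.l S r ≡ + 0) → Iso G.graph H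
      by-cases (inj₁ (S , ρ≡0)) = ⊥-elim (chain-attached chain S ρ≡0 total G.1≤m big (λ j → sym (tr j)))
      by-cases (inj₂ (S , r , ρ≡δ , l-r)) = chain⇒iso H S r ρ≡δ l-r (decoded S r ρ≡δ)

lollipop-DS : ∀ k t → + 200000 * + size t ≤ + suc k → DS (Lollipop.graph k t)
lollipop-DS k t big m H c = same-size m H c (ℕₚ.≤-antisym (ℕₚ.≮⇒≥ (cospectral-size H (Lollipop.graph k t) (λ i → sym (c i)))) (ℕₚ.≮⇒≥ (cospectral-size (Lollipop.graph k t) H c)))
  where
  same-size : ∀ m (H : Graph m) → Cospectral (Lollipop.graph k t) H → suc k ℕ.+ size t ≡ m → Iso (Lollipop.graph k t) H
  same-size m H c refl = cospectral⇒iso k t big H c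

-- Exponentially many pairwise non-isomorphic lollipops

iso-trace : ∀ {n} (G H : Graph n) → Iso G H → ∀ k → trace (pow (A G) k) ≡ trace (pow (A H) k)
iso-trace G H (σ , e) k = trans (sum-cong (λ i → sym (pow-σ k i i))) (sym (sum-permute (λ i → pow (A H) k i i) σ))
  where
  σ-inj : Injective (Inverse.to σ)
  σ-inj {i} {j} q = trans (sym (Inverse.strictlyInverseʳ σ i)) (trans (cong (Inverse.from σ) q) (Inverse.strictlyInverseʳ σ j))
  pow-σ : ∀ k i j → pow (A H) k (Inverse.to σ i) (Inverse.to σ j) ≡ pow (A G) k i j
  pow-σ zero i j = δ-injective σ-inj i j
  pow-σ (suc k) i j = trans (sum-permute _ σ) (sum-cong (λ l → cong₂ _*_ (cong bit (e i l)) (pow-σ k l j)))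

step-injective : ∀ {t u} → step t ≡ step u → t ≡ u
step-injective refl = refl

fork-injective : ∀ {t u} → fork t ≡ fork u → t ≡ u
fork-injective refl = refl

SizedCode : ℕ → Set
SizedCode s = Σ Code λ t → size t ≡ s

_≉_ : ∀ {s} → SizedCode s → SizedCode s → Set
x ≉ y = ¬ (proj₁ x ≡ proj₁ y)

-- Both blocks have four vertices, so a word of ℓ blocks has 1 + 4 ℓ vertices whatever the choices.
step-fork fork-step : ∀ {s} → SizedCode s → SizedCode (4 ℕ.+ s)
step-fork (t , e) = step (fork t) , cong (4 ℕ.+_) e
fork-step (t , e) = fork (step t) , cong (4 ℕ.+_) e

codes : ∀ ℓ → List (SizedCode (suc (ℓ ℕ.* 4)))
codes zero = (tip , refl) ∷ []
codes (suc ℓ) = map step-fork (codes ℓ) ++ map fork-step (codes ℓ)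

codes-length : ∀ ℓ → length (codes ℓ) ≡ 2 ℕ.^ ℓ
codes-length zero = refl
codes-length (suc ℓ) = begin
  length (map step-fork (codes ℓ) ++ map fork-step (codes ℓ))              ≡⟨ length-++ (map step-fork (codes ℓ)) ⟩
  length (map step-fork (codes ℓ)) ℕ.+ length (map fork-step (codes ℓ))    ≡⟨ cong₂ ℕ._+_ (length-map step-fork (codes ℓ)) (length-map fork-step (codes ℓ)) ⟩
  length (codes ℓ) ℕ.+ length (codes ℓ)                                    ≡⟨ cong (λ x → x ℕ.+ x) (codes-length ℓ) ⟩
  2 ℕ.^ ℓ ℕ.+ 2 ℕ.^ ℓ                                                      ≡⟨ cong (2 ℕ.^ ℓ ℕ.+_) (sym (ℕₚ.+-identityʳ _)) ⟩
  2 ℕ.^ suc ℓ                                                              ∎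
  where open ≡-Reasoning

-- Codes from different halves of the list begin with different constructors; within a half, the
-- common prefix is stripped by injectivity.
codes-distinct : ∀ ℓ → AllPairs _≉_ (codes ℓ)
codes-distinct zero = [] ∷ []
codes-distinct (suc ℓ) = AllPairsₚ.++⁺
  (AllPairsₚ.map⁺ (AllPairs.map (λ p e → p (fork-injective (step-injective e))) (codes-distinct ℓ)))
  (AllPairsₚ.map⁺ (AllPairs.map (λ p e → p (step-injective (fork-injective e))) (codes-distinct ℓ)))
  (Allₚ.map⁺ (All.universal (λ _ → Allₚ.map⁺ (All.universal (λ _ ()) (codes ℓ))) (codes ℓ)))

-- With ℓ = ⌊n / (5 (K + 1))⌋ the tail takes s = 1 + 4 ℓ ≤ 5 ℓ of the n vertices and leaves at least K s to the clique.
sizes : ∀ K n → 1 ℕ.≤ K → suc K ℕ.* 5 ℕ.≤ n → Σ ℕ λ ℓ → Σ ℕ λ k →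
  suc k ℕ.+ suc (ℓ ℕ.* 4) ≡ n × K ℕ.* suc (ℓ ℕ.* 4) ℕ.≤ suc k × n ℕ.≤ ℓ ℕ.* (suc K ℕ.* 5 ℕ.* 2)
sizes K n 1≤K M≤n = ℓ , positive-part (n ℕ.∸ s) (ℕₚ.m+[n∸m]≡n s≤n) Ks≤d
  where
  M ℓ s : ℕ
  M = suc K ℕ.* 5
  ℓ = n / M
  s = suc (ℓ ℕ.* 4)
  1≤ℓ : 1 ℕ.≤ ℓ
  1≤ℓ = m≥n⇒m/n>0 M≤n
  ℓM≤n : ℓ ℕ.* M ℕ.≤ n
  ℓM≤n = ℕₚ.≤-trans (ℕₚ.m≤n+m _ (n % M)) (ℕₚ.≤-reflexive (sym (m≡m%n+[m/n]*n n M)))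
  s≤5ℓ : s ℕ.≤ 5 ℕ.* ℓ
  s≤5ℓ = ℕₚ.+-mono-≤ 1≤ℓ (ℕₚ.≤-reflexive (ℕₚ.*-comm ℓ 4))
  s+Ks≤n : s ℕ.+ K ℕ.* s ℕ.≤ n
  s+Ks≤n = begin
    suc K ℕ.* s            ≤⟨ ℕₚ.*-monoʳ-≤ (suc K) s≤5ℓ ⟩
    suc K ℕ.* (5 ℕ.* ℓ)    ≡⟨ ℕₚ.*-assoc (suc K) 5 ℓ ⟨
    M ℕ.* ℓ                ≡⟨ ℕₚ.*-comm M ℓ ⟩
    ℓ ℕ.* M                ≤⟨ ℓM≤n ⟩
    n                      ∎
    where open ℕₚ.≤-Reasoning
  s≤n : s ℕ.≤ n
  s≤n = ℕₚ.m+n≤o⇒m≤o s s+Ks≤n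
  Ks≤d : K ℕ.* s ℕ.≤ n ℕ.∸ s
  Ks≤d = ℕₚ.m+n≤o⇒m≤o∸n (K ℕ.* s) (ℕₚ.≤-trans (ℕₚ.≤-reflexive (ℕₚ.+-comm (K ℕ.* s) s)) s+Ks≤n)
  n≤ : n ℕ.≤ ℓ ℕ.* (M ℕ.* 2)
  n≤ = begin
    n                        ≡⟨ m≡m%n+[m/n]*n n M ⟩
    n % M ℕ.+ ℓ ℕ.* M        ≤⟨ ℕₚ.+-monoˡ-≤ (ℓ ℕ.* M) (ℕₚ.<⇒≤ (m%n<n n M)) ⟩
    M ℕ.+ ℓ ℕ.* M            ≤⟨ ℕₚ.+-monoˡ-≤ (ℓ ℕ.* M) (ℕₚ.m≤n*m M ℓ {{ℕ.>-nonZero 1≤ℓ}}) ⟩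
    ℓ ℕ.* M ℕ.+ ℓ ℕ.* M      ≡⟨ ℕₚ.*-distribˡ-+ ℓ M M ⟨
    ℓ ℕ.* (M ℕ.+ M)          ≡⟨ cong (λ x → ℓ ℕ.* (M ℕ.+ x)) (sym (ℕₚ.+-identityʳ M)) ⟩
    ℓ ℕ.* (2 ℕ.* M)          ≡⟨ cong (ℓ ℕ.*_) (ℕₚ.*-comm 2 M) ⟩
    ℓ ℕ.* (M ℕ.* 2)          ∎
    where open ℕₚ.≤-Reasoning
  positive-part : ∀ d → s ℕ.+ d ≡ n → K ℕ.* s ℕ.≤ d → Σ ℕ λ k → suc k ℕ.+ s ≡ n × K ℕ.* s ℕ.≤ suc k × n ℕ.≤ ℓ ℕ.* (M ℕ.* 2)
  positive-part zero e Ks≤0 = ⊥-elim (ℕₚ.<⇒≱ (ℕₚ.*-mono-≤ 1≤K (s≤s z≤n)) Ks≤0)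
  positive-part (suc k) e Ks≤d = k , trans (ℕₚ.+-comm (suc k) s) e , Ks≤d , n≤

module _ {n k s : ℕ} (e : suc k ℕ.+ s ≡ n) where

  sized-graph : SizedCode s → Graph n
  sized-graph (t , e′) = subst Graph (trans (cong (suc k ℕ.+_) e′) e) (Lollipop.graph k t)

sized-DS : ∀ {n k s} (e : suc k ℕ.+ s ≡ n) → + 200000 * + s ≤ + suc k → ∀ x → DS (sized-graph {s = s} e x)
sized-DS {k = k} refl big (t , refl) = lollipop-DS k t big

sized-chain : ∀ {n k s} (e : suc k ℕ.+ s ≡ n) (x : SizedCode s) → Chain (A (sized-graph e x)) (+ suc k) (proj₁ x)
sized-chain {k = k} refl (t , refl) = chain k t

sized-distinct : ∀ {n k s} (e : suc k ℕ.+ suc s ≡ n) → + 200000 * + suc s ≤ + suc k → ∀ {x y} → x ≉ y → ¬ Iso (sized-graph e x) (sized-graph e y)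
sized-distinct {k = k} {s} e big {x} {y} x≉y iso = x≉y (chain-unique (sized-chain e x) (sized-chain e y) (trans (cong +_ (sym e)) (pos-+ (suc k) (suc s))) (+≤+ (s≤s z≤n)) big (iso-trace (sized-graph e x) (sized-graph e y) iso))

-- K stands for 200000; as a variable it keeps Agda from unfolding products with the literal.
many-DS : ∀ K → 1 ℕ.≤ K → K ≡ 200000 → ∀ n → suc K ℕ.* 5 ℕ.≤ n → Σ (List (Graph n)) λ Gs →
  All DS Gs × AllPairs (λ G H → ¬ Iso G H) Gs × (2 ℕ.^ n ℕ.≤ length Gs ℕ.^ (suc K ℕ.* 5 ℕ.* 2))
many-DS K 1≤K K≡ n large with sizes K n 1≤K large
... | ℓ , k , e , Ks≤d , n≤ = map (sized-graph e) (codes ℓ) , Allₚ.map⁺ (All.universal (sized-DS e big) (codes ℓ)) , AllPairsₚ.map⁺ (AllPairs.map (λ {x} {y} → sized-distinct e big {x} {y}) (codes-distinct ℓ)) , count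
  where
  big : + 200000 * + suc (ℓ ℕ.* 4) ≤ + suc k
  big = subst (λ c → + c * + suc (ℓ ℕ.* 4) ≤ + suc k) K≡ (≤-trans (≡⇒≤ (sym (pos-* K (suc (ℓ ℕ.* 4))))) (+≤+ Ks≤d))
  count : 2 ℕ.^ n ℕ.≤ length (map (sized-graph e) (codes ℓ)) ℕ.^ (suc K ℕ.* 5 ℕ.* 2)
  count = begin
    2 ℕ.^ n                                                                 ≤⟨ ℕₚ.^-monoʳ-≤ 2 n≤ ⟩
    2 ℕ.^ (ℓ ℕ.* (suc K ℕ.* 5 ℕ.* 2))                                       ≡⟨ ℕₚ.^-*-assoc 2 ℓ (suc K ℕ.* 5 ℕ.* 2) ⟨
    (2 ℕ.^ ℓ) ℕ.^ (suc K ℕ.* 5 ℕ.* 2)                                       ≡⟨ cong (ℕ._^ (suc K ℕ.* 5 ℕ.* 2)) (sym (trans (length-map (sized-graph e) (codes ℓ)) (codes-length ℓ))) ⟩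
    length (map (sized-graph e) (codes ℓ)) ℕ.^ (suc K ℕ.* 5 ℕ.* 2)          ∎
    where open ℕₚ.≤-Reasoning

theorem1p4 : Σ ℕ λ k → (1 ℕ.≤ k) × Σ ℕ λ N → ∀ n → N ℕ.≤ n →
    Σ (List (Graph n)) λ Gs →
    All DS Gs × AllPairs (λ G H → ¬ Iso G H) Gs × (2 ℕ.^ n ℕ.≤ length Gs ℕ.^ k)
-- 2^n ≤ |Gs|^k means |Gs| ≥ e^(c n) with c = ln 2 / k. Here k = 10 * 200001, and 5 * 200001 is the
-- least n for which the tail has a block.
theorem1p4 = 2000010 , s≤s z≤n , 1000005 , many-DS 200000 (s≤s z≤n) refl
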